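{- The total search problem Ward-Szabó belongs to the complexity class $\mathsf{PPP}$.
   Context: The problem Ward-Szabó: the input is a Boolean circuit $C:\{0,1\}^{2n}\times\{0,1\}^{2n}\to\{0,1\}^n$ (viewed as assigning a colour to each edge of the complete graph on vertex set $\{0,1\}^{2n}$) together with three distinct nodes $a,b,c\in\{0,1\}^{2n}$ with $C(a,b)\neq C(a,c)$. A solution is either (1) three distinct nodes $x,y,z\in\{0,1\}^{2n}$ with $C(x,y)=C(x,z)\neq C(y,z)$, or (2) two distinct nodes $x,y$ with $C(x,y)\neq C(y,x)$. A polynomial-time reduction from a search problem $R$ to a search problem $S$ consists of polynomial-time computable functions $f,g$ such that whenever $y$ is a solution of $S$ on input $f(x)$, $g(x,y)$ is a solution of $R$ on input $x$. The problem Pigeon: given a Boolean circuit $f:\{0,1\}^n\to\{0,1\}^n$ and $v^*\in\{0,1\}^n$, find either $x$ with $f(x)=v^*$ or two distinct $x,y$ with $f(x)=f(y)$. $\mathsf{PPP}$ is the class of all search problems polynomial-time reducible to Pigeon. -}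

module Defs where

open import Data.Nat using (ℕ; zero; suc; _+_; _*_; _^_; _≤_)
open import Data.Fin using (Fin; toℕ; fromℕ; inject₁)
open import Data.Bool using (Bool; true; false; _∧_; _∨_; not)
open import Data.List as L using (List; []; _∷_; _++_; length; replicate; concatMap)
open import Data.Vec as V using (Vec; lookup; _∷ʳ_; toList)
open import Data.Product using (Σ; _×_; _,_; ∃)
open import Data.Sum using (_⊎_; inj₁; inj₂)
open import Data.Unit using (⊤; tt)
open import Data.Empty using (⊥)
open import Relation.Binary.PropositionalEquality using (_≡_; _≢_)

BitString : Set
BitString = List Bool

SearchProblem : Set₁
SearchProblem = BitString → BitString → Set

data Sym : Set where
  blank : Sym
  bit   : Bool → Sym

data Move : Set where
  left right stay : Move

record TM : Set where
  field
    Q     : ℕ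
    start : Fin Q
    -- inj₂ tt = halt (after writing and moving)
    δ     : Fin Q → Sym → (Fin Q ⊎ ⊤) × Sym × Move

record Config (Q : ℕ) : Set where
  constructor cfg
  field
    state : Fin Q ⊎ ⊤
    lft   : List Sym   -- cells to the left of the head, nearest first
    hd    : Sym
    rgt   : List Sym   -- cells to the right of the head, nearest first

moveHead : Move → List Sym → Sym → List Sym → List Sym × Sym × List Sym
moveHead left  []       h r        = [] , h , r
moveHead left  (l ∷ ls) h r        = ls , l , h ∷ r
moveHead right ls       h []       = h ∷ ls , blank , []
moveHead right ls       h (r ∷ rs) = h ∷ ls , r , rs
moveHead stay  ls       h r        = ls , h , r

step : (M : TM) → Config (TM.Q M) → Config (TM.Q M)
step M (cfg (inj₂ tt) l h r) = cfg (inj₂ tt) l h r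
step M (cfg (inj₁ q) l h r) with TM.δ M q h
... | q′ , w , m with moveHead m l w r
...   | l′ , h′ , r′ = cfg q′ l′ h′ r′

run : (M : TM) → ℕ → Config (TM.Q M) → Config (TM.Q M)
run M zero    c = c
run M (suc t) c = run M t (step M c)

initial : (M : TM) → BitString → Config (TM.Q M)
initial M []       = cfg (inj₁ (TM.start M)) [] blank []
initial M (b ∷ bs) = cfg (inj₁ (TM.start M)) [] (bit b) (L.map bit bs)

Halted : ∀ {Q} → Config Q → Set
Halted (cfg (inj₁ _) _ _ _) = ⊥
Halted (cfg (inj₂ _) _ _ _) = ⊤

readBits : List Sym → BitString
readBits []            = []
readBits (blank ∷ _)   = []
readBits (bit b ∷ ss)  = b ∷ readBits ss

output : ∀ {Q} → Config Q → BitString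
output (cfg _ _ h r) = readBits (h ∷ r)

HaltsWithin : TM → BitString → ℕ → BitString → Set
HaltsWithin M x t y = Halted (run M t (initial M x)) × output (run M t (initial M x)) ≡ y

PolyTime : (BitString → BitString) → Set
PolyTime f = Σ TM λ M → Σ ℕ λ c → Σ ℕ λ k →
  ∀ x → HaltsWithin M x (c * length x ^ k + c) (f x)

selfDelim : BitString → BitString
selfDelim x = concatMap (λ b → true ∷ b ∷ []) x ++ false ∷ []

pairEnc : BitString → BitString → BitString
pairEnc x y = selfDelim x ++ y

PolyTime₂ : (BitString → BitString → BitString) → Set
PolyTime₂ g = Σ TM λ M → Σ ℕ λ c → Σ ℕ λ k →
  ∀ x y → HaltsWithin M (pairEnc x y) (c * length (pairEnc x y) ^ k + c) (g x y)

Reduces : SearchProblem → SearchProblem → Set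
Reduces R S = Σ (BitString → BitString) λ f → Σ (BitString → BitString → BitString) λ g →
  PolyTime f × PolyTime₂ g × (∀ x y → S (f x) y → R x (g x y))

data Gate (w : ℕ) : Set where
  AND OR : Fin w → Fin w → Gate w
  NOT    : Fin w → Gate w

-- Gates w v : a sequence of gates taking w wires to v wires
-- (each gate reads earlier wires and adds one new wire)
data Gates : ℕ → ℕ → Set where
  done : ∀ {w} → Gates w w
  _∷_  : ∀ {w v} → Gate w → Gates (suc w) v → Gates w v

record Circuit (n m : ℕ) : Set where
  constructor circuit
  field
    width   : ℕ
    gates   : Gates n width
    outputs : Vec (Fin width) m

evalGate : ∀ {w} → Gate w → Vec Bool w → Bool
evalGate (AND i j) x = lookup x i ∧ lookup x j
evalGate (OR i j)  x = lookup x i ∨ lookup x j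
evalGate (NOT i)   x = not (lookup x i)

evalGates : ∀ {w v} → Gates w v → Vec Bool w → Vec Bool v
evalGates done     x = x
evalGates (g ∷ gs) x = evalGates gs (x ∷ʳ evalGate g x)

eval : ∀ {n m} → Circuit n m → Vec Bool n → Vec Bool m
eval (circuit _ gs out) x = V.map (lookup (evalGates gs x)) out

encℕ : ℕ → BitString
encℕ k = replicate k true ++ false ∷ []

encGate : ∀ {w} → Gate w → BitString
encGate (AND i j) = encℕ 0 ++ encℕ (toℕ i) ++ encℕ (toℕ j)
encGate (OR i j)  = encℕ 1 ++ encℕ (toℕ i) ++ encℕ (toℕ j)
encGate (NOT i)   = encℕ 2 ++ encℕ (toℕ i)

encGates : ∀ {w v} → Gates w v → BitString
encGates done     = false ∷ []
encGates (g ∷ gs) = true ∷ encGate g ++ encGates gs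

encCircuit : ∀ {n m} → Circuit n m → BitString
encCircuit (circuit w gs out) =
  encℕ w ++ encGates gs ++ concatMap (λ i → encℕ (toℕ i)) (toList out)

record WSInstance : Set where
  constructor wsInst
  field
    n     : ℕ
    C     : Circuit (2 * n + 2 * n) n
    a b c : Vec Bool (2 * n)

encWS : WSInstance → BitString
encWS (wsInst n C a b c) = encℕ n ++ encCircuit C ++ toList a ++ toList b ++ toList c

colour : (I : WSInstance) → Vec Bool (2 * WSInstance.n I) → Vec Bool (2 * WSInstance.n I)
       → Vec Bool (WSInstance.n I)
colour I x y = eval (WSInstance.C I) (x V.++ y)

WSPromise : WSInstance → Set
WSPromise I = a ≢ b × a ≢ c × b ≢ c × colour I a b ≢ colour I a c
  where open WSInstance I

data WSSolution (I : WSInstance) : Set where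
  triangle : (x y z : Vec Bool (2 * WSInstance.n I)) →
             x ≢ y → x ≢ z → y ≢ z →
             colour I x y ≡ colour I x z → colour I x y ≢ colour I y z →
             WSSolution I
  asymm    : (x y : Vec Bool (2 * WSInstance.n I)) → x ≢ y →
             colour I x y ≢ colour I y x → WSSolution I

encWSSol : ∀ {I} → WSSolution I → BitString
encWSSol (triangle x y z _ _ _ _ _) = false ∷ toList x ++ toList y ++ toList z
encWSSol (asymm x y _ _)            = true ∷ toList x ++ toList y

-- strings that are not encodings of instances satisfying the promise
-- have every string as a solution
WardSzabo : SearchProblem
WardSzabo s t = ∀ (I : WSInstance) → s ≡ encWS I → WSPromise I →
  Σ (WSSolution I) λ σ → t ≡ encWSSol σ

record PigeonInstance : Set where
  constructor pigInst
  field
    n  : ℕ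
    f  : Circuit n n
    v* : Vec Bool n

encPigeon : PigeonInstance → BitString
encPigeon (pigInst n f v) = encℕ n ++ encCircuit f ++ toList v

data PigeonSolution (I : PigeonInstance) : Set where
  preimage  : (x : Vec Bool (PigeonInstance.n I)) →
              eval (PigeonInstance.f I) x ≡ PigeonInstance.v* I → PigeonSolution I
  collision : (x y : Vec Bool (PigeonInstance.n I)) → x ≢ y →
              eval (PigeonInstance.f I) x ≡ eval (PigeonInstance.f I) y → PigeonSolution I

encPigeonSol : ∀ {I} → PigeonSolution I → BitString
encPigeonSol (preimage x _)      = false ∷ toList x
encPigeonSol (collision x y _ _) = true ∷ toList x ++ toList y

Pigeon : SearchProblem
Pigeon s t = ∀ (I : PigeonInstance) → s ≡ encPigeon I →
  Σ (PigeonSolution I) λ σ → t ≡ encPigeonSol σ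

InPPP : SearchProblem → Set
InPPP R = Reduces R Pigeon

{-# OPTIONS --safe #-}
module Submission where

-- Let α(x) = C(a,x). For every x one of b and c, call it w(x), satisfies C(a,w) ≠ α(x): fix a position j where
-- C(a,b) and C(a,c) differ, and choose w(x) by the j-th bit of α(x). The Pigeon instance is the map
-- x ↦ (C(a,x), C(w(x),x)) with v* = 0…0. A collision x, y, or a preimage x of a diagonal value, yields a
-- bichromatic triangle or an asymmetric edge among a, b, c, x, y, also when x = a or y = a, so that a needs no
-- special treatment in the circuit; the solution is found by testing a fixed list of candidates.
--
-- The circuit of that map contains C twice, each time preceded by gates copying its inputs to consecutive
-- wires, so that a copy of C is C with all wire numbers shifted by a constant.
--
-- Polynomial time is obtained from a language of programs on bit string registers whose loops run at most as
-- many rounds as the input has bits: every program halts in polynomial time on every input, malformed ones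
-- included. The registers lie on the tape side by side, separated by blanks.

-- If C(a,x) = C(w,x) while C(a,w) ≠ C(a,x), then x, a, w is a bichromatic triangle unless an edge
-- is asymmetric; this is what any value with two equal halves yields. For a collision x, y the
-- first halves agree, so w(x) = w(y) = w, because w depends on α alone, and C(w,x) = C(w,y). Unless
-- a, x, y or w, x, y is bichromatic, both common colours equal C(x,y), and the previous case
-- applies. Choosing w by a single bit instead of comparing colours turns the choice into a bitwise
-- multiplexer: exactly one of C(a,b), C(a,c) disagrees with α(x) at position j.
--
-- The obstacle is that both functions have to be actual single-tape machines. Bounded loops make
-- the running time a syntactic matter, but shift the burden to correctness: on a well-formed
-- instance no loop may be cut short by its clock. Hence the many hypotheses of the form L < N. They
-- hold because the encoding of an instance spells out n and the number of wires in unary, so that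
-- every quantity occurring in a loop is smaller than the length of the input.

open import Defs
open import Data.Nat using (ℕ; zero; suc; _+_; _*_; _^_; _≤_; _<_; z≤n; s≤s; _∸_)
open import Data.Nat.Properties
open import Data.Nat.Tactic.RingSolver using (solve-∀)
open import Data.Fin using (Fin; zero; suc; toℕ; #_; fromℕ<; _↑ʳ_)
import Data.Fin.Properties as Finₚ
open import Data.Bool using (Bool; true; false; _∧_; _∨_; not; if_then_else_)
open import Data.Bool.Properties using (∨-idem) renaming (_≟_ to _≟ᵇ_)
open import Data.List using (List; []; _∷_; [_]; _++_; _ʳ++_; length; map; reverse; replicate; concatMap; drop)
open import Data.List.Properties using (++-assoc; ++-identityʳ; length-++; length-map; length-replicate; map-++; ∷-injective; ʳ++-defn; ++-ʳ++; reverse-map; reverse-involutive; length-reverse; drop-[]; length-drop; map-∘; map-cong; map-cong-local; concatMap-++; ≡-dec)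
open import Data.List.Relation.Unary.All using (All; []; _∷_)
import Data.List.Relation.Unary.All as All
import Data.List.Relation.Unary.All.Properties as Allₚ
open import Data.List.Relation.Unary.Any using (here; there; index)
import Data.List.Relation.Unary.Any as Any
open import Data.List.Relation.Unary.Any.Properties using (lookup-index)
open import Data.List.Membership.Propositional using (_∈_)
open import Data.List.Membership.Propositional.Properties using (∈-map⁺; ∈-++⁺ˡ; ∈-++⁺ʳ; ∈-concatMap⁺)
open import Data.Vec using (Vec; []; _∷_; _∷ʳ_; lookup; toList; _[_]≔_)
import Data.Vec as Vec
import Data.Vec.Properties as Vecₚ
open import Data.Maybe using (Maybe; just; nothing)
open import Data.Product using (Σ; Σ-syntax; ∃-syntax; _×_; _,_; proj₁; proj₂)
open import Data.Sum using (_⊎_; inj₁; inj₂)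
open import Data.Unit using (⊤; tt)
open import Data.Empty using (⊥)
open import Function using (_∘_)
open import Relation.Nullary using (¬_; Dec; yes; no; contradiction)
open import Relation.Binary.PropositionalEquality using (_≡_; _≢_; refl; sym; trans; cong; cong₂; subst; subst₂; module ≡-Reasoning)

-- Composable Turing machines

Tape : Set
Tape = List Sym × Sym × List Sym

bits : BitString → List Sym
bits = map bit

at : List Sym → List Sym → Tape
at l []      = l , blank , []
at l (x ∷ s) = l , x , s

-- Repetitions in the list are allowed: states are numbered by their position in it, and only
-- decoding after coding has to be the identity.
record Finite (A : Set) : Set where
  no-eta-equality
  field
    elements : List A
    complete : ∀ a → a ∈ elements
open Finite public

⊤-finite : Finite ⊤
⊤-finite .elements   = tt ∷ []
⊤-finite .complete _ = here refl

Bool-finite : Finite Bool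
Bool-finite .elements       = false ∷ true ∷ []
Bool-finite .complete false = here refl
Bool-finite .complete true  = there (here refl)

Sym-finite : Finite Sym
Sym-finite .elements             = blank ∷ bit false ∷ bit true ∷ []
Sym-finite .complete blank       = here refl
Sym-finite .complete (bit false) = there (here refl)
Sym-finite .complete (bit true)  = there (there (here refl))

Maybe-finite : ∀ {A} → Finite A → Finite (Maybe A)
Maybe-finite F .elements          = nothing ∷ map just (elements F)
Maybe-finite F .complete nothing  = here refl
Maybe-finite F .complete (just a) = there (∈-map⁺ just (complete F a))

⊎-finite : ∀ {A B} → Finite A → Finite B → Finite (A ⊎ B)
⊎-finite F G .elements          = map inj₁ (elements F) ++ map inj₂ (elements G)
⊎-finite F G .complete (inj₁ a) = ∈-++⁺ˡ (∈-map⁺ inj₁ (complete F a))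
⊎-finite F G .complete (inj₂ b) = ∈-++⁺ʳ _ (∈-map⁺ inj₂ (complete G b))

Σ-finite : ∀ {A} {B : A → Set} → Finite A → (∀ a → Finite (B a)) → Finite (Σ A B)
Σ-finite F G .elements         = concatMap (λ a → map (a ,_) (elements (G a))) (elements F)
Σ-finite F G .complete (a , b) =
  ∈-concatMap⁺ _ (Any.map (λ { refl → ∈-map⁺ (a ,_) (complete (G a) b) }) (complete F a))

-- A machine with exits in X: halting in exit x passes x on to whatever comes next,
-- so machines compose monadically (bind), and iter is the corresponding while loop.
record Mach (X : Set) : Set₁ where
  no-eta-equality
  field
    St     : Set
    finite : Finite St
    init   : St
    δ      : St → Sym → (St ⊎ X) × Sym × Move
open Mach public

-- The number is an upper bound on the steps, since `exit` accepts any successor. Weakening is then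
-- a plain induction, and no exact counts have to be kept.
data Runs {X} (M : Mach X) : St M → Tape → ℕ → X → Tape → Set where
  exit : ∀ {s l h r t x w m} → δ M s h ≡ (inj₂ x , w , m) →
         Runs M s (l , h , r) (suc t) x (moveHead m l w r)
  next : ∀ {s l h r t x w m s′ T} → δ M s h ≡ (inj₁ s′ , w , m) →
         Runs M s′ (moveHead m l w r) t x T → Runs M s (l , h , r) (suc t) x T

infix 4 _⊢_⇓[_]_,_
_⊢_⇓[_]_,_ : ∀ {X} → Mach X → Tape → ℕ → X → Tape → Set
M ⊢ T ⇓[ t ] x , T′ = Runs M (init M) T t x T′

Runs-weaken : ∀ {X} {M : Mach X} {s T t t′ x T′} → t ≤ t′ → Runs M s T t x T′ → Runs M s T t′ x T′
Runs-weaken (s≤s _) (exit e)   = exit e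
Runs-weaken (s≤s p) (next e r) = next e (Runs-weaken p r)

act : ∀ {X} → (Sym → X × Sym × Move) → Mach X
act f .St       = ⊤
act f .finite   = ⊤-finite
act f .init     = tt
act f .δ tt h   = inj₂ (proj₁ (f h)) , proj₂ (f h)

act⇓ : ∀ {X} {f : Sym → X × Sym × Move} {l h r t} →
       act f ⊢ (l , h , r) ⇓[ suc t ] proj₁ (f h) ,
         moveHead (proj₂ (proj₂ (f h))) l (proj₁ (proj₂ (f h))) r
act⇓ = exit refl

inside : ∀ {S S′ X Y : Set} → (S → S′) → (X → S′ ⊎ Y) → (S ⊎ X) × Sym × Move → (S′ ⊎ Y) × Sym × Move
inside f g (inj₁ s , wm) = inj₁ (f s) , wm
inside f g (inj₂ x , wm) = g x , wm

-- The exit step of `M` leads directly into the initial state of `k x`, so composition costs no step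
-- of its own. The exit `x` remains part of the state, whence the finiteness of `X`.
bind : ∀ {X Y} → Finite X → Mach X → (X → Mach Y) → Mach Y
bind F M k .St                   = St M ⊎ Σ _ (St ∘ k)
bind F M k .finite               = ⊎-finite (finite M) (Σ-finite F (finite ∘ k))
bind F M k .init                 = inj₁ (init M)
bind F M k .δ (inj₁ s) h         = inside inj₁ (λ x → inj₁ (inj₂ (x , init (k x)))) (δ M s h)
bind F M k .δ (inj₂ (x , s)) h   = inside (λ s′ → inj₂ (x , s′)) inj₂ (δ (k x) s h)

bind⇓ : ∀ {X Y} {F : Finite X} {M : Mach X} {k : X → Mach Y} {T t x T′ u y T″} →
        M ⊢ T ⇓[ t ] x , T′ → k x ⊢ T′ ⇓[ u ] y , T″ → bind F M k ⊢ T ⇓[ t + u ] y , T″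
bind⇓ {F = F} {M} {k} {x = x} p q = first p
  where
  second : ∀ {s T u y T″} → Runs (k x) s T u y T″ → Runs (bind F M k) (inj₂ (x , s)) T u y T″
  second (exit e)   = exit (cong (inside _ _) e)
  second (next e r) = next (cong (inside _ _) e) (second r)
  first : ∀ {s T t} → Runs M s T t x _ → Runs (bind F M k) (inj₁ s) T (t + _) _ _
  first (exit {t = t} e) = next (cong (inside _ _) e) (Runs-weaken (m≤n+m _ t) (second q))
  first (next e r)       = next (cong (inside _ _) e) (first r)

iter : ∀ {A X} → Finite A → (A → Mach (A ⊎ X)) → A → Mach X
iter F b a .St            = Σ _ (St ∘ b)
iter F b a .finite        = Σ-finite F (finite ∘ b)
iter F b a .init          = a , init (b a)
iter F b a .δ (a′ , s) h  = inside (a′ ,_) back (δ (b a′) s h)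
  where
  back : _ → _
  back (inj₁ a″) = inj₁ (a″ , init (b a″))
  back (inj₂ x)  = inj₂ x

module _ {A X : Set} {F : Finite A} {b : A → Mach (A ⊎ X)} where

  private
    -- The two machines differ only in their initial states, which a run from a given state never
    -- consults; but the machine is a parameter of `Runs`, so the derivation has to be rebuilt.
    relocate : ∀ {a a₀} {T t x T′} {s} → Runs (iter F b a) s T t x T′ → Runs (iter F b a₀) s T t x T′
    relocate (exit e)   = exit e
    relocate (next e r) = next e (relocate r)

  iter-exit⇓ : ∀ {a T t x T′} → b a ⊢ T ⇓[ t ] inj₂ x , T′ → iter F b a ⊢ T ⇓[ t ] x , T′
  iter-exit⇓ {a} = go
    where
    go : ∀ {s T t x T′} → Runs (b a) s T t (inj₂ x) T′ → Runs (iter F b a) (a , s) T t x T′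
    go (exit e)   = exit (cong (inside _ _) e)
    go (next e r) = next (cong (inside _ _) e) (go r)

  iter-next⇓ : ∀ {a a′ T t T′ u x T″} → b a ⊢ T ⇓[ t ] inj₁ a′ , T′ →
               iter F b a′ ⊢ T′ ⇓[ u ] x , T″ → iter F b a ⊢ T ⇓[ t + u ] x , T″
  iter-next⇓ {a} {a′} p q = go p
    where
    go : ∀ {s T t} → Runs (b a) s T t (inj₁ a′) _ → Runs (iter F b a) (a , s) T (t + _) _ _
    go (exit {t = t} e) = next (cong (inside _ _) e) (Runs-weaken (m≤n+m _ t) (relocate q))
    go (next e r)       = next (cong (inside _ _) e) (go r)

module _ (M : Mach ⊤) where

  private
    states : List (St M)
    states = elements (finite M)

    code : St M → Fin (length states)
    code s = index (complete (finite M) s)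

    decode : Fin (length states) → St M
    decode = Data.List.lookup states

    decode-code : ∀ s → decode (code s) ≡ s
    decode-code s = sym (lookup-index (complete (finite M) s))

  toTM : TM
  toTM .TM.Q     = length states
  toTM .TM.start = code (init M)
  toTM .TM.δ q h = inside code inj₂ (δ M (decode q) h)

  private
    δ-code : ∀ {s h d} → δ M s h ≡ d → TM.δ toTM (code s) h ≡ inside code inj₂ d
    δ-code {s} {h} e = cong (inside code inj₂) (trans (cong (λ s → δ M s h) (decode-code s)) e)

    config : Fin (length states) ⊎ ⊤ → Tape → Config (length states)
    config q (l , h , r) = cfg q l h r

    step-eq : ∀ {q q′ l h r w m} → TM.δ toTM q h ≡ (q′ , w , m) →
              step toTM (cfg (inj₁ q) l h r) ≡ config q′ (moveHead m l w r)
    step-eq {q} {h = h} e with TM.δ toTM q h | e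
    ... | _ | refl = refl

    halted-stays : ∀ t {T} → run toTM t (config (inj₂ tt) T) ≡ config (inj₂ tt) T
    halted-stays zero    = refl
    halted-stays (suc t) = halted-stays t

    runs : ∀ {s T t T′} → Runs M s T t tt T′ →
           run toTM t (config (inj₁ (code s)) T) ≡ config (inj₂ tt) T′
    runs (exit {t = t} e) = trans (cong (run toTM t) (step-eq (δ-code e))) (halted-stays t)
    runs (next {t = t} e r) = trans (cong (run toTM t) (step-eq (δ-code e))) (runs r)

  toTM-halts : ∀ x {t l h r} → M ⊢ at [] (bits x) ⇓[ t ] tt , (l , h , r) →
               HaltsWithin toTM x t (readBits (h ∷ r))
  toTM-halts [] {t} p rewrite runs p = tt , refl
  toTM-halts (b ∷ bs) {t} p rewrite runs p = tt , refl

-- Registers on the tape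

-- The tape holds a list of registers, each followed by a blank, after one blank in the leftmost cell.

File : Set
File = List BitString

cells : File → List Sym
cells []      = []
cells (v ∷ F) = bits v ++ blank ∷ cells F

-- The cells to the left of the head after passing the registers F, the head being on the blank behind F.
passed : File → List Sym → List Sym
passed []      l = l
passed (v ∷ F) l = passed F (bits v ʳ++ (blank ∷ l))

-- The cells `z` lie behind the last register. Between operations they are blanks whose number may
-- change, as registers grow into them and shrink away from them.
home : File → List Sym → Tape
home F z = [] , blank , cells F ++ z

right≡at : ∀ l h r → moveHead right l h r ≡ at (h ∷ l) r
right≡at l h []      = refl
right≡at l h (_ ∷ _) = refl

passed-++ : ∀ F {G l} → passed (F ++ G) l ≡ passed G (passed F l)
passed-++ []      = refl
passed-++ (v ∷ F) = passed-++ F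

cells-++ : ∀ F {G z} → cells (F ++ G) ++ z ≡ cells F ++ (cells G ++ z)
cells-++ []      = refl
cells-++ (v ∷ F) {G} {z} = begin
  (bits v ++ blank ∷ cells (F ++ G)) ++ z      ≡⟨ ++-assoc (bits v) _ z ⟩
  bits v ++ blank ∷ (cells (F ++ G) ++ z)      ≡⟨ cong (λ c → bits v ++ blank ∷ c) (cells-++ F) ⟩
  bits v ++ blank ∷ (cells F ++ cells G ++ z)  ≡⟨ ++-assoc (bits v) _ _ ⟨
  cells (v ∷ F) ++ cells G ++ z                ∎
  where open ≡-Reasoning

cells-∷ : ∀ v {F z} → cells (v ∷ F) ++ z ≡ bits v ++ blank ∷ (cells F ++ z)
cells-∷ v = ++-assoc (bits v) _ _

Fits : ℕ → File → Set
Fits m = All (λ v → length v ≤ m)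

Fits-weaken : ∀ {m n F} → m ≤ n → Fits m F → Fits n F
Fits-weaken p = All.map (λ q → ≤-trans q p)

infixl 1 _>>_
_>>_ : ∀ {X} → Mach ⊤ → Mach X → Mach X
M >> M′ = bind ⊤-finite M (λ _ → M′)

-- Time in units of `u` steps, a unit being enough for one pass over a register, so that sequencing
-- only adds small numbers.
record Takes {X} (u : ℕ) (M : Mach X) (T : Tape) (n : ℕ) (x : X) (T′ : Tape) : Set where
  constructor takes
  field
    steps : M ⊢ T ⇓[ n * u ] x , T′
open Takes public

infixr 4 _⨾_
_⨾_ : ∀ {X Y} {F : Finite X} {M : Mach X} {k : X → Mach Y} {T a b u x T′ y T″} →
      Takes u M T a x T′ → Takes u (k x) T′ b y T″ → Takes u (bind F M k) T (a + b) y T″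
_⨾_ {a = a} {b} {u} (takes p) (takes q) =
  takes (Runs-weaken (≤-reflexive (sym (*-distribʳ-+ u a b))) (bind⇓ p q))

Takes-weaken : ∀ {X u} {M : Mach X} {T a b x T′} → a ≤ b → Takes u M T a x T′ → Takes u M T b x T′
Takes-weaken {u = u} p (takes q) = takes (Runs-weaken (*-monoˡ-≤ u p) q)

pass : ∀ {X} → X → Move → Mach X
pass x m = act (λ h → x , h , m)

scanStep : Move → Sym → (⊤ ⊎ ⊤) × Sym × Move
scanStep mv blank   = inj₂ tt , blank , stay
scanStep mv (bit b) = inj₁ tt , bit b , mv

scan : Move → Mach ⊤
scan mv = iter ⊤-finite (λ _ → act (scanStep mv)) tt

act-right⇓ : ∀ {X} (f : Sym → X × Sym × Move) {x s l h r t} → f h ≡ (x , s , right) →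
             act f ⊢ (l , h , r) ⇓[ suc t ] x , at (s ∷ l) r
act-right⇓ f {x} {s} {l} {h} {r} {t} e = subst (act f ⊢ (l , h , r) ⇓[ suc t ] x ,_) (right≡at l s r)
  (exit (cong (λ p → inj₂ (proj₁ p) , proj₂ p) e))

scan-right⇓ : ∀ v {l r} → scan right ⊢ at l (bits v ++ blank ∷ r) ⇓[ suc (length v) ] tt ,
                (bits v ʳ++ l , blank , r)
scan-right⇓ []      = iter-exit⇓ (exit refl)
scan-right⇓ (b ∷ v) {l} {r} = iter-next⇓ {t = 1} (act-right⇓ (scanStep right) refl) (scan-right⇓ v)

scan-left⇓ : ∀ v {l r} → scan left ⊢ moveHead left (bits v ʳ++ (blank ∷ l)) blank r ⇓[ suc (length v) ] tt ,
               (l , blank , bits v ++ blank ∷ r)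
-- The cells to the left of the head list `v` backwards, nearest first, so the induction runs over
-- `reverse v`.
scan-left⇓ v {l} {r} =
  subst₂ (λ u w → scan left ⊢ moveHead left u blank r ⇓[ suc (length v) ] tt , (l , blank , w))
    (trans (cong (_++ blank ∷ l) (reverse-map bit v)) (sym (ʳ++-defn (bits v))))
    (trans (ʳ++-defn (bits (reverse v)))
      (cong (_++ blank ∷ r) (trans (sym (reverse-map bit (reverse v))) (cong bits (reverse-involutive v)))))
    (Runs-weaken (s≤s (≤-reflexive (length-reverse v))) (go (reverse v)))
  where
  go : ∀ w {h r} → scan left ⊢ moveHead left (bits w ++ blank ∷ l) h r ⇓[ suc (length w) ] tt ,
         (l , blank , bits w ʳ++ (h ∷ r))
  go []      = iter-exit⇓ (exit refl)
  go (b ∷ w) = iter-next⇓ {t = 1} act⇓ (go w)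

forward back : ℕ → Mach ⊤
forward zero    = pass tt stay
forward (suc k) = pass tt right >> scan right >> forward k
back zero       = pass tt stay
back (suc k)    = back k >> (pass tt left >> scan left)

pushStep : Sym → Sym → (Sym ⊎ ⊤) × Sym × Move
pushStep c blank   = inj₂ tt , c , right
pushStep c (bit b) = inj₁ (bit b) , c , right

-- Overwrites the cell under the head with c, moving the rest of the register one cell to the right.
pushRight : Sym → Mach ⊤
pushRight = iter Sym-finite (act ∘ pushStep)

-- The last bit of a register moves onto its own closing blank, and the blank pushed in front of the
-- next register replaces that one. The final closing blank is taken from the free cells by the base
-- case.
pushRights : ℕ → Mach ⊤
pushRights zero    = act λ _ → tt , blank , stay
pushRights (suc k) = pushRight blank >> pushRights k

again : Sym → ⊤ ⊎ ⊤
again blank   = inj₂ tt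
again (bit _) = inj₁ tt

-- Moves the rest of the register and the blank behind it one cell to the left.
pullLeft : Mach ⊤
pullLeft = iter ⊤-finite (λ _ → pass tt right >>
             bind Sym-finite (act λ h → h , h , left) (λ s → act λ _ → again s , s , right)) tt

-- `pullLeft` ends on the vacated cell, just where the next register has to be pulled to. The last
-- vacated cell joins the free blanks.
pullLefts : ℕ → Mach ⊤
pullLefts zero    = pass tt left
pullLefts (suc k) = pullLeft >> pullLefts k

pushRight⇓ : ∀ v {c l r} → pushRight c ⊢ at l (bits v ++ blank ∷ r) ⇓[ suc (length v) ] tt ,
               at (bits v ʳ++ (c ∷ l)) r
pushRight⇓ [] {c}      = iter-exit⇓ (act-right⇓ (pushStep c) refl)
pushRight⇓ (b ∷ v) {c} = iter-next⇓ {t = 1} (act-right⇓ (pushStep c) refl) (pushRight⇓ v)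

-- The variant for the raw input, behind which the tape ends instead of showing a blank.
pushRight-end⇓ : ∀ v {c l} → pushRight c ⊢ at l (bits v) ⇓[ suc (length v) ] tt , at (bits v ʳ++ (c ∷ l)) []
pushRight-end⇓ [] {c}      = iter-exit⇓ (act-right⇓ (pushStep c) refl)
pushRight-end⇓ (b ∷ v) {c} = iter-next⇓ {t = 1} (act-right⇓ (pushStep c) refl) (pushRight-end⇓ v)

pullLeft⇓ : ∀ v {l h r} → pullLeft ⊢ (l , h , bits v ++ blank ∷ r) ⇓[ suc (length v) * 3 ] tt ,
              (blank ∷ (bits v ʳ++ l) , blank , r)
pullLeft⇓ []      = iter-exit⇓ (bind⇓ (act⇓ {t = 0}) (bind⇓ (act⇓ {t = 0}) (act⇓ {t = 0})))
pullLeft⇓ (b ∷ v) = iter-next⇓ (bind⇓ (act⇓ {t = 0}) (bind⇓ (act⇓ {t = 0}) (act⇓ {t = 0}))) (pullLeft⇓ v)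

blanks : ℕ → List Sym
blanks z = replicate z blank

module _ {m : ℕ} where

  private
    u : ℕ
    u = suc (suc m)

    within : ∀ {X} {M : Mach X} {T t k x T′} → t ≤ suc m * k → M ⊢ T ⇓[ t ] x , T′ → Takes u M T k x T′
    within {t = t} {k} p q = takes (Runs-weaken (begin
      t           ≤⟨ p ⟩
      suc m * k   ≡⟨ *-comm (suc m) k ⟩
      k * suc m   ≤⟨ *-monoʳ-≤ k (n≤1+n _) ⟩
      k * u       ∎) q)
      where open ≤-Reasoning

    within₁ : ∀ {X} {M : Mach X} {T t x T′} → t ≤ m → M ⊢ T ⇓[ suc t ] x , T′ → Takes u M T 1 x T′
    within₁ p = within (≤-trans (s≤s p) (≤-reflexive (sym (*-identityʳ (suc m)))))

  forward⇓ : ∀ F {l z} → Fits m F → Takes u (forward (length F)) (l , blank , cells F ++ z)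
               (suc (length F * 2)) tt (passed F l , blank , z)
  forward⇓ [] [] = within₁ z≤n act⇓
  forward⇓ (v ∷ F) {l} {z} (p ∷ ps) rewrite cells-∷ v {F} {z} =
    Takes-weaken (≤-reflexive (+-suc 2 (length F * 2)))
      ((within₁ z≤n (act-right⇓ _ refl) ⨾ within₁ p (scan-right⇓ v)) ⨾ forward⇓ F ps)

  back⇓ : ∀ F {l z} → Fits m F → Takes u (back (length F)) (passed F l , blank , z)
            (suc (length F * 2)) tt (l , blank , cells F ++ z)
  back⇓ [] [] = within₁ z≤n act⇓
  back⇓ (v ∷ F) {l} {z} (p ∷ ps) rewrite cells-∷ v {F} {z} =
    Takes-weaken (≤-reflexive (+-comm (suc (length F * 2)) 2))
      (back⇓ F ps ⨾ (within₁ z≤n act⇓ ⨾ within₁ p (scan-left⇓ v)))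

  pushRights⇓ : ∀ F {l} z → Fits m F → ∃[ z′ ] Takes u (pushRights (length F)) (at l (cells F ++ blanks z))
                  (suc (length F)) tt (passed F l , blank , blanks z′)
  pushRights⇓ [] zero    [] = 0 , within₁ z≤n act⇓
  pushRights⇓ [] (suc z) [] = z , within₁ z≤n act⇓
  pushRights⇓ (v ∷ F) z (p ∷ ps) rewrite cells-∷ v {F} {blanks z} with pushRights⇓ F z ps
  ... | z′ , r = z′ , (within₁ p (pushRight⇓ v) ⨾ r)

  pullLeft-within⇓ : ∀ v {l h r} → length v ≤ m → Takes u pullLeft (l , h , bits v ++ blank ∷ r)
                       3 tt (blank ∷ (bits v ʳ++ l) , blank , r)
  pullLeft-within⇓ v p = within (*-monoˡ-≤ 3 (s≤s p)) (pullLeft⇓ v)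

  pullLefts⇓ : ∀ F {l z} → Fits m F → Takes u (pullLefts (length F)) (blank ∷ l , blank , cells F ++ z)
                 (suc (length F * 3)) tt (passed F l , blank , blank ∷ z)
  pullLefts⇓ [] [] = within₁ z≤n act⇓
  pullLefts⇓ (v ∷ F) {l} {z} (p ∷ ps) rewrite cells-∷ v {F} {z} =
    Takes-weaken (≤-reflexive (+-suc 3 (length F * 3))) (pullLeft-within⇓ v p ⨾ pullLefts⇓ F ps)

snocAt : ℕ → ℕ → Bool → Mach ⊤
snocAt i j b = forward (suc i) >> (act (λ _ → tt , bit b , right) >> (pushRights j >> back (suc (i + j))))

popBranch : ℕ → ℕ → Sym → Mach (Maybe Bool)
popBranch i j blank   = pass tt left >> (back i >> pass nothing stay)
popBranch i j (bit b) = pullLeft >> (pullLefts j >> (back (suc (i + j)) >> pass (just b) stay))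

popAt : ℕ → ℕ → Mach (Maybe Bool)
popAt i j = forward i >> (pass tt right >> bind Sym-finite (act λ h → h , h , stay) (popBranch i j))

-- `unit` covers the slowest pass over all registers, namely `pullLefts` with its three visits to
-- every cell. A pop that finds a bit consists of seven pieces, each within one unit; an empty pop
-- and a snoc have fewer.
unit opCost : ℕ → ℕ → ℕ
unit R m   = suc (R * 3) * suc (suc m)
opCost R m = 7 * unit R m

module _ {m : ℕ} (pre : File) (v : BitString) (post : File) (pre-fits : Fits m pre) (v-fits : length v ≤ m)
         (post-fits : Fits m post) where

  private
    i j R : ℕ
    i = length pre
    j = length post
    R = suc (i + j)

    i≤R : i ≤ R
    i≤R = ≤-trans (m≤m+n i j) (n≤1+n _)

    j≤R : j ≤ R
    j≤R = ≤-trans (m≤n+m j i) (n≤1+n _)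

    piece : ∀ {X} {M : Mach X} {T x T′ a} → a ≤ suc (R * 3) → Takes (suc (suc m)) M T a x T′ →
            Takes (unit R m) M T 1 x T′
    piece {a = a} p (takes q) = takes (Runs-weaken (≤-trans (*-monoˡ-≤ (suc (suc m)) p) (≤-reflexive (sym (*-identityˡ _)))) q)

    twice : ∀ k → k ≤ R → suc (k * 2) ≤ suc (R * 3)
    twice k p = s≤s (*-mono-≤ p (n≤1+n 2))

    single : ∀ {X} {f : Sym → X × Sym × Move} {l h r} → Takes (unit R m) (act f) (l , h , r) 1 (proj₁ (f h))
             (moveHead (proj₂ (proj₂ (f h))) l (proj₁ (proj₂ (f h))) r)
    single = takes (exit refl)

    single-right : ∀ {X} (f : Sym → X × Sym × Move) {x s l h r} → f h ≡ (x , s , right) →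
                   Takes (unit R m) (act f) (l , h , r) 1 x (at (s ∷ l) r)
    single-right f e = takes (act-right⇓ f e)

    back-all⇓ : ∀ {w z} → length w ≤ m → Takes (unit R m) (back R) (passed (pre ++ w ∷ post) [] , blank , z)
                  1 tt (home (pre ++ w ∷ post) z)
    back-all⇓ {w} {z} p = subst (λ k → Takes (unit R m) (back k) (passed (pre ++ w ∷ post) [] , blank , z) 1 tt (home (pre ++ w ∷ post) z)) eq
      (piece (twice (length (pre ++ w ∷ post)) (≤-reflexive eq)) (back⇓ (pre ++ w ∷ post) (Allₚ.++⁺ pre-fits (p ∷ post-fits))))
      where
      eq : length (pre ++ w ∷ post) ≡ R
      eq = trans (length-++ pre) (+-suc i j)

    home≡ : ∀ w z → home (pre ++ w ∷ post) z ≡ ([] , blank , cells pre ++ (bits w ++ blank ∷ (cells post ++ z)))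
    home≡ w z = cong (λ c → [] , blank , c) (trans (cells-++ pre {w ∷ post}) (cong (cells pre ++_) (cells-∷ w {post})))

    passed≡ : ∀ w → passed post (bits w ʳ++ (blank ∷ passed pre [])) ≡ passed (pre ++ w ∷ post) []
    passed≡ w = sym (passed-++ pre)

    forward-i⇓ : ∀ {z} → Takes (unit R m) (forward i) (home (pre ++ v ∷ post) z) 1 tt
                   (passed pre [] , blank , bits v ++ blank ∷ (cells post ++ z))
    forward-i⇓ {z} = subst (λ T → Takes (unit R m) (forward i) T 1 tt (passed pre [] , blank , bits v ++ blank ∷ (cells post ++ z)))
      (sym (home≡ v z)) (piece (twice i i≤R) (forward⇓ pre pre-fits))

  snocAt⇓ : ∀ {b} → length (v ++ [ b ]) ≤ m → ∀ z → ∃[ z′ ] Takes (unit R m) (snocAt i j b)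
              (home (pre ++ v ∷ post) (blanks z)) 7 tt (home (pre ++ (v ++ [ b ]) ∷ post) (blanks z′))
  snocAt⇓ {b} p z with pushRights⇓ post {bit b ∷ (bits v ʳ++ (blank ∷ passed pre []))} z post-fits
  ... | z′ , r = z′ , Takes-weaken {a = 4} (s≤s (s≤s (s≤s (s≤s z≤n))))
    (start ⨾ (single-right _ refl ⨾ (push ⨾ back-all⇓ p)))
    where
    snoc-bits : bit b ∷ (bits v ʳ++ (blank ∷ passed pre [])) ≡ bits (v ++ [ b ]) ʳ++ (blank ∷ passed pre [])
    snoc-bits = sym (trans (cong (_ʳ++ _) (map-++ bit v [ b ])) (++-ʳ++ (bits v)))
    push : Takes (unit R m) (pushRights j) (at (bit b ∷ (bits v ʳ++ (blank ∷ passed pre []))) (cells post ++ blanks z)) 1 tt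
             (passed (pre ++ (v ++ [ b ]) ∷ post) [] , blank , blanks z′)
    push = piece (s≤s (≤-trans j≤R (m≤m*n R 3)))
      (subst (λ l → Takes (suc (suc m)) (pushRights j) (at (bit b ∷ (bits v ʳ++ (blank ∷ passed pre []))) (cells post ++ blanks z)) (suc j) tt (l , blank , blanks z′))
        (trans (cong (passed post) snoc-bits) (passed≡ (v ++ [ b ]))) r)
    eq : length (pre ++ [ v ]) ≡ suc i
    eq = trans (length-++ pre) (+-comm i 1)
    start : Takes (unit R m) (forward (suc i)) (home (pre ++ v ∷ post) (blanks z)) 1 tt
              (bits v ʳ++ (blank ∷ passed pre []) , blank , cells post ++ blanks z)
    start = subst₂ (λ k T → Takes (unit R m) (forward k) T 1 tt (bits v ʳ++ (blank ∷ passed pre []) , blank , cells post ++ blanks z)) eq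
      (cong (λ c → [] , blank , c) (trans (sym (cells-++ (pre ++ [ v ]) {post})) (cong (λ F → cells F ++ blanks z) (++-assoc pre [ v ] post))))
      (subst (λ l → Takes (unit R m) (forward (length (pre ++ [ v ]))) ([] , blank , cells (pre ++ [ v ]) ++ (cells post ++ blanks z)) 1 tt (l , blank , cells post ++ blanks z)) (passed-++ pre)
        (piece (twice (length (pre ++ [ v ])) (≤-trans (≤-reflexive eq) (s≤s (m≤m+n i j))))
          (forward⇓ (pre ++ [ v ]) (Allₚ.++⁺ pre-fits (v-fits ∷ [])))))

  popAt-empty⇓ : v ≡ [] → ∀ z → Takes (unit R m) (popAt i j) (home (pre ++ v ∷ post) z) 7 nothing (home (pre ++ v ∷ post) z)
  popAt-empty⇓ refl z = Takes-weaken {a = 6} (n≤1+n 6)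
    (forward-i⇓ ⨾ (single-right _ refl ⨾ (single ⨾ (single ⨾ (return ⨾ single)))))
    where
    return : Takes (unit R m) (back i) (passed pre [] , blank , blank ∷ (cells post ++ z)) 1 tt (home (pre ++ [] ∷ post) z)
    return = subst (λ T → Takes (unit R m) (back i) (passed pre [] , blank , blank ∷ (cells post ++ z)) 1 tt T) (sym (home≡ [] z))
      (piece (twice i i≤R) (back⇓ pre pre-fits))

  popAt-bit⇓ : ∀ {b w} → v ≡ b ∷ w → ∀ z → Takes (unit R m) (popAt i j) (home (pre ++ v ∷ post) (blanks z)) 7 (just b)
                 (home (pre ++ w ∷ post) (blanks (suc z)))
  popAt-bit⇓ {b} {w} refl z =
    forward-i⇓ ⨾ (single-right _ refl ⨾ (single ⨾ (pull₁ ⨾ (pull₂ ⨾ (back-all⇓ w-fits ⨾ single)))))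
    where
    w-fits : length w ≤ m
    w-fits = ≤-trans (n≤1+n _) v-fits
    pull₁ : Takes (unit R m) pullLeft (blank ∷ passed pre [] , bit b , bits w ++ blank ∷ (cells post ++ blanks z)) 1 tt
              (blank ∷ (bits w ʳ++ (blank ∷ passed pre [])) , blank , cells post ++ blanks z)
    pull₁ = piece (≤-trans (m≤n*m 3 R) (n≤1+n _)) (pullLeft-within⇓ w w-fits)
    pull₂ : Takes (unit R m) (pullLefts j) (blank ∷ (bits w ʳ++ (blank ∷ passed pre [])) , blank , cells post ++ blanks z) 1 tt
              (passed (pre ++ w ∷ post) [] , blank , blanks (suc z))
    pull₂ = piece (s≤s (*-monoˡ-≤ 3 j≤R))
      (subst (λ l → Takes (suc (suc m)) (pullLefts j) (blank ∷ (bits w ʳ++ (blank ∷ passed pre [])) , blank , cells post ++ blanks z) (suc (j * 3)) tt (l , blank , blanks (suc z))) (passed≡ w) (pullLefts⇓ post post-fits))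

-- Register operations with bounds on space and time

module _ (R : ℕ) where

  infix 4 _⊢_⇒[_]_,_

  -- M turns the registers F into F′, where n bounds both the growth of every register and
  -- the number of register operations.
  record _⊢_⇒[_]_,_ {X} (M : Mach X) (F : File) (n : ℕ) (x : X) (F′ : File) : Set where
    constructor regs
    field
      fits : ∀ {m} → Fits m F → Fits (m + n) F′
      runs : ∀ {m} → Fits m F → ∀ z → ∃[ z′ ]
             M ⊢ home F (blanks z) ⇓[ n * opCost R (m + n) ] x , home F′ (blanks z′)

open _⊢_⇒[_]_,_ public

unit-mono : ∀ R {m m′} → m ≤ m′ → unit R m ≤ unit R m′
unit-mono R p = *-monoʳ-≤ (suc (R * 3)) (s≤s (s≤s p))

opCost-mono : ∀ R {m m′} → m ≤ m′ → opCost R m ≤ opCost R m′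
opCost-mono R p = *-monoʳ-≤ 7 (unit-mono R p)

module _ {R : ℕ} where

  ⇒-weaken : ∀ {X} {M : Mach X} {F n n′ x F′} → n ≤ n′ → _⊢_⇒[_]_,_ R M F n x F′ → _⊢_⇒[_]_,_ R M F n′ x F′
  ⇒-weaken p r .fits {m} q = Fits-weaken (+-monoʳ-≤ m p) (fits r q)
  ⇒-weaken p r .runs {m} q z with runs r q z
  ... | z′ , s = z′ , Runs-weaken (*-mono-≤ p (opCost-mono R (+-monoʳ-≤ m p))) s

  private
    sequence-cost : ∀ a b m → a * opCost R (m + a) + b * opCost R (m + a + b) ≤ (a + b) * opCost R (m + (a + b))
    sequence-cost a b m = begin
      a * opCost R (m + a) + b * opCost R (m + a + b)
        ≤⟨ +-mono-≤ (*-monoʳ-≤ a (opCost-mono R (+-monoʳ-≤ m (m≤m+n a b))))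
                    (*-monoʳ-≤ b (opCost-mono R (≤-reflexive (+-assoc m a b)))) ⟩
      a * opCost R (m + (a + b)) + b * opCost R (m + (a + b))
        ≡⟨ *-distribʳ-+ _ a b ⟨
      (a + b) * opCost R (m + (a + b)) ∎
      where open ≤-Reasoning

  bind⇒ : ∀ {X Y} {Fin : Finite X} {M : Mach X} {k : X → Mach Y} {F a x F′ b y F″} →
          _⊢_⇒[_]_,_ R M F a x F′ → _⊢_⇒[_]_,_ R (k x) F′ b y F″ → _⊢_⇒[_]_,_ R (bind Fin M k) F (a + b) y F″
  bind⇒ {a = a} {b = b} r s .fits {m} q = Fits-weaken (≤-reflexive (+-assoc m a b)) (fits s (fits r q))
  bind⇒ {a = a} {b = b} r s .runs {m} q z with runs r q z
  ... | z₁ , t with runs s (fits r q) z₁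
  ...   | z₂ , u = z₂ , Runs-weaken (sequence-cost a b m) (bind⇓ t u)

  iter-exit⇒ : ∀ {A X} {Fin : Finite A} {body : A → Mach (A ⊎ X)} {i F a x F′} →
               _⊢_⇒[_]_,_ R (body i) F a (inj₂ x) F′ → _⊢_⇒[_]_,_ R (iter Fin body i) F a x F′
  iter-exit⇒ r .fits = fits r
  iter-exit⇒ r .runs q z with runs r q z
  ... | z′ , s = z′ , iter-exit⇓ s

  iter-next⇒ : ∀ {A X} {Fin : Finite A} {body : A → Mach (A ⊎ X)} {i F a j F′ b x F″} →
               _⊢_⇒[_]_,_ R (body i) F a (inj₁ j) F′ → _⊢_⇒[_]_,_ R (iter Fin body j) F′ b x F″ →
               _⊢_⇒[_]_,_ R (iter Fin body i) F (a + b) x F″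
  iter-next⇒ {a = a} {b = b} r s .fits {m} q = Fits-weaken (≤-reflexive (+-assoc m a b)) (fits s (fits r q))
  iter-next⇒ {a = a} {b = b} r s .runs {m} q z with runs r q z
  ... | z₁ , t with runs s (fits r q) z₁
  ...   | z₂ , u = z₂ , Runs-weaken (sequence-cost a b m) (iter-next⇓ t u)

  pass⇒ : ∀ {X} {x : X} {F} → _⊢_⇒[_]_,_ R (pass x stay) F 1 x F
  pass⇒ .fits {m} = Fits-weaken (m≤m+n m 1)
  pass⇒ .runs q z = z , exit refl

module _ (R : ℕ) where

  snocReg : ℕ → Bool → Mach ⊤
  snocReg i = snocAt i (R ∸ suc i)

  popReg : ℕ → Mach (Maybe Bool)
  popReg i = popAt i (R ∸ suc i)

module _ {R : ℕ} where

  private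
    post-length : ∀ (pre : File) {v post} → length (pre ++ v ∷ post) ≡ R → R ∸ suc (length pre) ≡ length post
    post-length pre {v} {post} refl = begin
      length (pre ++ v ∷ post) ∸ suc (length pre)     ≡⟨ cong (_∸ suc (length pre)) (trans (length-++ pre) (+-suc _ _)) ⟩
      length pre + length post ∸ length pre           ≡⟨ m+n∸m≡n (length pre) _ ⟩
      length post                                     ∎
      where open ≡-Reasoning

    full-length : ∀ (pre : File) {v post} → length (pre ++ v ∷ post) ≡ R → suc (length pre + length post) ≡ R
    full-length pre e = trans (sym (trans (length-++ pre) (+-suc _ _))) e

    once : ∀ {R′ m m′} → R′ ≡ R → m ≤ m′ → opCost R′ m ≤ 1 * opCost R m′
    once refl p = ≤-trans (opCost-mono R p) (≤-reflexive (sym (*-identityˡ _)))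

    split : ∀ {m} pre {v post} → Fits m (pre ++ v ∷ post) → Fits m pre × length v ≤ m × Fits m post
    split pre q with Allₚ.++⁻ pre q
    ... | a , b ∷ c = a , b , c

    snoc-length : ∀ v {b : Bool} → length (v ++ [ b ]) ≡ length v + 1
    snoc-length v = length-++ v

  snocReg⇒ : ∀ pre {v post i b} → length pre ≡ i → length (pre ++ v ∷ post) ≡ R →
             _⊢_⇒[_]_,_ R (snocReg R i b) (pre ++ v ∷ post) 1 tt (pre ++ (v ++ [ b ]) ∷ post)
  snocReg⇒ pre {v} {post} {b = b} refl e .fits {m} q with split pre q
  ... | p , l , s = Allₚ.++⁺ (Fits-weaken (m≤m+n m 1) p)
                      (≤-trans (≤-reflexive (snoc-length v)) (+-monoˡ-≤ 1 l) ∷ Fits-weaken (m≤m+n m 1) s)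
  snocReg⇒ pre {v} {post} {b = b} refl e .runs {m} q z with split pre q
  ... | p , l , s rewrite post-length pre {_} {post} e
    with snocAt⇓ {m + 1} pre v post (Fits-weaken (m≤m+n m 1) p) (≤-trans l (m≤m+n m 1)) (Fits-weaken (m≤m+n m 1) s)
           {b} (≤-trans (≤-reflexive (snoc-length v)) (+-monoˡ-≤ 1 l)) z
  ... | z′ , r = z′ , Runs-weaken (once (full-length pre e) ≤-refl) (steps r)

  popReg-empty⇒ : ∀ pre {post i} → length pre ≡ i → length (pre ++ [] ∷ post) ≡ R →
                  _⊢_⇒[_]_,_ R (popReg R i) (pre ++ [] ∷ post) 1 nothing (pre ++ [] ∷ post)
  popReg-empty⇒ pre refl e .fits {m} = Fits-weaken (m≤m+n m 1)
  popReg-empty⇒ pre {post} refl e .runs {m} q z with split pre q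
  ... | p , l , s rewrite post-length pre {_} {post} e =
    z , Runs-weaken (once (full-length pre e) (m≤m+n m 1)) (steps (popAt-empty⇓ pre [] post p l s refl (blanks z)))

  popReg-bit⇒ : ∀ pre {b v post i} → length pre ≡ i → length (pre ++ (b ∷ v) ∷ post) ≡ R →
                _⊢_⇒[_]_,_ R (popReg R i) (pre ++ (b ∷ v) ∷ post) 1 (just b) (pre ++ v ∷ post)
  popReg-bit⇒ pre {b} {v} {post} refl e .fits {m} q with split pre q
  ... | p , l , s = Fits-weaken (m≤m+n m 1) (Allₚ.++⁺ p (≤-trans (n≤1+n _) l ∷ s))
  popReg-bit⇒ pre {b} {v} {post} refl e .runs {m} q z with split pre q
  ... | p , l , s rewrite post-length pre {_} {post} e =
    suc z , Runs-weaken (once (full-length pre e) (m≤m+n m 1)) (steps (popAt-bit⇓ pre (b ∷ v) post p l s refl z))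

-- Register programs

-- case pops the front bit of a register, stop leaves the innermost loop, and a loop
-- makes at most as many rounds as the input has bits. The index counts the nesting depth of loops.
data Prog (K : ℕ) : ℕ → Set where
  snoc      : ∀ {d} → Fin K → Bool → Prog K d
  stop skip : ∀ {d} → Prog K d
  case      : ∀ {d} → Fin K → Prog K d → Prog K d → Prog K d → Prog K d
  _；_       : ∀ {d} → Prog K d → Prog K d → Prog K d
  loop      : ∀ {d} → Prog K d → Prog K (suc d)

infixr 5 _；_

State : ℕ → Set
State = Vec BitString

repeat : ∀ {K} → ℕ → (State K → Bool × State K) → Bool × State K → State K
repeat n f (false , σ)         = σ
repeat zero f (true , σ)       = σ
repeat (suc n) f (true , σ)    = repeat n f (f σ)

-- The flag is `false` while a `stop` is pending, which `；` passes on and `loop` absorbs. Branching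
-- on a register and on the flag are functions of their own, so that the rules in `Execution` arise
-- by rewriting one argument.
sem : ∀ {K d} → ℕ → Prog K d → State K → Bool × State K
branch : ∀ {K d} → ℕ → Fin K → Prog K d → Prog K d → Prog K d → State K → BitString → Bool × State K
andThen : ∀ {K d} → ℕ → Prog K d → Bool × State K → Bool × State K
sem N (snoc i b) σ     = true , σ [ i ]≔ (lookup σ i ++ [ b ])
sem N stop σ           = false , σ
sem N skip σ           = true , σ
sem N (case i p q r) σ = branch N i p q r σ (lookup σ i)
sem N (p ； q) σ       = andThen N q (sem N p σ)
sem N (loop p) σ       = true , repeat N (sem N p) (true , σ)
branch N i p q r σ []          = sem N p σ
branch N i p q r σ (false ∷ v) = sem N q (σ [ i ]≔ v)
branch N i p q r σ (true ∷ v)  = sem N r (σ [ i ]≔ v)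
andThen N q (true , σ)  = sem N q σ
andThen N q (false , σ) = false , σ

-- In a round a loop pays three operations besides its body: popping one clock register, extending
-- the other, passing on the flag. Two more discover the empty clock, restoring the clock costs the
-- same again per bit, and one operation sets the flag. Adding up the branches of `case` keeps the
-- bound visibly polynomial.
cost : ∀ {K d} → ℕ → Prog K d → ℕ
cost N (snoc i b)     = 2
cost N stop           = 1
cost N skip           = 1
cost N (case i p q r) = 1 + (cost N p + (cost N q + cost N r))
cost N (p ； q)       = cost N p + (cost N q + 1)
cost N (loop p)       = (N * (cost N p + 3) + 2) + ((N * 3 + 2) + 1)

-- Compilation of programs

module Compile (R K : ℕ) where

  loopEnd : Bool → ⊤ ⊎ ⊤
  loopEnd true  = inj₁ tt
  loopEnd false = inj₂ tt

  roundBranch : Mach Bool → ℕ → Maybe Bool → Mach (⊤ ⊎ ⊤)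
  roundBranch M e nothing  = pass (inj₂ tt) stay
  roundBranch M e (just _) = snocReg R e false >> bind Bool-finite M (λ b → pass (loopEnd b) stay)

  restoreBranch : ℕ → Maybe Bool → Mach (⊤ ⊎ ⊤)
  restoreBranch c nothing  = pass (inj₂ tt) stay
  restoreBranch c (just _) = snocReg R c false >> pass (inj₁ tt) stay

  rounds : Mach Bool → ℕ → ℕ → Mach ⊤
  rounds M c e = iter ⊤-finite (λ _ → bind (Maybe-finite Bool-finite) (popReg R c) (roundBranch M e)) tt

  restore : ℕ → ℕ → Mach ⊤
  restore c e = iter ⊤-finite (λ _ → bind (Maybe-finite Bool-finite) (popReg R e) (restoreBranch c)) tt

  caseBranch : Mach Bool → Mach Bool → Mach Bool → Maybe Bool → Mach Bool
  caseBranch P Q S nothing      = P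
  caseBranch P Q S (just false) = Q
  caseBranch P Q S (just true)  = S

  thenBranch : Mach Bool → Bool → Mach Bool
  thenBranch Q true  = Q
  thenBranch Q false = pass false stay

  compile : ∀ {d} → Prog K d → Mach Bool
  compile (snoc i b)     = snocReg R (toℕ i) b >> pass true stay
  compile stop           = pass false stay
  compile skip           = pass true stay
  compile (case i p q r) = bind (Maybe-finite Bool-finite) (popReg R (toℕ i)) (caseBranch (compile p) (compile q) (compile r))
  compile (p ； q)       = bind Bool-finite (compile p) (thenBranch (compile q))
  -- Consecutive loops of the same depth share one pair of clock registers; this is sound because
  -- `restore` refills the clock after every exit, early or not.
  compile {suc d} (loop p) =
    rounds (compile p) (K + d * 2) (suc (K + d * 2)) >> (restore (K + d * 2) (suc (K + d * 2)) >> pass true stay)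

  zeros : ℕ → BitString
  zeros a = replicate a false

  zeros-snoc : ∀ a → zeros a ++ [ false ] ≡ zeros (suc a)
  zeros-snoc zero    = refl
  zeros-snoc (suc a) = cong (false ∷_) (zeros-snoc a)

  -- A loop of depth d moves a clock of N bits between two registers of its own, one bit per round.
  clocks : ℕ → ℕ → File → File
  clocks N zero    F = F
  clocks N (suc d) F = clocks N d (zeros N ∷ [] ∷ F)

  clocks-++ : ∀ N d F {G} → clocks N d (F ++ G) ≡ clocks N d F ++ G
  clocks-++ N zero F    = refl
  clocks-++ N (suc d) F = clocks-++ N d (zeros N ∷ [] ∷ F)

  clocks-length : ∀ N d F → length (clocks N d F) ≡ d * 2 + length F
  clocks-length N zero F    = refl
  clocks-length N (suc d) F = trans (clocks-length N d _) (trans (+-suc (d * 2) _) (cong suc (+-suc (d * 2) _)))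

  -- The surroundings are chosen before the content `v`, so the same decomposition serves before and
  -- after an update.
  split : ∀ {n} (σ : Vec BitString n) i → Σ[ pre ∈ File ] Σ[ post ∈ File ] length pre ≡ toℕ i ×
          (∀ v → toList (σ [ i ]≔ v) ≡ pre ++ v ∷ post)
  split (u ∷ σ) zero = [] , toList σ , refl , λ _ → refl
  split (u ∷ σ) (suc i) with split σ i
  ... | pre , post , l , e = u ∷ pre , post , cong suc l , λ v → cong (u ∷_) (e v)

  module _ (N : ℕ) where

    infix 4 _⊢_⇒⟨_⟩_,_
    _⊢_⇒⟨_⟩_,_ : ∀ {X} → Mach X → File → ℕ → X → File → Set
    M ⊢ F ⇒⟨ n ⟩ x , F′ = length F ≡ R → _⊢_⇒[_]_,_ R M F n x F′

    -- Y are the registers behind the data, none of which is touched.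
    module _ (σ : State K) (i : Fin K) (Y : File) where

      private
        pre post : File
        pre  = proj₁ (split σ i)
        post = proj₁ (proj₂ (split σ i))

        pre-length : length pre ≡ toℕ i
        pre-length = proj₁ (proj₂ (proj₂ (split σ i)))

        updated : ∀ v → toList (σ [ i ]≔ v) ++ Y ≡ pre ++ v ∷ (post ++ Y)
        updated v = trans (cong (_++ Y) (proj₂ (proj₂ (proj₂ (split σ i))) v)) (++-assoc pre (v ∷ post) Y)

        current : toList σ ++ Y ≡ pre ++ lookup σ i ∷ (post ++ Y)
        current = trans (cong (λ τ → toList τ ++ Y) (sym (Vecₚ.[]≔-lookup σ i))) (updated (lookup σ i))

      snoc⇒ : ∀ {b} → snocReg R (toℕ i) b ⊢ toList σ ++ Y ⇒⟨ 1 ⟩ tt , toList (σ [ i ]≔ (lookup σ i ++ [ b ])) ++ Y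
      snoc⇒ {b} e = subst₂ (λ F G → _⊢_⇒[_]_,_ R (snocReg R (toℕ i) b) F 1 tt G) (sym current) (sym (updated _))
        (snocReg⇒ pre pre-length (trans (cong length (sym current)) e))

      pop-empty⇒ : lookup σ i ≡ [] → popReg R (toℕ i) ⊢ toList σ ++ Y ⇒⟨ 1 ⟩ nothing , toList σ ++ Y
      pop-empty⇒ q e = subst (λ F → _⊢_⇒[_]_,_ R (popReg R (toℕ i)) F 1 nothing F) (sym at-i)
        (popReg-empty⇒ pre pre-length (trans (cong length (sym at-i)) e))
        where
        at-i : toList σ ++ Y ≡ pre ++ [] ∷ (post ++ Y)
        at-i = trans current (cong (λ v → pre ++ v ∷ (post ++ Y)) q)

      pop-bit⇒ : ∀ {b v} → lookup σ i ≡ b ∷ v →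
                 popReg R (toℕ i) ⊢ toList σ ++ Y ⇒⟨ 1 ⟩ just b , toList (σ [ i ]≔ v) ++ Y
      pop-bit⇒ {b} {v} q e = subst₂ (λ F G → _⊢_⇒[_]_,_ R (popReg R (toℕ i)) F 1 (just b) G) (sym at-i) (sym (updated v))
        (popReg-bit⇒ pre pre-length (trans (cong length (sym at-i)) e))
        where
        at-i : toList σ ++ Y ≡ pre ++ (b ∷ v) ∷ (post ++ Y)
        at-i = trans current (cong (λ v → pre ++ v ∷ (post ++ Y)) q)

    toList-length : ∀ (σ τ : State K) {Y} → length (toList σ ++ Y) ≡ R → length (toList τ ++ Y) ≡ R
    toList-length σ τ {Y} e = trans (lengths τ) (trans (sym (lengths σ)) e)
      where
      lengths : ∀ (τ : State K) → length (toList τ ++ Y) ≡ K + length Y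
      lengths τ = trans (length-++ (toList τ)) (cong (_+ length Y) (Vecₚ.length-toList τ))

    file : ∀ d → File → State K → ℕ → ℕ → File
    file d Y σ a b = toList σ ++ clocks N d (zeros a ∷ zeros b ∷ Y)

    module _ (d : ℕ) (Y : File) where

      private
        c e : ℕ
        c = K + d * 2
        e = suc c

        before : State K → File
        before σ = toList σ ++ clocks N d []

        before-length : ∀ σ → length (before σ) ≡ c
        before-length σ = trans (length-++ (toList σ)) (cong₂ _+_ (Vecₚ.length-toList σ)
          (trans (clocks-length N d []) (+-identityʳ _)))

        file≡ : ∀ σ F → before σ ++ F ≡ toList σ ++ clocks N d F
        file≡ σ F = trans (++-assoc (toList σ) _ F) (cong (toList σ ++_) (sym (clocks-++ N d [])))

        length-any : ∀ σ τ a b a′ b′ → length (file d Y σ a b) ≡ R → length (file d Y τ a′ b′) ≡ R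
        length-any σ τ a b a′ b′ q = trans (l τ a′ b′) (trans (sym (l σ a b)) q)
          where
          l : ∀ σ a b → length (file d Y σ a b) ≡ K + (d * 2 + (2 + length Y))
          l σ a b = trans (length-++ (toList σ)) (cong₂ _+_ (Vecₚ.length-toList σ) (clocks-length N d _))

        move : ∀ {X} {M : Mach X} {n x} σ F G → (length (before σ ++ F) ≡ R → _⊢_⇒[_]_,_ R M (before σ ++ F) n x (before σ ++ G)) →
               M ⊢ toList σ ++ clocks N d F ⇒⟨ n ⟩ x , toList σ ++ clocks N d G
        move {M = M} {n} {x} σ F G r q = subst₂ (λ F G → _⊢_⇒[_]_,_ R M F n x G) (file≡ σ F) (file≡ σ G)
          (r (trans (cong length (file≡ σ F)) q))

        second : ∀ σ u F → (before σ ++ [ u ]) ++ F ≡ before σ ++ u ∷ F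
        second σ u F = ++-assoc (before σ) [ u ] F

        second-length : ∀ σ u → length (before σ ++ [ u ]) ≡ e
        second-length σ u = trans (length-++ (before σ)) (trans (+-comm _ 1) (cong suc (before-length σ)))

        move₂ : ∀ {X} {M : Mach X} {n x} σ u F G →
                (length ((before σ ++ [ u ]) ++ F) ≡ R → _⊢_⇒[_]_,_ R M ((before σ ++ [ u ]) ++ F) n x ((before σ ++ [ u ]) ++ G)) →
                M ⊢ toList σ ++ clocks N d (u ∷ F) ⇒⟨ n ⟩ x , toList σ ++ clocks N d (u ∷ G)
        move₂ {M = M} {n} {x} σ u F G r = move σ (u ∷ F) (u ∷ G)
          (λ q → subst₂ (λ F G → _⊢_⇒[_]_,_ R M F n x G) (second σ u F) (second σ u G)
            (r (trans (cong length (second σ u F)) q)))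

      pop-c⇒ : ∀ σ a b → popReg R c ⊢ file d Y σ (suc a) b ⇒⟨ 1 ⟩ just false , file d Y σ a b
      pop-c⇒ σ a b = move σ _ _ (popReg-bit⇒ (before σ) (before-length σ))

      pop-c-empty⇒ : ∀ σ b → popReg R c ⊢ file d Y σ 0 b ⇒⟨ 1 ⟩ nothing , file d Y σ 0 b
      pop-c-empty⇒ σ b = move σ _ _ (popReg-empty⇒ (before σ) (before-length σ))

      snoc-c⇒ : ∀ σ a b → snocReg R c false ⊢ file d Y σ a b ⇒⟨ 1 ⟩ tt , file d Y σ (suc a) b
      snoc-c⇒ σ a b = subst (λ v → snocReg R c false ⊢ file d Y σ a b ⇒⟨ 1 ⟩ tt , toList σ ++ clocks N d (v ∷ zeros b ∷ Y))
        (zeros-snoc a) (move σ _ _ (snocReg⇒ (before σ) (before-length σ)))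

      pop-e⇒ : ∀ σ a b → popReg R e ⊢ file d Y σ a (suc b) ⇒⟨ 1 ⟩ just false , file d Y σ a b
      pop-e⇒ σ a b = move₂ σ (zeros a) _ _ (popReg-bit⇒ (before σ ++ [ zeros a ]) (second-length σ _))

      pop-e-empty⇒ : ∀ σ a → popReg R e ⊢ file d Y σ a 0 ⇒⟨ 1 ⟩ nothing , file d Y σ a 0
      pop-e-empty⇒ σ a = move₂ σ (zeros a) _ _ (popReg-empty⇒ (before σ ++ [ zeros a ]) (second-length σ _))

      snoc-e⇒ : ∀ σ a b → snocReg R e false ⊢ file d Y σ a b ⇒⟨ 1 ⟩ tt , file d Y σ a (suc b)
      snoc-e⇒ σ a b = subst (λ v → snocReg R e false ⊢ file d Y σ a b ⇒⟨ 1 ⟩ tt , toList σ ++ clocks N d (zeros a ∷ v ∷ Y))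
        (zeros-snoc b) (move₂ σ (zeros a) _ _ (snocReg⇒ (before σ ++ [ zeros a ]) (second-length σ _)))

      restore⇒ : ∀ σ b a → restore c e ⊢ file d Y σ a b ⇒⟨ b * 3 + 2 ⟩ tt , file d Y σ (b + a) 0
      restore⇒ σ zero a q    = iter-exit⇒ (bind⇒ (pop-e-empty⇒ σ a q) pass⇒)
      restore⇒ σ (suc b) a q = iter-next⇒ (bind⇒ (pop-e⇒ σ a b q) (bind⇒ (snoc-c⇒ σ a b (length-any σ σ a (suc b) a b q)) pass⇒))
        (subst (λ k → restore c e ⊢ file d Y σ (suc a) b ⇒⟨ b * 3 + 2 ⟩ tt , file d Y σ k 0) (+-suc b a)
          (restore⇒ σ b (suc a)) (length-any σ σ a (suc b) (suc a) b q))

      -- Each round moves one bit between the clock registers, so their sum is invariant wherever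
      -- the loop stops. That sum is what `restore` puts back.
      rounds⇒ : ∀ (p : Prog K d) → (∀ σ a b → compile p ⊢ file d Y σ a b ⇒⟨ cost N p ⟩ proj₁ (sem N p σ) , file d Y (proj₂ (sem N p σ)) a b) →
                ∀ σ a b → ∃[ a′ ] ∃[ b′ ] b′ + a′ ≡ b + a × b′ ≤ b + a ×
                (rounds (compile p) c e ⊢ file d Y σ a b ⇒⟨ a * (cost N p + 3) + 2 ⟩ tt ,
                   file d Y (repeat a (sem N p) (true , σ)) a′ b′)
      rounds⇒ p h σ zero b = zero , b , refl , m≤m+n b 0 , λ q → iter-exit⇒ (bind⇒ (pop-c-empty⇒ σ b q) pass⇒)
      rounds⇒ p h σ (suc a) b with sem N p σ | h σ a (suc b)
      ... | false , τ | g = a , suc b , sym (+-suc b a) , ≤-trans (m≤m+n (suc b) a) (≤-reflexive (sym (+-suc b a))) , λ q →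
        ⇒-weaken (bound a) (iter-exit⇒ (bind⇒ (pop-c⇒ σ a b q)
          (bind⇒ (snoc-e⇒ σ a b (length-any σ σ (suc a) b a b q))
            (bind⇒ (g (length-any σ σ (suc a) b a (suc b) q)) (pass⇒ {x = inj₂ tt})))))
        where
        rearrange : ∀ k → 1 + (1 + (k + 1)) ≡ k + 3
        rearrange = solve-∀
        bound : ∀ a → 1 + (1 + (cost N p + 1)) ≤ suc a * (cost N p + 3) + 2
        bound a = ≤-trans (≤-reflexive (rearrange (cost N p))) (≤-trans (m≤m+n _ _) (m≤m+n _ 2))
      ... | true , τ | g with rounds⇒ p h τ a (suc b)
      ...   | a′ , b′ , s , s′ , r = a′ , b′ , trans s (sym (+-suc b a)) , ≤-trans s′ (≤-reflexive (sym (+-suc b a))) , λ q →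
        ⇒-weaken (≤-reflexive (rearrange (cost N p) (a * (cost N p + 3)))) (iter-next⇒ (bind⇒ (pop-c⇒ σ a b q)
          (bind⇒ (snoc-e⇒ σ a b (length-any σ σ (suc a) b a b q))
            (bind⇒ (g (length-any σ σ (suc a) b a (suc b) q)) (pass⇒ {x = inj₁ tt}))))
          (r (length-any σ τ (suc a) b a (suc b) q)))
        where
        rearrange : ∀ k l → 1 + (1 + (k + 1)) + (l + 2) ≡ k + 3 + l + 2
        rearrange = solve-∀

    -- Generalised over the registers `Y` at the end, because inside a loop body the partly used
    -- clock of that loop belongs to them.
    compile⇒ : ∀ {d} (p : Prog K d) σ Y → compile p ⊢ toList σ ++ clocks N d Y ⇒⟨ cost N p ⟩
                 proj₁ (sem N p σ) , toList (proj₂ (sem N p σ)) ++ clocks N d Y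
    compile⇒ (snoc i b) σ Y q = bind⇒ (snoc⇒ σ i _ q) pass⇒
    compile⇒ stop σ Y q       = pass⇒
    compile⇒ skip σ Y q       = pass⇒
    compile⇒ {d} (case i p r s) σ Y q with lookup σ i in eq
    ... | []        = ⇒-weaken (s≤s (m≤m+n _ _)) (bind⇒ (pop-empty⇒ σ i _ eq q) (compile⇒ p σ Y q))
    ... | false ∷ v = ⇒-weaken (s≤s (≤-trans (m≤m+n _ _) (m≤n+m _ (cost N p))))
      (bind⇒ (pop-bit⇒ σ i _ eq q) (compile⇒ r _ Y (toList-length σ (σ [ i ]≔ v) q)))
    ... | true ∷ v  = ⇒-weaken (s≤s (≤-trans (m≤n+m _ (cost N r)) (m≤n+m _ (cost N p))))
      (bind⇒ (pop-bit⇒ σ i _ eq q) (compile⇒ s _ Y (toList-length σ (σ [ i ]≔ v) q)))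
    compile⇒ (p ； r) σ Y q with sem N p σ | compile⇒ p σ Y q
    ... | false , τ | g = ⇒-weaken (+-monoʳ-≤ (cost N p) (m≤n+m 1 (cost N r))) (bind⇒ g pass⇒)
    ... | true , τ  | g = ⇒-weaken (+-monoʳ-≤ (cost N p) (m≤m+n (cost N r) 1)) (bind⇒ g (compile⇒ r τ Y (toList-length σ τ q)))
    compile⇒ {suc d} (loop p) σ Y q
      with rounds⇒ d Y p (λ τ a b → compile⇒ p τ (zeros a ∷ zeros b ∷ Y)) σ N 0
    ... | a , b , s , b≤N , r =
      bind⇒ (r q) (⇒-weaken (+-monoˡ-≤ 1 (+-monoˡ-≤ 2 (*-monoˡ-≤ 3 b≤N)))
        (bind⇒ (subst (λ k → restore _ _ ⊢ file d Y τ a b ⇒⟨ _ ⟩ tt , file d Y τ k 0) s (restore⇒ d Y τ b a) (len τ)) pass⇒))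
      where
      τ : State K
      τ = repeat N (sem N p) (true , σ)
      len : ∀ τ → length (file d Y τ a b) ≡ R
      len τ = trans (l τ a b) (trans (sym (l σ N 0)) q)
        where
        l : ∀ σ a b → length (file d Y σ a b) ≡ K + (d * 2 + (2 + length Y))
        l σ a b = trans (length-++ (toList σ)) (cong₂ _+_ (Vecₚ.length-toList σ) (clocks-length N d _))

-- Polynomial time

-- With base `suc n` instead of n, raising the degree never lowers the bound, not even at n = 0;
-- `_⊕_` relies on this.
record Poly (f : ℕ → ℕ) : Set where
  constructor poly
  field
    factor degree : ℕ
    bound         : ∀ n → f n ≤ factor * suc n ^ degree
open Poly

const-poly : ∀ c → Poly (λ _ → c)
const-poly c = poly c 0 (λ _ → ≤-reflexive (sym (*-identityʳ c)))

id-poly : Poly (λ n → n)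
id-poly = poly 1 1 (λ n → ≤-trans (n≤1+n n) (≤-reflexive (sym (trans (*-identityˡ _) (*-identityʳ (suc n))))))

infixl 6 _⊕_
_⊕_ : ∀ {f g} → Poly f → Poly g → Poly (λ n → f n + g n)
_⊕_ {f} {g} (poly c j p) (poly d k q) = poly (c + d) (j + k) λ n → begin
  f n + g n                                        ≤⟨ +-mono-≤ (p n) (q n) ⟩
  c * suc n ^ j + d * suc n ^ k
    ≤⟨ +-mono-≤ (*-monoʳ-≤ c (^-monoʳ-≤ (suc n) (m≤m+n j k))) (*-monoʳ-≤ d (^-monoʳ-≤ (suc n) (m≤n+m k j))) ⟩
  c * suc n ^ (j + k) + d * suc n ^ (j + k)        ≡⟨ *-distribʳ-+ (suc n ^ (j + k)) c d ⟨
  (c + d) * suc n ^ (j + k)                        ∎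
  where open ≤-Reasoning

infixl 7 _⊗_
_⊗_ : ∀ {f g} → Poly f → Poly g → Poly (λ n → f n * g n)
_⊗_ {f} {g} (poly c j p) (poly d k q) = poly (c * d) (j + k) λ n → begin
  f n * g n                            ≤⟨ *-mono-≤ (p n) (q n) ⟩
  c * suc n ^ j * (d * suc n ^ k)      ≡⟨ rearrange c d (suc n ^ j) (suc n ^ k) ⟩
  c * d * (suc n ^ j * suc n ^ k)      ≡⟨ cong (c * d *_) (^-distribˡ-+-* (suc n) j k) ⟨
  c * d * suc n ^ (j + k)              ∎
  where
  open ≤-Reasoning
  rearrange : ∀ a b x y → a * x * (b * y) ≡ a * b * (x * y)
  rearrange = solve-∀

-- For n ≥ 1 use n + 1 ≤ 2n; for n = 0 the additive term suffices. Factor and summand coincide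
-- because `PolyTime` has one constant for both.
poly-bound : ∀ {f} (P : Poly f) n → f n ≤ (factor P * 2 ^ degree P) * n ^ degree P + factor P * 2 ^ degree P
poly-bound {f} (poly c k p) n = ≤-trans (p n) (begin
  c * suc n ^ k                       ≤⟨ *-monoʳ-≤ c (power n) ⟩
  c * (2 ^ k * n ^ k + 2 ^ k)         ≡⟨ rearrange c (2 ^ k) (n ^ k) ⟩
  c * 2 ^ k * n ^ k + c * 2 ^ k       ∎)
  where
  open ≤-Reasoning
  rearrange : ∀ a b x → a * (b * x + b) ≡ a * b * x + a * b
  rearrange = solve-∀
  distrib : ∀ k a b → (a * b) ^ k ≡ a ^ k * b ^ k
  distrib zero a b    = refl
  distrib (suc k) a b = trans (cong (a * b *_) (distrib k a b)) (exchange a b (a ^ k) (b ^ k))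
    where
    exchange : ∀ a b x y → a * b * (x * y) ≡ a * x * (b * y)
    exchange = solve-∀
  power : ∀ n → suc n ^ k ≤ 2 ^ k * n ^ k + 2 ^ k
  power zero    = begin
    1 ^ k                      ≡⟨ ^-zeroˡ k ⟩
    1                          ≤⟨ m^n>0 2 k ⟩
    2 ^ k                      ≤⟨ m≤n+m _ _ ⟩
    2 ^ k * 0 ^ k + 2 ^ k      ∎
  power (suc n) = begin
    suc (suc n) ^ k                    ≤⟨ ^-monoˡ-≤ k (≤-trans (m≤n+m _ n) (≤-reflexive (double n))) ⟩
    (2 * suc n) ^ k                    ≡⟨ distrib k 2 (suc n) ⟩
    2 ^ k * suc n ^ k                  ≤⟨ m≤m+n _ _ ⟩
    2 ^ k * suc n ^ k + 2 ^ k          ∎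
    where
    double : ∀ n → n + suc (suc n) ≡ 2 * suc n
    double = solve-∀

cost-poly : ∀ {K d} (p : Prog K d) → Poly (λ N → cost N p)
cost-poly (snoc i b)     = const-poly 2
cost-poly stop           = const-poly 1
cost-poly skip           = const-poly 1
cost-poly (case i p q r) = const-poly 1 ⊕ (cost-poly p ⊕ (cost-poly q ⊕ cost-poly r))
cost-poly (p ； q)       = cost-poly p ⊕ (cost-poly q ⊕ const-poly 1)
cost-poly (loop p)       = (id-poly ⊗ (cost-poly p ⊕ const-poly 3) ⊕ const-poly 2)
                         ⊕ ((id-poly ⊗ const-poly 3 ⊕ const-poly 2) ⊕ const-poly 1)

-- From programs to machines on raw inputs

extend : ℕ → Mach ⊤
extend zero    = pass tt stay
extend (suc k) = pass tt right >> extend k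

layout : ℕ → Mach ⊤
layout k = pushRight blank >> (act (λ _ → tt , blank , stay) >> (extend k >> back (suc k)))

module _ {m : ℕ} where

  private
    small : ∀ {X} {M : Mach X} {T t x T′} → t ≤ m → M ⊢ T ⇓[ suc t ] x , T′ → Takes (suc (suc m)) M T 1 x T′
    small p q = takes (Runs-weaken (s≤s (≤-trans p (≤-trans (n≤1+n m) (m≤m+n (suc m) _)))) q)

  extend⇓ : ∀ k {l} → Takes (suc (suc m)) (extend k) (l , blank , []) (suc k) tt (passed (replicate k []) l , blank , [])
  extend⇓ zero    = small z≤n act⇓
  extend⇓ (suc k) = small z≤n act⇓ ⨾ extend⇓ k

  layout⇓ : ∀ k x → length x ≤ m → Takes (suc (suc m)) (layout k) (at [] (bits x))
              (2 + (suc k + suc (suc k * 2))) tt (home (x ∷ replicate k []) [])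
  layout⇓ k x p = small p (pushRight-end⇓ x) ⨾ (small z≤n act⇓ ⨾ (extend⇓ k ⨾
    subst (λ j → Takes (suc (suc m)) (back (suc j)) (passed (replicate k []) (bits x ʳ++ (blank ∷ [])) , blank , [])
                   (suc (suc j * 2)) tt (home (x ∷ replicate k []) []))
      (length-replicate k)
      (back⇓ (x ∷ replicate k []) (p ∷ Allₚ.replicate⁺ k z≤n))))

reading : ∀ l v s → ∃[ l′ ] ∃[ h ] ∃[ r ] at l (bits v ++ blank ∷ s) ≡ (l′ , h , r) × readBits (h ∷ r) ≡ v
reading l []      s = l , blank , s , refl , refl
reading l (b ∷ v) s = l , bit b , bits v ++ blank ∷ s , refl , cong (b ∷_) (read v)
  where
  read : ∀ v → readBits (bits v ++ blank ∷ s) ≡ v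
  read []      = refl
  read (b ∷ v) = cong (b ∷_) (read v)

halts-within : ∀ {T} → Poly T → (M : Mach ⊤) (f : BitString → BitString) →
  (∀ x → ∃[ l ] ∃[ h ] ∃[ r ] (M ⊢ at [] (bits x) ⇓[ T (length x) ] tt , (l , h , r)) × readBits (h ∷ r) ≡ f x) →
  Σ[ c ∈ ℕ ] Σ[ k ∈ ℕ ] ∀ x → HaltsWithin (toTM M) x (c * length x ^ k + c) (f x)
halts-within P M f computes = c , degree P , halts
  where
  c : ℕ
  c = factor P * 2 ^ degree P
  halts : ∀ x → HaltsWithin (toTM M) x (c * length x ^ degree P + c) (f x)
  halts x with computes x
  ... | l , h , r , w , e = subst (HaltsWithin (toTM M) x (c * length x ^ degree P + c)) e (toTM-halts M x (Runs-weaken (poly-bound P (length x)) w))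

-- Two levels of clocks, hence programs whose loops are nested at most twice.
module Machine (k : ℕ) where

  K R : ℕ
  K = suc (suc k)
  R = K + 4

  open Compile R K

  start : BitString → BitString → State K
  start x y = x ∷ y ∷ Vec.replicate k []

  full : BitString → BitString → ℕ → File
  full x y a = toList (start x y) ++ clocks a 2 []

  private
    len : ∀ (σ : State K) {Y} → length Y ≡ 4 → length (toList σ ++ Y) ≡ R
    len σ e = trans (length-++ (toList σ)) (cong₂ _+_ (Vecₚ.length-toList σ) e)

  fillBranch : Maybe Bool → Mach (⊤ ⊎ ⊤)
  fillBranch nothing  = pass (inj₂ tt) stay
  fillBranch (just b) = snocReg R 1 b >> (snocReg R (K + 0) false >> (snocReg R (K + 2) false >> pass (inj₁ tt) stay))

  unfillBranch : Maybe Bool → Mach (⊤ ⊎ ⊤)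
  unfillBranch nothing  = pass (inj₂ tt) stay
  unfillBranch (just b) = snocReg R 0 b >> pass (inj₁ tt) stay

  -- The clocks must receive one bit per input bit, but reading consumes a register. So the input
  -- wanders to register 1 while the clocks are filled, and back. Registers `K + 0` and `K + 2` are
  -- the full halves of the two clocks.
  fill unfill : Mach ⊤
  fill   = iter ⊤-finite (λ _ → bind (Maybe-finite Bool-finite) (popReg R 0) fillBranch) tt
  unfill = iter ⊤-finite (λ _ → bind (Maybe-finite Bool-finite) (popReg R 1) unfillBranch) tt

  fill⇒ : ∀ x y a → _⊢_⇒[_]_,_ R fill (full x y a) (length x * 5 + 2) tt (full [] (y ++ x) (length x + a))
  fill⇒ [] y a = iter-exit⇒ (bind⇒ (pop-empty⇒ a (start [] y) zero (clocks a 2 []) refl (len (start [] y) refl))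
    (subst (λ w → _⊢_⇒[_]_,_ R (fillBranch nothing) (full [] y a) 1 (inj₂ tt) (full [] w a)) (sym (++-identityʳ y)) pass⇒))
  fill⇒ (b ∷ x) y a = iter-next⇒
    (bind⇒ (pop-bit⇒ a (start (b ∷ x) y) zero (clocks a 2 []) refl (len (start (b ∷ x) y) refl))
      (bind⇒ (snoc⇒ a (start x y) (suc zero) (clocks a 2 []) (len (start x y) refl))
        (bind⇒ (snoc-c⇒ a 0 (zeros a ∷ [] ∷ []) (start x (y ++ [ b ])) a 0 (len (start x (y ++ [ b ])) refl))
          (bind⇒ (snoc-c⇒ (suc a) 1 [] (start x (y ++ [ b ])) a 0 (len (start x (y ++ [ b ])) refl))
            (pass⇒ {x = inj₁ tt})))))
    (subst₂ (λ w c → _⊢_⇒[_]_,_ R fill (full x (y ++ [ b ]) (suc a)) (length x * 5 + 2) tt (full [] w c))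
      (++-assoc y [ b ] x) (+-suc (length x) a) (fill⇒ x (y ++ [ b ]) (suc a)))

  unfill⇒ : ∀ x y a → _⊢_⇒[_]_,_ R unfill (full x y a) (length y * 3 + 2) tt (full (x ++ y) [] a)
  unfill⇒ x [] a = iter-exit⇒ (bind⇒ (pop-empty⇒ a (start x []) (suc zero) (clocks a 2 []) refl (len (start x []) refl))
    (subst (λ w → _⊢_⇒[_]_,_ R (unfillBranch nothing) (full x [] a) 1 (inj₂ tt) (full w [] a)) (sym (++-identityʳ x)) pass⇒))
  unfill⇒ x (b ∷ y) a = iter-next⇒
    (bind⇒ (pop-bit⇒ a (start x (b ∷ y)) (suc zero) (clocks a 2 []) refl (len (start x (b ∷ y)) refl))
      (bind⇒ (snoc⇒ a (start x y) zero (clocks a 2 []) (len (start x y) refl)) (pass⇒ {x = inj₁ tt})))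
    (subst (λ w → _⊢_⇒[_]_,_ R unfill (full (x ++ [ b ]) y a) (length y * 3 + 2) tt (full w [] a))
      (++-assoc x [ b ] y) (unfill⇒ (x ++ [ b ]) y a))

  work : Prog K 2 → Mach Bool
  work p = fill >> (unfill >> compile p)

  workCost : Prog K 2 → ℕ → ℕ
  workCost p N = (N * 5 + 2) + ((N * 3 + 2) + cost N p)

  final : Prog K 2 → BitString → State K
  final p x = proj₂ (sem (length x) p (start x []))

  work⇒ : ∀ p x → _⊢_⇒[_]_,_ R (work p) (x ∷ replicate (R ∸ 1) []) (workCost p (length x))
            (proj₁ (sem (length x) p (start x []))) (toList (final p x) ++ clocks (length x) 2 [])
  work⇒ p x = subst (λ F → _⊢_⇒[_]_,_ R (work p) F (workCost p (length x))
      (proj₁ (sem (length x) p (start x []))) (toList (final p x) ++ clocks (length x) 2 []))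
    initially
    (bind⇒ (subst (λ N → _⊢_⇒[_]_,_ R fill (full x [] 0) (length x * 5 + 2) tt (full [] x N)) (+-identityʳ _) (fill⇒ x [] 0))
      (bind⇒ (unfill⇒ [] x (length x)) (compile⇒ (length x) p (start x []) [] (len (start x []) refl))))
    where
    initially : full x [] 0 ≡ x ∷ replicate (R ∸ 1) []
    initially = cong (λ F → x ∷ [] ∷ F) (trans (cong (_++ replicate 4 []) (Vecₚ.toList-replicate k [])) (sym (replicate-+ k 4)))
      where
      replicate-+ : ∀ m n → replicate {A = BitString} (m + n) [] ≡ replicate m [] ++ replicate n []
      replicate-+ zero n    = refl
      replicate-+ (suc m) n = cong ([] ∷_) (replicate-+ m n)

  seek : Fin K → Mach ⊤
  seek o = forward (toℕ o) >> pass tt right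

  machine : Prog K 2 → Fin K → Mach ⊤
  machine p o = layout (R ∸ 1) >> bind Bool-finite (work p) (λ _ → seek o)

  layoutCost seekCost : ℕ
  layoutCost = 2 + (suc (R ∸ 1) + suc (suc (R ∸ 1) * 2))
  seekCost   = suc (K * 2) + 1

  time : Prog K 2 → ℕ → ℕ
  time p N = layoutCost * (2 + N) + (workCost p N * opCost R (N + workCost p N) + seekCost * (2 + (N + workCost p N)))

  time-poly : ∀ p → Poly (time p)
  time-poly p = const-poly layoutCost ⊗ (const-poly 2 ⊕ id-poly)
    ⊕ (work-poly ⊗ opCost-poly ⊕ const-poly seekCost ⊗ (const-poly 2 ⊕ (id-poly ⊕ work-poly)))
    where
    work-poly : Poly (workCost p)
    work-poly = (id-poly ⊗ const-poly 5 ⊕ const-poly 2) ⊕ ((id-poly ⊗ const-poly 3 ⊕ const-poly 2) ⊕ cost-poly p)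
    opCost-poly : Poly (λ N → opCost R (N + workCost p N))
    opCost-poly = const-poly 7 ⊗ (const-poly (suc (R * 3)) ⊗ (const-poly 2 ⊕ (id-poly ⊕ work-poly)))

  result : Prog K 2 → Fin K → BitString → BitString
  result p o x = lookup (final p x) o

  seek⇓ : ∀ o (σ : State K) Y {m} z → Fits m (toList σ ++ Y) → ∃[ l ] ∃[ h ] ∃[ r ]
          Takes (2 + m) (seek o) (home (toList σ ++ Y) z) seekCost tt (l , h , r) × readBits (h ∷ r) ≡ lookup σ o
  seek⇓ o σ Y {m} z fit with split σ o
  ... | pre , post , i , e with reading (blank ∷ passed pre []) (lookup σ o) (cells (post ++ Y) ++ z)
  ...   | l , h , r , at≡ , read≡ = l , h , r , sought , read≡
    where
    after : List Sym
    after = bits (lookup σ o) ++ blank ∷ (cells (post ++ Y) ++ z)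
    F≡ : toList σ ++ Y ≡ pre ++ lookup σ o ∷ (post ++ Y)
    F≡ = trans (cong (λ τ → toList τ ++ Y) (sym (Vecₚ.[]≔-lookup σ o)))
           (trans (cong (_++ Y) (e (lookup σ o))) (++-assoc pre (lookup σ o ∷ post) Y))
    home≡ : home (toList σ ++ Y) z ≡ ([] , blank , cells pre ++ after)
    home≡ = cong (λ c → [] , blank , c) (trans (cong (λ F → cells F ++ z) F≡)
      (trans (cells-++ pre {lookup σ o ∷ (post ++ Y)}) (cong (cells pre ++_) (cells-∷ (lookup σ o) {post ++ Y}))))
    forwards : Takes (2 + m) (forward (toℕ o)) ([] , blank , cells pre ++ after) (suc (toℕ o * 2)) tt (passed pre [] , blank , after)
    forwards = subst (λ i → Takes (2 + m) (forward i) ([] , blank , cells pre ++ after) (suc (i * 2)) tt (passed pre [] , blank , after))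
      i (forward⇓ pre (Allₚ.++⁻ˡ pre (subst (Fits m) F≡ fit)))
    sought : Takes (2 + m) (seek o) (home (toList σ ++ Y) z) seekCost tt (l , h , r)
    sought = Takes-weaken (+-monoˡ-≤ 1 (s≤s (*-monoˡ-≤ 2 (<⇒≤ (Finₚ.toℕ<n o)))))
      (subst₂ (λ T T′ → Takes (2 + m) (seek o) T (suc (toℕ o * 2) + 1) tt T′) (sym home≡) at≡
        (forwards ⨾ takes (act-right⇓ (λ h → tt , h , right) refl)))

  machine⇓ : ∀ p o x → ∃[ l ] ∃[ h ] ∃[ r ] (machine p o ⊢ at [] (bits x) ⇓[ time p (length x) ] tt , (l , h , r)) ×
               readBits (h ∷ r) ≡ result p o x
  machine⇓ p o x with runs (work⇒ p x) fits₀ 0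
    where
    fits₀ : Fits (length x) (x ∷ replicate (R ∸ 1) [])
    fits₀ = ≤-refl ∷ Allₚ.replicate⁺ (R ∸ 1) z≤n
  ... | z , w with seek⇓ o (final p x) (clocks (length x) 2 []) (blanks z)
                     (fits (work⇒ p x) (≤-refl ∷ Allₚ.replicate⁺ (R ∸ 1) z≤n))
  ...   | l , h , r , sought , read≡ =
    l , h , r , bind⇓ (steps (layout⇓ (R ∸ 1) x ≤-refl)) (bind⇓ w (steps sought)) , read≡

  result-halts : ∀ p o → Σ[ c ∈ ℕ ] Σ[ k ∈ ℕ ] ∀ x → HaltsWithin (toTM (machine p o)) x (c * length x ^ k + c) (result p o x)
  result-halts p o = halts-within (time-poly p) (machine p o) (result p o) (machine⇓ p o)

  polyTime : ∀ p o → PolyTime (result p o)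
  polyTime p o = toTM (machine p o) , result-halts p o

  polyTime₂ : ∀ p o → PolyTime₂ (λ x y → result p o (pairEnc x y))
  polyTime₂ p o = toTM (machine p o) , proj₁ (result-halts p o) , proj₁ (proj₂ (result-halts p o)) ,
    λ x y → proj₂ (proj₂ (result-halts p o)) (pairEnc x y)

-- Circuits as lists of gates

-- Programs see wires as unary numbers only, and shifting a typed gate would change its type.
data UGate : Set where
  and or : ℕ → ℕ → UGate
  neg    : ℕ → UGate

-- false beyond the end of the list
nth : BitString → ℕ → Bool
nth []      _       = false
nth (b ∷ w) zero    = b
nth (b ∷ w) (suc i) = nth w i

evU : UGate → BitString → Bool
evU (and i j) w = nth w i ∧ nth w j
evU (or i j)  w = nth w i ∨ nth w j
evU (neg i)   w = not (nth w i)

evUs : List UGate → BitString → BitString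
evUs []       w = w
evUs (g ∷ gs) w = evUs gs (w ++ [ evU g w ])

shift : ℕ → UGate → UGate
shift k (and i j) = and (k + i) (k + j)
shift k (or i j)  = or (k + i) (k + j)
shift k (neg i)   = neg (k + i)

encU : UGate → BitString
encU (and i j) = encℕ 0 ++ encℕ i ++ encℕ j
encU (or i j)  = encℕ 1 ++ encℕ i ++ encℕ j
encU (neg i)   = encℕ 2 ++ encℕ i

encUs : List UGate → BitString
encUs = concatMap (λ g → true ∷ encU g)

encOuts : List ℕ → BitString
encOuts = concatMap encℕ

ones : ℕ → BitString
ones k = replicate k true

replicate-+ : ∀ {A : Set} m n (x : A) → replicate (m + n) x ≡ replicate m x ++ replicate n x
replicate-+ zero n x    = refl
replicate-+ (suc m) n x = cong (x ∷_) (replicate-+ m n x)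

encℕ-+ : ∀ k i → encℕ (k + i) ≡ ones k ++ encℕ i
encℕ-+ k i = trans (cong (_++ [ false ]) (replicate-+ k i true)) (++-assoc (ones k) (ones i) [ false ])

-- Basic programs and rules for executing programs

clear : ∀ {K d} → Fin K → Prog K (suc d)
clear i = loop (case i stop skip skip)

move : ∀ {K d} → Fin K → Fin K → Prog K (suc d)
move i j = loop (case i stop (snoc j false) (snoc j true))

-- Since reading consumes `i`, its bits are duplicated into the scratch register `t` and fetched
-- back. The target is appended to, so copying a unary number adds it.
copy : ∀ {K d} → Fin K → Fin K → Fin K → Prog K (suc d)
copy i j t = loop (case i stop (snoc j false ； snoc t false) (snoc j true ； snoc t true)) ； move t i

-- A record, so that program and states can be inferred from an execution without `sem` being
-- unfolded.
record Exec {K d} (N : ℕ) (p : Prog K d) (σ : State K) (b : Bool) (τ : State K) : Set where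
  constructor exec
  field
    result : sem N p σ ≡ (b , τ)

module Execution {K : ℕ} {N : ℕ} where

  infixr 4 _∙_
  _∙_ : ∀ {d} {p q : Prog K d} {σ τ υ b} → Exec N p σ true τ → Exec N q τ b υ → Exec N (p ； q) σ b υ
  _∙_ {q = q} (exec e) (exec f) = exec (trans (cong (andThen N q) e) f)

  halt : ∀ {d} {p q : Prog K d} {σ τ} → Exec N p σ false τ → Exec N (p ； q) σ false τ
  halt {q = q} (exec e) = exec (cong (andThen N q) e)

  skip! : ∀ {d σ} → Exec N (skip {K} {d}) σ true σ
  skip! = exec refl

  stop! : ∀ {d σ} → Exec N (stop {K} {d}) σ false σ
  stop! = exec refl

  snoc! : ∀ {d i b σ} → Exec N (snoc {K} {d} i b) σ true (σ [ i ]≔ (lookup σ i ++ [ b ]))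
  snoc! = exec refl

  module _ {d : ℕ} {i : Fin K} {p q r : Prog K d} {σ : State K} {b : Bool} {τ : State K} where

    case-empty : lookup σ i ≡ [] → Exec N p σ b τ → Exec N (case i p q r) σ b τ
    case-empty e (exec f) = exec (trans (cong (branch N i p q r σ) e) f)

    case-false : ∀ {v} → lookup σ i ≡ false ∷ v → Exec N q (σ [ i ]≔ v) b τ → Exec N (case i p q r) σ b τ
    case-false e (exec f) = exec (trans (cong (branch N i p q r σ) e) f)

    case-true : ∀ {v} → lookup σ i ≡ true ∷ v → Exec N r (σ [ i ]≔ v) b τ → Exec N (case i p q r) σ b τ
    case-true e (exec f) = exec (trans (cong (branch N i p q r σ) e) f)

  case-bit : ∀ {d} {i : Fin K} {p : Prog K d} {q : Bool → Prog K d} {σ b τ c v} → lookup σ i ≡ c ∷ v →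
             Exec N (q c) (σ [ i ]≔ v) b τ → Exec N (case i p (q false) (q true)) σ b τ
  case-bit {c = false} = case-false
  case-bit {c = true}  = case-true

  data Rounds {d} (p : Prog K d) : ℕ → State K → State K → Set where
    last : ∀ {σ τ} → Exec N p σ false τ → Rounds p 1 σ τ
    more : ∀ {n σ τ υ} → Exec N p σ true τ → Rounds p n τ υ → Rounds p (suc n) σ υ

  -- As long as `stop` comes in time, the clock is invisible and `loop` is an ordinary while loop.
  -- The round that meets `stop` counts too, so a loop emptying a register of length L asks for L <
  -- N.
  loop! : ∀ {d} {p : Prog K d} {n σ τ} → Rounds p n σ τ → n ≤ N → Exec N (loop p) σ true τ
  loop! {p = p} rs n≤N = exec (cong (true ,_) (go rs n≤N))
    where
    go : ∀ {n m σ τ} → Rounds p n σ τ → n ≤ m → repeat m (sem N p) (true , σ) ≡ τ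
    go {m = suc zero}    (last (exec e)) (s≤s _)    rewrite e = refl
    go {m = suc (suc m)} (last (exec e)) (s≤s _)    rewrite e = refl
    go {m = suc m}       (more (exec e) rs) (s≤s p) rewrite e = go rs p

  resume : ∀ {d} {p : Prog K d} {σ b τ τ′} → τ ≡ τ′ → Exec N p σ b τ → Exec N p σ b τ′
  resume refl e = e

  clear! : ∀ {d i σ} → length (lookup σ i) < N → Exec N (clear {K} {d} i) σ true (σ [ i ]≔ [])
  clear! {i = i} {σ} = loop! (go (lookup σ i) refl)
    where
    go : ∀ v {σ} → lookup σ i ≡ v → Rounds (case i stop skip skip) (suc (length v)) σ (σ [ i ]≔ [])
    go [] {σ} e      = last (case-empty e (resume (trans (sym (Vecₚ.[]≔-lookup σ i)) (cong (σ [ i ]≔_) e)) stop!))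
    go (b ∷ v) {σ} e = more (case-bit {q = λ _ → skip} e skip!)
      (subst (Rounds _ _ _) (Vecₚ.[]≔-idempotent σ i) (go v (Vecₚ.lookup∘update i σ v)))

  -- A normal form for the states that differ from `σ` only in `i` and `j`; every update in a loop
  -- is brought back to it.
  module Two {i j : Fin K} (i≢j : i ≢ j) (σ : State K) where

    set : BitString → BitString → State K
    set u v = σ [ i ]≔ u [ j ]≔ v

    get-i : ∀ {u v} → lookup (set u v) i ≡ u
    get-i {u} {v} = trans (Vecₚ.lookup∘update′ i≢j (σ [ i ]≔ u) v) (Vecₚ.lookup∘update i σ u)

    get-j : ∀ {u v} → lookup (set u v) j ≡ v
    get-j {u} {v} = Vecₚ.lookup∘update j (σ [ i ]≔ u) v

    set-i : ∀ {u u′ v} → set u v [ i ]≔ u′ ≡ set u′ v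
    set-i {u} {u′} {v} = trans (Vecₚ.[]≔-commutes (σ [ i ]≔ u) j i (i≢j ∘ sym)) (cong (_[ j ]≔ v) (Vecₚ.[]≔-idempotent σ i))

    set-j : ∀ {u v v′} → set u v [ j ]≔ v′ ≡ set u v′
    set-j {u} = Vecₚ.[]≔-idempotent (σ [ i ]≔ u) j

    set-same : set (lookup σ i) (lookup σ j) ≡ σ
    set-same = trans (cong (_[ j ]≔ lookup σ j) (Vecₚ.[]≔-lookup σ i)) (Vecₚ.[]≔-lookup σ j)

    shuttle : ∀ {d} c {u v} → Exec N (snoc {K} {d} j c) (set (c ∷ u) v [ i ]≔ u) true (set u (v ++ [ c ]))
    shuttle c {u} {v} = resume (trans (cong (λ τ → τ [ j ]≔ (lookup τ j ++ [ c ])) set-i)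
      (trans (cong (λ w → set u v [ j ]≔ (w ++ [ c ])) get-j) set-j)) snoc!

    moving : ∀ {d} u {v} → Rounds (case {K} {d} i stop (snoc j false) (snoc j true)) (suc (length u)) (set u v) (set [] (v ++ u))
    moving [] {v}      = last (case-empty get-i (resume (cong (set []) (sym (++-identityʳ v))) stop!))
    moving (c ∷ u) {v} = more (case-bit {q = snoc j} get-i (shuttle c))
      (subst (Rounds _ _ _) (cong (set []) (++-assoc v [ c ] u)) (moving u))

    move! : ∀ {d u v} → length u < N → Exec N (move {K} {d} i j) (set u v) true (set [] (v ++ u))
    move! {u = u} = loop! (moving u)

  move! : ∀ {d i j σ} → i ≢ j → length (lookup σ i) < N →
          Exec N (move {K} {d} i j) σ true (σ [ i ]≔ [] [ j ]≔ (lookup σ j ++ lookup σ i))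
  move! {i = i} {j} {σ} i≢j l = subst (λ τ → Exec N (move i j) τ true (σ [ i ]≔ [] [ j ]≔ (lookup σ j ++ lookup σ i))) set-same (Two.move! i≢j σ l)
    where open Two i≢j σ

  module Three {i j t : Fin K} (i≢j : i ≢ j) (i≢t : i ≢ t) (j≢t : j ≢ t) (σ : State K) where

    open Two i≢j σ using (set; set-i; set-j; get-i; get-j)

    put : BitString → BitString → BitString → State K
    put u v w = set u v [ t ]≔ w

    put-i : ∀ {u u′ v w} → put u v w [ i ]≔ u′ ≡ put u′ v w
    put-i {u} {u′} {v} {w} = trans (Vecₚ.[]≔-commutes (set u v) t i (i≢t ∘ sym)) (cong (_[ t ]≔ w) set-i)

    put-j : ∀ {u v v′ w} → put u v w [ j ]≔ v′ ≡ put u v′ w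
    put-j {u} {v} {v′} {w} = trans (Vecₚ.[]≔-commutes (set u v) t j (j≢t ∘ sym)) (cong (_[ t ]≔ w) set-j)

    put-t : ∀ {u v w w′} → put u v w [ t ]≔ w′ ≡ put u v w′
    put-t {u} {v} = Vecₚ.[]≔-idempotent (set u v) t

    fetch-i : ∀ {u v w} → lookup (put u v w) i ≡ u
    fetch-i {u} {v} {w} = trans (Vecₚ.lookup∘update′ i≢t (set u v) w) get-i

    fetch-j : ∀ {u v w} → lookup (put u v w) j ≡ v
    fetch-j {u} {v} {w} = trans (Vecₚ.lookup∘update′ j≢t (set u v) w) get-j

    fetch-t : ∀ {u v w} → lookup (put u v w) t ≡ w
    fetch-t {u} {v} {w} = Vecₚ.lookup∘update t (set u v) w

    shuttle : ∀ {d} c {u v w} → Exec N (snoc {K} {d} j c ； snoc t c) (put (c ∷ u) v w [ i ]≔ u) true (put u (v ++ [ c ]) (w ++ [ c ]))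
    shuttle c {u} {v} {w} =
      resume (trans (cong (λ τ → τ [ j ]≔ (lookup τ j ++ [ c ])) put-i)
        (trans (cong (λ x → put u v w [ j ]≔ (x ++ [ c ])) fetch-j) put-j)) snoc!
      ∙ resume (trans (cong (λ x → put u (v ++ [ c ]) w [ t ]≔ (x ++ [ c ])) fetch-t) put-t) snoc!

    copying : ∀ {d} u {v w} → Rounds (case {K} {d} i stop (snoc j false ； snoc t false) (snoc j true ； snoc t true))
                (suc (length u)) (put u v w) (put [] (v ++ u) (w ++ u))
    copying [] {v} {w}      = last (case-empty fetch-i
      (resume (sym (trans (cong (λ x → put [] x (w ++ [])) (++-identityʳ v)) (cong (put [] v) (++-identityʳ w)))) stop!))
    copying (c ∷ u) {v} {w} = more (case-bit {q = λ b → snoc j b ； snoc t b} fetch-i (shuttle c))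
      (subst (Rounds _ _ _) (trans (cong (λ x → put [] x ((w ++ [ c ]) ++ u)) (++-assoc v [ c ] u))
                                   (cong (put [] (v ++ c ∷ u)) (++-assoc w [ c ] u))) (copying u))

    restored : ∀ {u v w} → (put u v w) [ t ]≔ [] [ i ]≔ (lookup (put u v w) i ++ lookup (put u v w) t) ≡ put (u ++ w) v []
    restored {u} {v} {w} = trans (cong (_[ i ]≔ (lookup (put u v w) i ++ lookup (put u v w) t)) put-t) (trans put-i
      (trans (cong (λ x → put (x ++ lookup (put u v w) t) v []) fetch-i) (cong (λ x → put (u ++ x) v []) fetch-t)))

  copy! : ∀ {d i j t σ} → i ≢ j → i ≢ t → j ≢ t → lookup σ t ≡ [] → length (lookup σ i) < N →
          Exec N (copy {K} {d} i j t) σ true (σ [ j ]≔ (lookup σ j ++ lookup σ i))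
  copy! {i = i} {j} {t} {σ} i≢j i≢t j≢t t-empty l = subst (λ τ → Exec N (copy i j t) τ true result) initial≡
    (loop! (copying u) l ∙ resume (trans (restored {[]} {v ++ u} {u}) final≡)
      (move! (i≢t ∘ sym) (subst (λ x → length x < N) (sym fetch-t) l)))
    where
    open Three i≢j i≢t j≢t σ
    u v : BitString
    u = lookup σ i
    v = lookup σ j
    result : State K
    result = σ [ j ]≔ (v ++ u)
    initial≡ : put u v [] ≡ σ
    initial≡ = trans (cong (_[ t ]≔ []) (Two.set-same i≢j σ)) (trans (cong (σ [ t ]≔_) (sym t-empty)) (Vecₚ.[]≔-lookup σ t))
    final≡ : put u (v ++ u) [] ≡ result
    final≡ = trans (sym put-j) (cong (_[ j ]≔ (v ++ u)) initial≡)

-- Parsing instances and evaluating circuits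

open Execution public

rS rW rV rY rO rF rT rJ rE : Fin 22
rS = # 0
rW = # 1
rV = # 2
rY = # 3
rO = # 4
rF = # 5
rT = # 6
rJ = # 7
rE = # 8

hi : Fin 13 → Fin 22
hi r = 9 ↑ʳ r

-- These hold n, 2n and the number l of wires in unary, the bits of the gates (with terminator) and
-- of the output wires of C, and the three given nodes.
nn dd ll gg uu aa bb cc : Fin 13
nn = # 0
dd = # 1
ll = # 2
gg = # 3
uu = # 4
aa = # 5
bb = # 6
cc = # 7

-- stream, wires, cursor into the wires, operands, output, offset of the emitted indices, scratch, counter, values
core : (s w v y o f t j e : BitString) → Vec BitString 13 → State 22
core s w v y o f t j e ρ = s ∷ w ∷ v ∷ y ∷ o ∷ f ∷ t ∷ j ∷ e ∷ ρ

P : ℕ → Set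
P = Prog 22

indexStep : ∀ {d} → P d
indexStep = case rS stop (snoc rO false ； stop) (snoc rO true ； case rV skip skip skip)

-- One program serves for evaluating and for copying circuits: an index on the stream is looked up
-- among the wires and also echoed on `rO` behind the offset `rF`, which in unary adds the offset.
-- The effect that is not wanted is cleared afterwards. A wire beyond the end reads as false, in
-- accordance with `nth`.
look : ∀ {d} → Fin 22 → P (suc d)
look y = copy rF rO rT ； copy rW rV rT ； loop indexStep
       ； case rV (snoc y false) (snoc y false) (snoc y true) ； clear rV

andEnd orEnd negEnd : ∀ {d} → P d
andEnd = case rY stop (case rY stop (snoc rW false) (snoc rW false)) (case rY stop (snoc rW false) (snoc rW true))
orEnd  = case rY stop (case rY stop (snoc rW false) (snoc rW true)) (case rY stop (snoc rW true) (snoc rW true))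
negEnd = case rY stop (snoc rW true) (snoc rW false)

gateStep : ∀ {d} → P (suc d)
gateStep = case rS stop stop (snoc rO true ； case rS stop
  (snoc rO false ； look rY ； look rY ； andEnd)
  (snoc rO true ； case rS stop
    (snoc rO false ； look rY ； look rY ； orEnd)
    (snoc rO true ； case rS stop (snoc rO false ； look rY ； negEnd) stop)))

gatesRun : P 2
gatesRun = loop gateStep

outsRun : P 2
outsRun = loop (case rJ stop stop (look rE))

take : Fin 13 → P 2
take r = copy (hi dd) rJ rT ； loop (case rJ stop stop (case rS stop (snoc (hi r) false) (snoc (hi r) true)))

parse : P 2
parse = loop (case rS stop stop (snoc (hi nn) true ； snoc (hi dd) true ； snoc (hi dd) true))
      ； loop (case rS stop stop (snoc (hi ll) true))
      -- Here the circuit is only copied, with offset zero: the wires start out empty, and what is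
      -- computed on them is thrown away below. The terminator swallowed by the last round is put
      -- back.
      ； gatesRun ； snoc rO false ； move rO (hi gg)
      ； copy (hi nn) rJ rT ； outsRun ； move rO (hi uu)
      ； clear rW ； clear rE ； take aa ； take bb ； take cc

evalPair : Fin 13 → Fin 13 → P 2
evalPair p q = copy (hi p) rW rT ； copy (hi q) rW rT ； copy (hi gg) rS rT ； gatesRun ； clear rO
             ； copy (hi uu) rS rT ； copy (hi nn) rJ rT ； outsRun ； clear rO ； clear rW

append : ∀ {K} → Fin K → BitString → State K → State K
append i v σ = σ [ i ]≔ (lookup σ i ++ v)

append-comm : ∀ {K} {i j : Fin K} {u v} (σ : State K) → i ≢ j → append i v σ [ j ]≔ u ≡ append i v (σ [ j ]≔ u)
append-comm {i = i} {j} {u} {v} σ i≢j = trans (Vecₚ.[]≔-commutes σ i j i≢j)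
  (cong (λ w → σ [ j ]≔ u [ i ]≔ (w ++ v)) (sym (Vecₚ.lookup∘update′ i≢j σ u)))

append-[] : ∀ {K} (i : Fin K) σ → append i [] σ ≡ σ
append-[] i σ = trans (cong (σ [ i ]≔_) (++-identityʳ _)) (Vecₚ.[]≔-lookup σ i)

append-++ : ∀ {K} (i : Fin K) σ {u v} → append i v (append i u σ) ≡ append i (u ++ v) σ
append-++ i σ {u} {v} = trans (Vecₚ.[]≔-idempotent σ i)
  (cong (σ [ i ]≔_) (trans (cong (_++ v) (Vecₚ.lookup∘update i σ _)) (++-assoc (lookup σ i) u v)))

nth-drop : ∀ i w → (drop i w ≡ [] × nth w i ≡ false) ⊎ (∃[ v ] drop i w ≡ nth w i ∷ v)
nth-drop i []            = inj₁ (drop-[] i , refl)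
nth-drop zero (b ∷ w)    = inj₂ (w , refl)
nth-drop (suc i) (b ∷ w) = nth-drop i w

colourU : List UGate → List ℕ → BitString → BitString
colourU gs os w = map (nth (evUs gs w)) os

length-encℕ : ∀ i → length (encℕ i) ≡ suc i
length-encℕ i = trans (length-++ (ones i)) (trans (cong (_+ 1) (length-replicate i)) (+-comm i 1))

length-evUs : ∀ gs w → length (evUs gs w) ≡ length w + length gs
length-evUs [] w       = sym (+-identityʳ _)
length-evUs (g ∷ gs) w = trans (length-evUs gs (w ++ [ evU g w ]))
  (trans (cong (_+ length gs) (trans (length-++ w) (+-comm _ 1))) (sym (+-suc _ _)))

index-bound : ∀ {N i u} → length (encℕ i ++ u) ≤ N → i < N
index-bound {N} {i} {u} p = ≤-trans (≤-reflexive (sym (length-encℕ i)))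
  (≤-trans (m≤m+n _ (length u)) (≤-trans (≤-reflexive (sym (length-++ (encℕ i)))) p))

suffix-bound : ∀ {N} (u : BitString) {v} → length (u ++ v) ≤ N → length v ≤ N
suffix-bound u p = ≤-trans (m≤n+m _ (length u)) (≤-trans (≤-reflexive (sym (length-++ u))) p)

prefix-bound : ∀ {N} (u : BitString) {v} → length (u ++ v) ≤ N → length u ≤ N
prefix-bound u p = ≤-trans (m≤m+n (length u) _) (≤-trans (≤-reflexive (sym (length-++ u))) p)

module _ {N : ℕ} where

  index! : ∀ {d} i v {s w y o f t j e ρ} → Rounds {N = N} (indexStep {d}) (suc i)
             (core (encℕ i ++ s) w v y o f t j e ρ) (core s w (drop i v) y (o ++ encℕ i) f t j e ρ)
  index! zero v = last (case-false refl (snoc! ∙ stop!))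
  index! {d} (suc i) [] {s} {w} {y} {o} {f} {t} {j} {e} {ρ} =
    more (case-true refl (snoc! ∙ case-empty refl skip!))
      (subst₂ (λ v o′ → Rounds (indexStep {d}) (suc i) (core (encℕ i ++ s) w [] y (o ++ [ true ]) f t j e ρ) (core s w v y o′ f t j e ρ))
        (drop-[] i) (++-assoc o [ true ] (encℕ i)) (index! i []))
  index! {d} (suc i) (b ∷ v) {s} {w} {y} {o} {f} {t} {j} {e} {ρ} =
    more (case-true refl (snoc! ∙ case-bit {q = λ _ → skip} refl skip!))
      (subst (λ o′ → Rounds (indexStep {d}) (suc i) (core (encℕ i ++ s) w v y (o ++ [ true ]) f t j e ρ) (core s w (drop i v) y o′ f t j e ρ))
        (++-assoc o [ true ] (encℕ i)) (index! i v))

  look! : ∀ {d} r → r ≢ rV → ∀ i {s w y o f j e ρ} → i < N → length w < N → length f < N →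
          Exec N (look {d} r) (core (encℕ i ++ s) w [] y o f [] j e ρ) true
            (append r [ nth w i ] (core s w [] y (o ++ (f ++ encℕ i)) f [] j e ρ))
  look! {d} r r≢V i {s} {w} {y} {o} {f} {j} {e} {ρ} i<N w<N f<N =
    copy! (λ ()) (λ ()) (λ ()) refl f<N ∙ (copy! (λ ()) (λ ()) (λ ()) refl w<N ∙ (loop! (index! i w) i<N ∙ finish (nth-drop i w)))
    where
    σ : BitString → State 22
    σ v = core s w v y ((o ++ f) ++ encℕ i) f [] j e ρ
    σ≡ : append r [ nth w i ] (σ []) ≡ append r [ nth w i ] (core s w [] y (o ++ (f ++ encℕ i)) f [] j e ρ)
    σ≡ = cong (λ o′ → append r [ nth w i ] (core s w [] y o′ f [] j e ρ)) (++-assoc o f (encℕ i))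
    cleared : ∀ {v} → length v < N → Exec N (clear {d = d} rV) (append r [ nth w i ] (σ v)) true
                (append r [ nth w i ] (core s w [] y (o ++ (f ++ encℕ i)) f [] j e ρ))
    cleared {v} p = resume (trans (append-comm (σ v) r≢V) σ≡)
      (clear! (subst (λ u → length u < N) (sym (Vecₚ.lookup∘update′ (r≢V ∘ sym) (σ v) _)) p))
    finish : (drop i w ≡ [] × nth w i ≡ false) ⊎ (∃[ v ] drop i w ≡ nth w i ∷ v) →
             Exec N (case {d = suc d} rV (snoc r false) (snoc r false) (snoc r true) ； clear rV) (σ (drop i w)) true
               (append r [ nth w i ] (core s w [] y (o ++ (f ++ encℕ i)) f [] j e ρ))
    finish (inj₁ (d≡ , n≡)) = case-empty {d = suc d} {σ = σ (drop i w)} d≡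
      (resume (trans (cong (λ v → append r [ false ] (σ v)) d≡) (cong (λ b → append r [ b ] (σ [])) (sym n≡))) snoc!)
      ∙ cleared (≤-trans (s≤s z≤n) w<N)
    finish (inj₂ (v , d≡)) = case-bit {d = suc d} {q = λ b → snoc r b} {σ = σ (drop i w)} d≡ snoc! ∙ cleared v<N
      where
      v<N : length v < N
      v<N = ≤-trans (s≤s (≤-trans (n≤1+n _) (≤-trans (≤-reflexive (trans (sym (cong length d≡)) (length-drop i w))) (m∸n≤m (length w) i)))) w<N

  module _ {s w o f j e : BitString} {ρ : Vec BitString 13} where

    private
      operands : BitString → State 22
      operands y = core s w [] y o f [] j e ρ

      result : Bool → State 22
      result b = core s (w ++ [ b ]) [] [] o f [] j e ρ

    andEnd! : ∀ {d} b c → Exec N (andEnd {d}) (operands (b ∷ c ∷ [])) true (result (b ∧ c))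
    andEnd! false c     = case-false refl (case-bit {q = λ _ → snoc rW false} refl snoc!)
    andEnd! true false  = case-true refl (case-false refl snoc!)
    andEnd! true true   = case-true refl (case-true refl snoc!)

    orEnd! : ∀ {d} b c → Exec N (orEnd {d}) (operands (b ∷ c ∷ [])) true (result (b ∨ c))
    orEnd! false false = case-false refl (case-false refl snoc!)
    orEnd! false true  = case-false refl (case-true refl snoc!)
    orEnd! true c      = case-true refl (case-bit {q = λ _ → snoc rW true} refl snoc!)

    negEnd! : ∀ {d} b → Exec N (negEnd {d}) (operands (b ∷ [])) true (result (not b))
    negEnd! false = case-false refl snoc!
    negEnd! true  = case-true refl snoc!

  private
    two-indices : ∀ (o u : BitString) k i j → ((o ++ u) ++ (ones k ++ encℕ i)) ++ (ones k ++ encℕ j) ≡ o ++ (u ++ (encℕ (k + i) ++ encℕ (k + j)))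
    two-indices o u k i j rewrite sym (encℕ-+ k i) | sym (encℕ-+ k j) =
      trans (++-assoc (o ++ u) (encℕ (k + i)) _) (++-assoc o u _)

    one-index : ∀ (o u : BitString) k i → (o ++ u) ++ (ones k ++ encℕ i) ≡ o ++ (u ++ encℕ (k + i))
    one-index o u k i rewrite sym (encℕ-+ k i) = ++-assoc o u _

  gateStep! : ∀ {d} g {s w o k j e ρ} → length (encU g) ≤ N → length w < N → k < N →
              Exec N (gateStep {d}) (core ((true ∷ encU g) ++ s) w [] [] o (ones k) [] j e ρ) true
                (core s (w ++ [ evU g w ]) [] [] (o ++ (true ∷ encU (shift k g))) (ones k) [] j e ρ)
  gateStep! (and x y) {s} {w} {o} {k} {j} {e} {ρ} g≤N w<N k<N =
    resume (cong (λ o′ → core s (w ++ [ nth w x ∧ nth w y ]) [] [] o′ (ones k) [] j e ρ)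
        (trans (cong (λ o″ → (o″ ++ (ones k ++ encℕ x)) ++ (ones k ++ encℕ y)) (++-assoc o [ true ] [ false ]))
               (two-indices o (true ∷ false ∷ []) k x y)))
      (case-true refl (snoc! ∙ case-false (cong (false ∷_) (++-assoc (encℕ x) (encℕ y) s)) (snoc! ∙
        (look! rY (λ ()) x (index-bound (≤-trans (n≤1+n _) g≤N)) w<N k<N′ ∙
        (look! rY (λ ()) y (index-bound {u = []} (≤-trans (≤-reflexive (cong length (++-identityʳ (encℕ y)))) (suffix-bound (encℕ x) (≤-trans (n≤1+n _) g≤N)))) w<N k<N′ ∙
        andEnd! (nth w x) (nth w y))))))
    where
    k<N′ : length (ones k) < N
    k<N′ = subst (_< N) (sym (length-replicate k)) k<N
  gateStep! (or x y) {s} {w} {o} {k} {j} {e} {ρ} g≤N w<N k<N =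
    resume (cong (λ o′ → core s (w ++ [ nth w x ∨ nth w y ]) [] [] o′ (ones k) [] j e ρ)
        (trans (cong (λ o″ → (o″ ++ (ones k ++ encℕ x)) ++ (ones k ++ encℕ y)) (trans (cong (_++ [ false ]) (++-assoc o [ true ] [ true ])) (++-assoc o _ [ false ])))
               (two-indices o (true ∷ true ∷ false ∷ []) k x y)))
      (case-true refl (snoc! ∙ case-true refl (snoc! ∙ case-false (cong (false ∷_) (++-assoc (encℕ x) (encℕ y) s)) (snoc! ∙
        (look! rY (λ ()) x (index-bound (≤-trans (n≤1+n _) (≤-trans (n≤1+n _) g≤N))) w<N k<N′ ∙
        (look! rY (λ ()) y (index-bound {u = []} (≤-trans (≤-reflexive (cong length (++-identityʳ (encℕ y)))) (suffix-bound (encℕ x) (≤-trans (n≤1+n _) (≤-trans (n≤1+n _) g≤N))))) w<N k<N′ ∙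
        orEnd! (nth w x) (nth w y)))))))
    where
    k<N′ : length (ones k) < N
    k<N′ = subst (_< N) (sym (length-replicate k)) k<N
  gateStep! (neg x) {s} {w} {o} {k} {j} {e} {ρ} g≤N w<N k<N =
    resume (cong (λ o′ → core s (w ++ [ not (nth w x) ]) [] [] o′ (ones k) [] j e ρ)
        (trans (cong (_++ (ones k ++ encℕ x)) (trans (cong (_++ [ false ]) (trans (cong (_++ [ true ]) (++-assoc o [ true ] [ true ])) (++-assoc o _ [ true ]))) (++-assoc o _ [ false ])))
               (one-index o (true ∷ true ∷ true ∷ false ∷ []) k x)))
      (case-true refl (snoc! ∙ case-true refl (snoc! ∙ case-true refl (snoc! ∙ case-false refl (snoc! ∙
        (look! rY (λ ()) x (index-bound {u = []} (≤-trans (≤-reflexive (cong length (++-identityʳ (encℕ x)))) (≤-trans (m≤n+m _ 3) g≤N))) w<N k<N′ ∙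
        negEnd! (nth w x)))))))
    where
    k<N′ : length (ones k) < N
    k<N′ = subst (_< N) (sym (length-replicate k)) k<N

  private
    gateRounds : ∀ gs {s w o k j e ρ} → length (encUs gs) ≤ N → length w + length gs < N → k < N →
                 Rounds {N = N} (gateStep {0}) (suc (length gs)) (core (encUs gs ++ false ∷ s) w [] [] o (ones k) [] j e ρ)
                   (core s (evUs gs w) [] [] (o ++ encUs (map (shift k) gs)) (ones k) [] j e ρ)
    gateRounds [] {s} {w} {o} {k} {j} {e} {ρ} p q r =
      last (case-false refl (resume (cong (λ o′ → core s w [] [] o′ (ones k) [] j e ρ) (sym (++-identityʳ o))) stop!))
    gateRounds (g ∷ gs) {s} {w} {o} {k} {j} {e} {ρ} p q r =
      subst₂ (Rounds (gateStep {0}) (suc (suc (length gs))))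
        (cong (λ s′ → core s′ w [] [] o (ones k) [] j e ρ) (sym (++-assoc (true ∷ encU g) (encUs gs) (false ∷ s))))
        (cong (λ o′ → core s (evUs (g ∷ gs) w) [] [] o′ (ones k) [] j e ρ) (++-assoc o (true ∷ encU (shift k g)) _))
        (more (gateStep! g (≤-trans (n≤1+n _) (prefix-bound (true ∷ encU g) p)) (≤-trans (s≤s (m≤m+n _ _)) q) r)
          (gateRounds gs (suffix-bound (true ∷ encU g) p)
            (subst (_< N) (trans (+-suc (length w) _) (cong (_+ length gs) (sym (trans (length-++ w) (+-comm (length w) 1))))) q) r))

  gatesRun! : ∀ gs {s w o k j e ρ} → length (encUs gs) ≤ N → length w + length gs < N → k < N →
              Exec N gatesRun (core (encUs gs ++ false ∷ s) w [] [] o (ones k) [] j e ρ) true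
                (core s (evUs gs w) [] [] (o ++ encUs (map (shift k) gs)) (ones k) [] j e ρ)
  gatesRun! gs {w = w} p q r = loop! (gateRounds gs p q r) (≤-trans (s≤s (m≤n+m _ (length w))) q)

  private
    outRounds : ∀ os {s w o k e ρ} → length (encOuts os) ≤ N → length w < N → k < N →
                Rounds {N = N} (case rJ stop stop (look {0} rE)) (suc (length os))
                  (core (encOuts os ++ s) w [] [] o (ones k) [] (ones (length os)) e ρ)
                  (core s w [] [] (o ++ encOuts (map (k +_) os)) (ones k) [] [] (e ++ map (nth w) os) ρ)
    outRounds [] {s} {w} {o} {k} {e} {ρ} p q r =
      last (case-empty refl (resume (cong₂ (λ o′ e′ → core s w [] [] o′ (ones k) [] [] e′ ρ) (sym (++-identityʳ o)) (sym (++-identityʳ e))) stop!))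
    outRounds (x ∷ os) {s} {w} {o} {k} {e} {ρ} p q r =
      subst₂ (Rounds (case rJ stop stop (look rE)) (suc (suc (length os))))
        (cong (λ s′ → core s′ w [] [] o (ones k) [] (ones (length (x ∷ os))) e ρ) (sym (++-assoc (encℕ x) (encOuts os) s)))
        (cong₂ (λ o′ e′ → core s w [] [] o′ (ones k) [] [] e′ ρ)
          (trans (cong (λ u → (o ++ u) ++ _) (sym (encℕ-+ k x))) (++-assoc o (encℕ (k + x)) _)) (++-assoc e [ nth w x ] _))
        (more (case-true refl (look! rE (λ ()) x (index-bound p) q (subst (_< N) (sym (length-replicate k)) r)))
          (outRounds os (suffix-bound (encℕ x) p) q r))

  outsRun! : ∀ os {s w o k e ρ} → length (encOuts os) ≤ N → length os < N → length w < N → k < N →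
             Exec N outsRun (core (encOuts os ++ s) w [] [] o (ones k) [] (ones (length os)) e ρ) true
               (core s w [] [] (o ++ encOuts (map (k +_) os)) (ones k) [] [] (e ++ map (nth w) os) ρ)
  outsRun! os p l q r = loop! (outRounds os p q r) l

  take! : ∀ r x {s w v y o f e ρ} → lookup ρ dd ≡ ones (length x) → length x < N →
          Exec N (take r) (core (x ++ s) w v y o f [] [] e ρ) true (core s w v y o f [] [] e (append r x ρ))
  take! r x {s} {w} {v} {y} {o} {f} {e} {ρ} d≡ x<N =
    resume (cong (λ j → core (x ++ s) w v y o f [] j e ρ) d≡)
      (copy! (λ ()) (λ ()) (λ ()) refl (subst (_< N) (sym (trans (cong length d≡) (length-replicate (length x)))) x<N))
    ∙ loop! (go x) x<N
    where
    go : ∀ x {ρ} → Rounds (case rJ stop stop (case rS stop (snoc (hi r) false) (snoc (hi r) true))) (suc (length x))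
           (core (x ++ s) w v y o f [] (ones (length x)) e ρ) (core s w v y o f [] [] e (append r x ρ))
    go [] {ρ}      = last (case-empty refl (resume (cong (core s w v y o f [] [] e) (sym (append-[] r ρ))) stop!))
    go (b ∷ x) {ρ} = more (case-true refl (case-bit {q = snoc (hi r)} refl snoc!))
      (subst (λ ρ′ → Rounds _ _ (core (x ++ s) w v y o f [] (ones (length x)) e (append r [ b ] ρ)) (core s w v y o f [] [] e ρ′))
        (append-++ r ρ) (go x))

-- Everything a loop runs through, compared with the clock. The bound on the wires holds because
-- their number is part of the encoding of C, in unary.
record Bounds (N n l : ℕ) (gs : List UGate) (os : List ℕ) : Set where
  field
    nodes<N  : 2 * n < N
    width<N  : l < N
    gates<N  : length (encUs gs ++ [ false ]) < N
    outs<N   : length (encOuts os) < N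
    wires<N  : (2 * n + 2 * n) + length gs < N
    number   : length os ≡ n

  n<N : n < N
  n<N = ≤-trans (s≤s (m≤m+n n _)) nodes<N

  os<N : length os < N
  os<N = subst (_< N) (sym number) n<N

  gates≤N : length (encUs gs) ≤ N
  gates≤N = prefix-bound (encUs gs) (<⇒≤ gates<N)

  0<N : 0 < N
  0<N = ≤-trans (s≤s z≤n) n<N

map-shift-0 : ∀ gs → map (shift 0) gs ≡ gs
map-shift-0 []             = refl
map-shift-0 (and i j ∷ gs) = cong (and i j ∷_) (map-shift-0 gs)
map-shift-0 (or i j ∷ gs)  = cong (or i j ∷_) (map-shift-0 gs)
map-shift-0 (neg i ∷ gs)   = cong (neg i ∷_) (map-shift-0 gs)

map-+-0 : ∀ (os : List ℕ) → map (0 +_) os ≡ os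
map-+-0 []       = refl
map-+-0 (x ∷ os) = cong (x ∷_) (map-+-0 os)

module _ {N n l gs os} (B : Bounds N n l gs os) where

  open Bounds B

  evalPair! : ∀ p q {e ρ} → lookup ρ nn ≡ ones n → lookup ρ gg ≡ encUs gs ++ [ false ] → lookup ρ uu ≡ encOuts os →
              length (lookup ρ p) ≡ 2 * n → length (lookup ρ q) ≡ 2 * n →
              Exec N (evalPair p q) (core [] [] [] [] [] [] [] [] e ρ) true
                (core [] [] [] [] [] [] [] [] (e ++ colourU gs os (lookup ρ p ++ lookup ρ q)) ρ)
  evalPair! p q {e} {ρ} n≡ g≡ u≡ p≡ q≡ =
    copy! (λ ()) (λ ()) (λ ()) refl (subst (_< N) (sym p≡) nodes<N) ∙
    (copy! (λ ()) (λ ()) (λ ()) refl (subst (_< N) (sym q≡) nodes<N) ∙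
    (resume (cong (λ s → core s w [] [] [] [] [] [] e ρ) g≡) (copy! (λ ()) (λ ()) (λ ()) refl (subst (λ u → length u < N) (sym g≡) gates<N)) ∙
    (resume (cong (λ hs → core [] W [] [] (encUs hs) [] [] [] e ρ) (map-shift-0 gs)) (gatesRun! gs {k = 0} gates≤N wires 0<N) ∙
    (clear! (≤-trans (s≤s (prefix-bound (encUs gs) ≤-refl)) gates<N) ∙
    (resume (cong (λ s → core s W [] [] [] [] [] [] e ρ) (trans u≡ (sym (++-identityʳ _)))) (copy! (λ ()) (λ ()) (λ ()) refl (subst (λ u → length u < N) (sym u≡) outs<N)) ∙
    (resume (cong (λ j → core (encOuts os ++ []) W [] [] [] [] [] j e ρ) (trans n≡ (cong ones (sym number))))
      (copy! (λ ()) (λ ()) (λ ()) refl (subst (_< N) (sym (trans (cong length n≡) (length-replicate n))) n<N)) ∙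
    (resume (cong (λ xs → core [] W [] [] (encOuts xs) [] [] [] (e ++ map (nth W) os) ρ) (map-+-0 os)) (outsRun! os {k = 0} (<⇒≤ outs<N) os<N W<N 0<N) ∙
    (clear! outs<N ∙ clear! W<N))))))))
    where
    w W : BitString
    w = lookup ρ p ++ lookup ρ q
    W = evUs gs w
    wires : length w + length gs < N
    wires = subst (λ k → k + length gs < N) (sym (trans (length-++ (lookup ρ p)) (cong₂ _+_ p≡ q≡))) wires<N
    W<N : length W < N
    W<N = subst (_< N) (sym (length-evUs gs w)) wires

  private
    nRounds : ∀ m {s x y ρ} → Rounds {K = 22} {N = N} (case {d = 1} rS stop stop (snoc (hi nn) true ； snoc (hi dd) true ； snoc (hi dd) true)) (suc m)
                (core (encℕ m ++ s) [] [] [] [] [] [] [] [] (x ∷ y ∷ ρ))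
                (core s [] [] [] [] [] [] [] [] ((x ++ ones m) ∷ (y ++ ones (2 * m)) ∷ ρ))
    nRounds zero {s} {x} {y} {ρ} = last (case-false refl
      (resume (cong₂ (λ x y → core s [] [] [] [] [] [] [] [] (x ∷ y ∷ ρ)) (sym (++-identityʳ x)) (sym (++-identityʳ y))) stop!))
    nRounds (suc m) {s} {x} {y} {ρ} = more (case-true refl (snoc! ∙ (snoc! ∙ snoc!)))
      (subst (Rounds _ _ _) (cong₂ (λ x y → core s [] [] [] [] [] [] [] [] (x ∷ y ∷ ρ)) (++-assoc x [ true ] (ones m))
        (trans (++-assoc (y ++ [ true ]) [ true ] _) (trans (++-assoc y [ true ] _) (cong (λ k → y ++ ones k) (sym (*-suc 2 m)))))) (nRounds m))

    lRounds : ∀ m {s x y z ρ} → Rounds {K = 22} {N = N} (case {d = 1} rS stop stop (snoc (hi ll) true)) (suc m)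
                (core (encℕ m ++ s) [] [] [] [] [] [] [] [] (x ∷ y ∷ z ∷ ρ))
                (core s [] [] [] [] [] [] [] [] (x ∷ y ∷ (z ++ ones m) ∷ ρ))
    lRounds zero {s} {x} {y} {z} {ρ} = last (case-false refl
      (resume (cong (λ z → core s [] [] [] [] [] [] [] [] (x ∷ y ∷ z ∷ ρ)) (sym (++-identityʳ z))) stop!))
    lRounds (suc m) {s} {x} {y} {z} {ρ} = more (case-true refl snoc!)
      (subst (Rounds _ _ _) (cong (λ z → core s [] [] [] [] [] [] [] [] (x ∷ y ∷ z ∷ ρ)) (++-assoc z [ true ] (ones m))) (lRounds m))

  parse! : ∀ {a b c s} {κ : Vec BitString 5} → length a ≡ 2 * n → length b ≡ 2 * n → length c ≡ 2 * n →
           Exec N parse (core (encℕ n ++ (encℕ l ++ (encUs gs ++ false ∷ (encOuts os ++ (a ++ (b ++ (c ++ s)))))))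
                              [] [] [] [] [] [] [] [] ([] ∷ [] ∷ [] ∷ [] ∷ [] ∷ [] ∷ [] ∷ [] ∷ κ)) true
             (core s [] [] [] [] [] [] [] [] (ones n ∷ ones (2 * n) ∷ ones l ∷ (encUs gs ++ [ false ]) ∷ encOuts os ∷ a ∷ b ∷ c ∷ κ))
  parse! {a} {b} {c} {s} {κ} a≡ b≡ c≡ =
    loop! (nRounds n) n<N ∙
    (loop! (lRounds l) width<N ∙
    (resume (cong (λ hs → core s₁ W [] [] (encUs hs) [] [] [] [] ρ₁) (map-shift-0 gs)) (gatesRun! gs {k = 0} gates≤N (≤-trans (s≤s (m≤n+m (length gs) (2 * n + 2 * n))) wires<N) 0<N) ∙
    (snoc! ∙
    (move! (λ ()) gates<N ∙
    (resume (cong (λ j → core s₁ W [] [] [] [] [] j [] ρ₂) (cong ones (sym number))) (copy! (λ ()) (λ ()) (λ ()) refl (subst (_< N) (sym (length-replicate n)) n<N)) ∙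
    (resume (cong (λ xs → core s₂ W [] [] (encOuts xs) [] [] [] (map (nth W) os) ρ₂) (map-+-0 os)) (outsRun! os {k = 0} (<⇒≤ outs<N) os<N W<N 0<N) ∙
    (move! (λ ()) outs<N ∙
    (clear! W<N ∙
    (clear! (subst (_< N) (sym (length-map (nth W) os)) os<N) ∙
    (take! aa a (cong ones (sym a≡)) (subst (_< N) (sym a≡) nodes<N) ∙
    (take! bb b (cong ones (sym b≡)) (subst (_< N) (sym b≡) nodes<N) ∙
    take! cc c (cong ones (sym c≡)) (subst (_< N) (sym c≡) nodes<N))))))))))))
    where
    W s₂ s₁ : BitString
    W  = evUs gs []
    s₂ = a ++ (b ++ (c ++ s))
    s₁ = encOuts os ++ s₂
    ρ₁ ρ₂ : Vec BitString 13
    ρ₁ = ones n ∷ ones (2 * n) ∷ ones l ∷ [] ∷ [] ∷ [] ∷ [] ∷ [] ∷ κ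
    ρ₂ = ones n ∷ ones (2 * n) ∷ ones l ∷ (encUs gs ++ [ false ]) ∷ [] ∷ [] ∷ [] ∷ [] ∷ κ
    W<N : length W < N
    W<N = subst (_< N) (sym (length-evUs gs [])) (≤-trans (s≤s (m≤n+m (length gs) (2 * n + 2 * n))) wires<N)

-- The program of the reduction

e₁ e₂ ss hb hc : Fin 13
e₁ = # 8
e₂ = # 9
ss = # 10
hb = # 11
hc = # 12

emitIndex : ∀ {d} → Fin 22 → P (suc d)
emitIndex r = copy r rO rT ； snoc rO false

emit : ∀ {d} → BitString → P d
emit []      = skip
emit (b ∷ u) = snoc rO b ； emit u

skipIndex : ∀ {d} → P (suc d)
skipIndex = loop (case rS stop stop skip)

found : ∀ {d} → Fin 13 → Fin 13 → P (suc d)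
found p q = loop (case rS stop stop (snoc (hi ss) true)) ； copy (hi p) (hi hb) rT ； copy (hi q) (hi hc) rT ； stop

-- At the first position where the colours of ab and ac differ, hb receives the endpoint whose colour
-- has a true bit there, hc the other one, and ss the index of the output wire.
findStep : ∀ {d} → P (suc d)
findStep = case (hi e₁) stop (case (hi e₂) stop skipIndex (found cc bb)) (case (hi e₂) stop (found bb cc) skipIndex)

find : P 2
find = copy (hi uu) rS rT ； loop findStep ； clear (hi e₁) ； clear (hi e₂) ； clear rS

-- The multiplexer "if s then q else p" for bits p, q known when the circuit is written down.
-- Circuits have no constants; wire d will carry the negation of wire 0, which makes `and 0 d` false
-- and `or 0 d` true.
selectGate : ℕ → ℕ → Bool → Bool → UGate
selectGate d s false false = and 0 d
selectGate d s false true  = or s s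
selectGate d s true false  = neg s
selectGate d s true true   = or 0 d

selectGates : ℕ → ℕ → BitString → BitString → List UGate
selectGates d s (p ∷ x) (q ∷ y) = selectGate d s p q ∷ selectGates d s x y
selectGates d s _       _       = []

-- `or i i` plays the identity gate.
copyGates : ℕ → ℕ → List UGate
copyGates i zero    = []
copyGates i (suc m) = or i i ∷ copyGates (suc i) m

-- The constants spell the marker of a further gate and its tag; in the first and the last case
-- their final `false` is already the operand 0.
emitSelect : ∀ {d} → Bool → Bool → P (suc d)
emitSelect false false = emit (true ∷ false ∷ false ∷ []) ； emitIndex (hi dd)
emitSelect false true  = emit (true ∷ true ∷ false ∷ []) ； emitIndex (hi ss) ； emitIndex (hi ss)
emitSelect true false  = emit (true ∷ true ∷ true ∷ false ∷ []) ； emitIndex (hi ss)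
emitSelect true true   = emit (true ∷ true ∷ false ∷ false ∷ []) ； emitIndex (hi dd)

selectStep : ∀ {d} → P (suc d)
selectStep = case (hi e₁) stop
  (case (hi e₂) stop (emitSelect false false) (emitSelect false true))
  (case (hi e₂) stop (emitSelect true false) (emitSelect true true))

copyStep : ∀ {d} → P (suc d)
copyStep = case rJ stop stop (emit (true ∷ true ∷ false ∷ []) ； emitIndex rY ； emitIndex rY ； snoc rY true)

block : P 2
block = loop selectStep ； copy (hi dd) rJ rT ； loop copyStep ； clear rY ； copy (hi gg) rS rT ； gatesRun ； clear rW

emitOuts : P 2
emitOuts = copy (hi uu) rS rT ； copy (hi nn) rJ rT ； outsRun ； clear rE

-- The width d + 1 + l + l counts the inputs, the negation of wire 0, and two blocks. A block has d
-- selecting gates, d copying gates and those of C, which is again l, as C has d + d inputs.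
header : P 2
header = emitIndex (hi dd) ； copy (hi dd) rO rT ； snoc rO true ； copy (hi ll) rO rT ； copy (hi ll) rO rT ； snoc rO false
       ； emit (true ∷ encU (neg 0))

search : P 2
search = evalPair aa bb ； move rE (hi e₁) ； evalPair aa cc ； move rE (hi e₂) ； find

body : P 2
body = copy (hi dd) rF rT ； snoc rF true
     -- Selecting between a and a emits constant gates only, so the still unshifted number in `ss`
     -- does not appear in the output.
     ； copy (hi aa) (hi e₁) rT ； copy (hi aa) (hi e₂) rT ； block
     -- Appending adds: the selector becomes wire suc d + i, an output of the first copy of C, and
     -- the offset becomes suc d + l, the beginning of the second block.
     ； copy rF (hi ss) rT ； copy (hi ll) rF rT
     ； copy (hi hb) (hi e₁) rT ； copy (hi hc) (hi e₂) rT ； block ； snoc rO false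

footer : P 2
footer = clear rF ； copy (hi dd) rF rT ； snoc rF true ； emitOuts ； copy (hi ll) rF rT ； emitOuts
       ； copy (hi dd) rJ rT ； loop (case rJ stop stop (snoc rO false))

reduction : P 2
reduction = parse ； search ； header ； body ； footer

joinʳ : BitString → List BitString → BitString
joinʳ u []       = u
joinʳ u (v ∷ vs) = u ++ joinʳ v vs

joinˡ : BitString → List BitString → BitString
joinˡ o []       = o
joinˡ o (u ∷ us) = joinˡ (o ++ u) us

join-assoc : ∀ o u us → joinˡ o (u ∷ us) ≡ o ++ joinʳ u us
join-assoc o u []       = refl
join-assoc o u (v ∷ us) = trans (join-assoc (o ++ u) v us) (++-assoc o u _)

module _ {N : ℕ} where

  emit! : ∀ {d} u {s w v y o f t j e ρ} → Exec N (emit {d} u) (core s w v y o f t j e ρ) true (core s w v y (o ++ u) f t j e ρ)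
  emit! [] {s} {w} {v} {y} {o} {f} {t} {j} {e} {ρ} = resume (cong (λ o → core s w v y o f t j e ρ) (sym (++-identityʳ o))) skip!
  emit! (b ∷ u) {s} {w} {v} {y} {o} {f} {t} {j} {e} {ρ} =
    snoc! ∙ resume (cong (λ o → core s w v y o f t j e ρ) (++-assoc o [ b ] u)) (emit! u)

  emitIndex! : ∀ {d} r k {s w v y o f j e ρ} → r ≢ rO → r ≢ rT → lookup (core s w v y o f [] j e ρ) r ≡ ones k → k < N →
           Exec N (emitIndex {d} r) (core s w v y o f [] j e ρ) true (core s w v y (o ++ encℕ k) f [] j e ρ)
  emitIndex! r k {s} {w} {v} {y} {o} {f} {j} {e} {ρ} r≢O r≢T l k<N =
    resume (cong (λ u → core s w v y (o ++ u) f [] j e ρ) l)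
      (copy! r≢O r≢T (λ ()) refl (subst (_< N) (sym (trans (cong length l) (length-replicate k))) k<N))
    ∙ resume (cong (λ o → core s w v y o f [] j e ρ) (++-assoc o (ones k) [ false ])) snoc!

pick : Bool → BitString → BitString → BitString
pick t u v = if t then u else v

nthℕ : List ℕ → ℕ → ℕ
nthℕ []       _       = 0
nthℕ (x ∷ xs) zero    = x
nthℕ (x ∷ xs) (suc i) = nthℕ xs i

nthℕ-All : ∀ {p} {Q : ℕ → Set p} {xs} → All Q xs → ∀ {j} → j < length xs → Q (nthℕ xs j)
nthℕ-All (q ∷ qs) {zero} _        = q
nthℕ-All (q ∷ qs) {suc j} (s≤s h) = nthℕ-All qs h

blockGates : List UGate → (d k s : ℕ) → BitString → BitString → List UGate
blockGates gs d k s x y = selectGates d s x y ++ (copyGates 0 d ++ map (shift k) gs)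

-- p and q are the endpoints b and c, p being the one whose edge to a has a true bit at the chosen
-- position, and i is the output wire of that position.
reductionOutput : (d l : ℕ) → List UGate → List ℕ → BitString → ℕ → BitString → BitString → BitString
reductionOutput d l gs os a i p q = (encℕ d ++ (encℕ (d + suc (l + (l + 0))) ++ (true ∷ encU (neg 0))))
  ++ ((encUs (blockGates gs d (suc d) i a a) ++ (encUs (blockGates gs d (suc d + l) (suc d + i) p q) ++ [ false ]))
  ++ (encOuts (map (suc d +_) os) ++ (encOuts (map ((suc d + l) +_) os) ++ replicate d false)))

record Reduced (N n l : ℕ) (gs : List UGate) (os : List ℕ) (a b c : BitString) : Set where
  field
    position  : ℕ
    position< : position < length os
    differs   : nth (colourU gs os (a ++ b)) position ≡ not (nth (colourU gs os (a ++ c)) position)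
    {final}   : State 22
    {flag}    : Bool
    executed  : Exec N reduction ((encℕ n ++ (encℕ l ++ (encUs gs ++ false ∷ (encOuts os ++ (a ++ (b ++ (c ++ [])))))))
                                  ∷ Vec.replicate 21 []) flag final
    emitted   : lookup final rO ≡ reductionOutput (2 * n) l gs os a (nthℕ os position)
                  (pick (nth (colourU gs os (a ++ b)) position) b c) (pick (nth (colourU gs os (a ++ b)) position) c b)

module Reduction {N n l gs os} (B : Bounds N n l gs os) (a b c : BitString)
                 (a≡ : length a ≡ 2 * n) (b≡ : length b ≡ 2 * n) (c≡ : length c ≡ 2 * n) where

  open Bounds B

  private
    d : ℕ
    d = 2 * n

  regs₁₃ : BitString → BitString → BitString → BitString → BitString → Vec BitString 13
  regs₁₃ x y s p q = ones n ∷ ones d ∷ ones l ∷ (encUs gs ++ [ false ]) ∷ encOuts os ∷ a ∷ b ∷ c ∷ x ∷ y ∷ s ∷ p ∷ q ∷ []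

  private
    skipping : ∀ i {s ρ} → Rounds {K = 22} {N = N} (case {d = 0} rS stop stop skip) (suc i)
                 (core (encℕ i ++ s) [] [] [] [] [] [] [] [] ρ) (core s [] [] [] [] [] [] [] [] ρ)
    skipping zero    = last (case-false refl stop!)
    skipping (suc i) = more (case-true refl skip!) (skipping i)

    noting : ∀ i {s x y z p q} → Rounds {K = 22} {N = N} (case {d = 0} rS stop stop (snoc (hi ss) true)) (suc i)
               (core (encℕ i ++ s) [] [] [] [] [] [] [] [] (regs₁₃ x y z p q)) (core s [] [] [] [] [] [] [] [] (regs₁₃ x y (z ++ ones i) p q))
    noting zero {s} {x} {y} {z} {p} {q} = last (case-false refl (resume (cong (λ z → core s [] [] [] [] [] [] [] [] (regs₁₃ x y z p q)) (sym (++-identityʳ z))) stop!))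
    noting (suc i) {s} {x} {y} {z} {p} {q} = more (case-true refl snoc!)
      (subst (Rounds _ _ _) (cong (λ z → core s [] [] [] [] [] [] [] [] (regs₁₃ x y z p q)) (++-assoc z [ true ] (ones i))) (noting i))

  -- The remainders `s`, `x′` and `y′` are described by their lengths alone, which is what clearing
  -- them asks for.
  record Found (x y : BitString) (os′ : List ℕ) : Set where
    field
      j       : ℕ
      j<os    : j < length os′
      differ  : nth x j ≡ not (nth y j)
      s x′ y′ : BitString
      s≤      : length s ≤ length (encOuts os′)
      x′≤     : length x′ ≤ length x
      y′≤     : length y′ ≤ length y
      rounds  : Rounds {N = N} (findStep {0}) (suc j) (core (encOuts os′) [] [] [] [] [] [] [] [] (regs₁₃ x y [] [] []))
                  (core s [] [] [] [] [] [] [] [] (regs₁₃ x′ y′ (ones (nthℕ os′ j)) (pick (nth x j) b c) (pick (nth x j) c b)))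

  private
    b<N : length b < N
    b<N = subst (_< N) (sym b≡) nodes<N

    c<N : length c < N
    c<N = subst (_< N) (sym c≡) nodes<N

    finding : ∀ x y os′ → length x ≡ length os′ → length y ≡ length os′ → x ≢ y → length (encOuts os′) ≤ N → Found x y os′
    finding [] [] [] _ _ x≢y _ = contradiction refl x≢y
    finding (false ∷ x) (true ∷ y) (i ∷ os′) p q x≢y h = record
      { j = 0 ; j<os = s≤s z≤n ; differ = refl ; s = encOuts os′ ; x′ = x ; y′ = y
      ; s≤ = ≤-trans (m≤n+m _ (length (encℕ i))) (≤-reflexive (sym (length-++ (encℕ i)))) ; x′≤ = n≤1+n _ ; y′≤ = n≤1+n _
      ; rounds = last (case-false refl (case-true refl (loop! (noting i) (index-bound h) ∙
          (copy! (λ ()) (λ ()) (λ ()) refl c<N ∙ (copy! (λ ()) (λ ()) (λ ()) refl b<N ∙ stop!))))) }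
    finding (true ∷ x) (false ∷ y) (i ∷ os′) p q x≢y h = record
      { j = 0 ; j<os = s≤s z≤n ; differ = refl ; s = encOuts os′ ; x′ = x ; y′ = y
      ; s≤ = ≤-trans (m≤n+m _ (length (encℕ i))) (≤-reflexive (sym (length-++ (encℕ i)))) ; x′≤ = n≤1+n _ ; y′≤ = n≤1+n _
      ; rounds = last (case-true refl (case-false refl (loop! (noting i) (index-bound h) ∙
          (copy! (λ ()) (λ ()) (λ ()) refl b<N ∙ (copy! (λ ()) (λ ()) (λ ()) refl c<N ∙ stop!))))) }
    finding (false ∷ x) (false ∷ y) (i ∷ os′) p q x≢y h = record
      { j = suc (Found.j F) ; j<os = s≤s (Found.j<os F) ; differ = Found.differ F ; s = Found.s F ; x′ = Found.x′ F ; y′ = Found.y′ F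
      ; s≤ = ≤-trans (Found.s≤ F) (≤-trans (m≤n+m _ (length (encℕ i))) (≤-reflexive (sym (length-++ (encℕ i)))))
      ; x′≤ = ≤-trans (Found.x′≤ F) (n≤1+n _) ; y′≤ = ≤-trans (Found.y′≤ F) (n≤1+n _)
      ; rounds = more (case-false refl (case-false refl (loop! (skipping i) (index-bound h)))) (Found.rounds F) }
      where
      F : Found x y os′
      F = finding x y os′ (suc-injective p) (suc-injective q) (x≢y ∘ cong (false ∷_)) (suffix-bound (encℕ i) h)
    finding (true ∷ x) (true ∷ y) (i ∷ os′) p q x≢y h = record
      { j = suc (Found.j F) ; j<os = s≤s (Found.j<os F) ; differ = Found.differ F ; s = Found.s F ; x′ = Found.x′ F ; y′ = Found.y′ F
      ; s≤ = ≤-trans (Found.s≤ F) (≤-trans (m≤n+m _ (length (encℕ i))) (≤-reflexive (sym (length-++ (encℕ i)))))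
      ; x′≤ = ≤-trans (Found.x′≤ F) (n≤1+n _) ; y′≤ = ≤-trans (Found.y′≤ F) (n≤1+n _)
      ; rounds = more (case-true refl (case-true refl (loop! (skipping i) (index-bound h)))) (Found.rounds F) }
      where
      F : Found x y os′
      F = finding x y os′ (suc-injective p) (suc-injective q) (x≢y ∘ cong (true ∷_)) (suffix-bound (encℕ i) h)

  colours : BitString → BitString → BitString
  colours p q = colourU gs os (p ++ q)

  private
    colours-length : ∀ p q → length (colours p q) ≡ length os
    colours-length p q = length-map _ os

    colours<N : ∀ p q → length (colours p q) < N
    colours<N p q = subst (_< N) (sym (colours-length p q)) os<N

  search! : colours a b ≢ colours a c → Σ[ j ∈ ℕ ] j < length os × nth (colours a b) j ≡ not (nth (colours a c) j) ×
            Exec N search (core [] [] [] [] [] [] [] [] [] (regs₁₃ [] [] [] [] [])) true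
              (core [] [] [] [] [] [] [] [] [] (regs₁₃ [] [] (ones (nthℕ os j))
                (pick (nth (colours a b) j) b c) (pick (nth (colours a b) j) c b)))
  search! h = Found.j F , Found.j<os F , Found.differ F ,
    (evalPair! B aa bb refl refl refl a≡ b≡ ∙ (move! (λ ()) (colours<N a b) ∙
    (evalPair! B aa cc refl refl refl a≡ c≡ ∙ (move! (λ ()) (colours<N a c) ∙
    (copy! (λ ()) (λ ()) (λ ()) refl outs<N ∙ (loop! (Found.rounds F) (≤-trans (s≤s (<⇒≤ (Found.j<os F))) os<N) ∙
    (clear! (≤-trans (s≤s (Found.x′≤ F)) (colours<N a b)) ∙ (clear! (≤-trans (s≤s (Found.y′≤ F)) (colours<N a c)) ∙
    clear! (≤-trans (s≤s (Found.s≤ F)) outs<N)))))))))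
    where
    F : Found (colours a b) (colours a c) os
    F = finding (colours a b) (colours a c) os (colours-length a b) (colours-length a c) h (<⇒≤ outs<N)

  -- The inner summand 0 lets `encℕ-+` split off both blocks `ones l` in the same way.
  width : ℕ
  width = d + suc (l + (l + 0))

  private
    zero-core : BitString → BitString → Vec BitString 13 → State 22
    zero-core o f ρ = core [] [] [] [] o f [] [] [] ρ

    selectStep! : ∀ p q {x y s u v o f} → s < N →
                  Exec N (selectStep {0}) (zero-core o f (regs₁₃ (p ∷ x) (q ∷ y) (ones s) u v)) true
                    (zero-core (o ++ (true ∷ encU (selectGate d s p q))) f (regs₁₃ x y (ones s) u v))
    selectStep! false false {x} {y} {s} {u} {v} {o} {f} _ = case-false refl (case-false refl
      (emit! (true ∷ false ∷ false ∷ []) ∙ resume (cong (λ o → zero-core o f (regs₁₃ x y (ones s) u v)) (++-assoc o _ _))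
        (emitIndex! (hi dd) d (λ ()) (λ ()) refl nodes<N)))
    selectStep! false true {x} {y} {s} {u} {v} {o} {f} s<N = case-false refl (case-true refl
      (emit! (true ∷ true ∷ false ∷ []) ∙ (emitIndex! (hi ss) s (λ ()) (λ ()) refl s<N ∙
        resume (cong (λ o → zero-core o f (regs₁₃ x y (ones s) u v)) (join-assoc o (true ∷ true ∷ false ∷ []) (encℕ s ∷ encℕ s ∷ [])))
        (emitIndex! (hi ss) s (λ ()) (λ ()) refl s<N))))
    selectStep! true false {x} {y} {s} {u} {v} {o} {f} s<N = case-true refl (case-false refl
      (emit! (true ∷ true ∷ true ∷ false ∷ []) ∙ resume (cong (λ o → zero-core o f (regs₁₃ x y (ones s) u v)) (++-assoc o _ _))
        (emitIndex! (hi ss) s (λ ()) (λ ()) refl s<N)))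
    selectStep! true true {x} {y} {s} {u} {v} {o} {f} _ = case-true refl (case-true refl
      (emit! (true ∷ true ∷ false ∷ false ∷ []) ∙ resume (cong (λ o → zero-core o f (regs₁₃ x y (ones s) u v)) (++-assoc o _ _))
        (emitIndex! (hi dd) d (λ ()) (λ ()) refl nodes<N)))

    selecting : ∀ x y {s u v o f} → s < N → length x ≡ length y → Rounds {N = N} (selectStep {0}) (suc (length x))
                  (zero-core o f (regs₁₃ x y (ones s) u v)) (zero-core (o ++ encUs (selectGates d s x y)) f (regs₁₃ [] [] (ones s) u v))
    selecting [] [] {s} {u} {v} {o} {f} _ _ = last (case-empty refl
      (resume (cong (λ o → zero-core o f (regs₁₃ [] [] (ones s) u v)) (sym (++-identityʳ o))) stop!))
    selecting (p ∷ x) (q ∷ y) {s} {u} {v} {o} {f} s<N e = more (selectStep! p q s<N)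
      (subst (λ o′ → Rounds (selectStep {0}) (suc (length x)) (zero-core (o ++ (true ∷ encU (selectGate d s p q))) f (regs₁₃ x y (ones s) u v))
               (zero-core o′ f (regs₁₃ [] [] (ones s) u v)))
        (++-assoc o (true ∷ encU (selectGate d s p q)) _) (selecting x y s<N (suc-injective e)))

    ones-snoc : ∀ i → ones i ++ [ true ] ≡ ones (suc i)
    ones-snoc zero    = refl
    ones-snoc (suc i) = cong (true ∷_) (ones-snoc i)

    copying : ∀ m i {o f ρ} → i + m < N → Rounds {N = N} (copyStep {0}) (suc m) (core [] [] [] (ones i) o f [] (ones m) [] ρ)
                (core [] [] [] (ones (i + m)) (o ++ encUs (copyGates i m)) f [] [] [] ρ)
    copying zero i {o} {f} {ρ} _ = last (case-empty refl (resume (cong₂ (λ y o → core [] [] [] y o f [] [] [] ρ)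
      (cong ones (sym (+-identityʳ i))) (sym (++-identityʳ o))) stop!))
    copying (suc m) i {o} {f} {ρ} h =
      more (case-true refl (emit! (true ∷ true ∷ false ∷ []) ∙ (emitIndex! rY i (λ ()) (λ ()) refl i<N ∙
        (resume (cong (λ o → core [] [] [] (ones i) o f [] (ones m) [] ρ) (join-assoc o (true ∷ true ∷ false ∷ []) (encℕ i ∷ encℕ i ∷ [])))
          (emitIndex! rY i (λ ()) (λ ()) refl i<N) ∙
        resume (cong (λ y → core [] [] [] y (o ++ (true ∷ encU (or i i))) f [] (ones m) [] ρ) (ones-snoc i)) snoc!))))
      (subst₂ (λ k o′ → Rounds {N = N} (copyStep {0}) (suc m) (core [] [] [] (ones (suc i)) (o ++ (true ∷ encU (or i i))) f [] (ones m) [] ρ)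
                (core [] [] [] (ones k) o′ f [] [] [] ρ))
        (sym (+-suc i m)) (++-assoc o (true ∷ encU (or i i)) _) (copying m (suc i) (subst (_< N) (+-suc i m) h)))
      where
      i<N : i < N
      i<N = ≤-trans (s≤s (m≤m+n i (suc m))) h

    ones<N : ∀ {k} → k < N → length (ones k) < N
    ones<N {k} = subst (_< N) (sym (length-replicate k))

    block! : ∀ x y k {s u v o} → s < N → k < N → length x ≡ d → length y ≡ d →
             Exec N block (zero-core o (ones k) (regs₁₃ x y (ones s) u v)) true
               (zero-core (o ++ encUs (blockGates gs d k s x y)) (ones k) (regs₁₃ [] [] (ones s) u v))
    block! x y k {s} {u} {v} {o} s<N k<N x≡ y≡ =
      loop! (selecting x y s<N (trans x≡ (sym y≡))) (subst (_< N) (sym x≡) nodes<N) ∙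
      (copy! (λ ()) (λ ()) (λ ()) refl (ones<N nodes<N) ∙
      (loop! (copying d 0 nodes<N) nodes<N ∙
      (clear! (ones<N nodes<N) ∙
      (copy! (λ ()) (λ ()) (λ ()) refl gates<N ∙
      (gatesRun! gs gates≤N gs<N k<N ∙
      resume (cong (λ o → zero-core o (ones k) (regs₁₃ [] [] (ones s) u v))
        (trans (join-assoc o _ (_ ∷ _ ∷ []))
          (cong (o ++_) (sym (trans (concatMap-++ _ (selectGates d s x y) _) (cong (encUs (selectGates d s x y) ++_) (concatMap-++ _ (copyGates 0 d) _)))))))
      (clear! (subst (_< N) (sym (length-evUs gs [])) gs<N)))))))
      where
      gs<N : length gs < N
      gs<N = ≤-trans (s≤s (m≤n+m (length gs) (2 * n + 2 * n))) wires<N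

    emitOuts! : ∀ k {o ρ} → lookup ρ uu ≡ encOuts os → lookup ρ nn ≡ ones n → k < N →
                Exec N emitOuts (zero-core o (ones k) ρ) true (zero-core (o ++ encOuts (map (k +_) os)) (ones k) ρ)
    emitOuts! k {o} {ρ} u≡ n≡ k<N =
      resume (cong (λ s → core s [] [] [] o (ones k) [] [] [] ρ) (trans u≡ (sym (++-identityʳ _))))
        (copy! (λ ()) (λ ()) (λ ()) refl (subst (λ u → length u < N) (sym u≡) outs<N)) ∙
      (resume (cong (λ j → core (encOuts os ++ []) [] [] [] o (ones k) [] j [] ρ) (trans n≡ (cong ones (sym number))))
        (copy! (λ ()) (λ ()) (λ ()) refl (subst (λ u → length u < N) (sym n≡) (ones<N n<N))) ∙
      (outsRun! os (<⇒≤ outs<N) os<N 0<N k<N ∙ clear! (subst (_< N) (sym (length-map _ os)) os<N)))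

    header! : ∀ {ρ} → lookup ρ dd ≡ ones d → lookup ρ ll ≡ ones l → Exec N header (zero-core [] [] ρ) true
                (zero-core (encℕ d ++ (encℕ width ++ (true ∷ encU (neg 0)))) [] ρ)
    header! {ρ} d≡ l≡ =
      emitIndex! (hi dd) d (λ ()) (λ ()) d≡ nodes<N ∙
      (resume (cong (λ u → zero-core (encℕ d ++ u) [] ρ) d≡) (copy! (λ ()) (λ ()) (λ ()) refl d<) ∙ (snoc! ∙
      (resume (cong (λ u → zero-core (((encℕ d ++ ones d) ++ [ true ]) ++ u) [] ρ) l≡) (copy! (λ ()) (λ ()) (λ ()) refl l<) ∙
      (resume (cong (λ u → zero-core ((((encℕ d ++ ones d) ++ [ true ]) ++ ones l) ++ u) [] ρ) l≡) (copy! (λ ()) (λ ()) (λ ()) refl l<) ∙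
      (snoc! ∙ resume (cong (λ o → zero-core o [] ρ) shape) (emit! (true ∷ encU (neg 0))))))))
      where
      d< : length (lookup ρ dd) < N
      d< = subst (λ u → length u < N) (sym d≡) (ones<N nodes<N)
      l< : length (lookup ρ ll) < N
      l< = subst (λ u → length u < N) (sym l≡) (ones<N width<N)
      width≡ : encℕ width ≡ ones d ++ ([ true ] ++ (ones l ++ (ones l ++ [ false ])))
      width≡ = trans (encℕ-+ d _) (cong (λ u → ones d ++ (true ∷ u)) (trans (encℕ-+ l _) (cong (ones l ++_) (encℕ-+ l 0))))
      shape : ((((((encℕ d ++ ones d) ++ [ true ]) ++ ones l) ++ ones l) ++ [ false ]) ++ (true ∷ encU (neg 0)))
              ≡ encℕ d ++ (encℕ width ++ (true ∷ encU (neg 0)))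
      shape = trans (cong (_++ (true ∷ encU (neg 0))) (trans (join-assoc (encℕ d) (ones d) ([ true ] ∷ ones l ∷ ones l ∷ [ false ] ∷ []))
                (cong (encℕ d ++_) (sym width≡)))) (++-assoc (encℕ d) (encℕ width) _)

    module _ (i : ℕ) (i<l : i < l) (o₂<N : suc d + l < N) where

      o₁<N : suc d < N
      o₁<N = ≤-trans (s≤s (m≤m+n (suc d) l)) o₂<N

      s : ℕ
      s = suc d + i

      s<N : s < N
      s<N = ≤-trans (s≤s (+-monoʳ-≤ (suc d) (<⇒≤ i<l))) o₂<N

      body! : ∀ {p q o} → length p ≡ d → length q ≡ d →
              Exec N body (zero-core o [] (regs₁₃ [] [] (ones i) p q)) true
                (zero-core (o ++ (encUs (blockGates gs d (suc d) i a a) ++ (encUs (blockGates gs d (suc d + l) s p q) ++ [ false ])))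
                  (ones (suc d + l)) (regs₁₃ [] [] (ones s) p q))
      body! {p} {q} {o} p≡ q≡ =
        copy! (λ ()) (λ ()) (λ ()) refl (ones<N nodes<N) ∙
        (resume (cong (λ f → zero-core o f (regs₁₃ [] [] (ones i) p q)) (ones-snoc d)) snoc! ∙
        (copy! (λ ()) (λ ()) (λ ()) refl (subst (_< N) (sym a≡) nodes<N) ∙
        (copy! (λ ()) (λ ()) (λ ()) refl (subst (_< N) (sym a≡) nodes<N) ∙
        (block! a a (suc d) (≤-trans i<l (<⇒≤ width<N)) o₁<N a≡ a≡ ∙
        (resume (cong (λ z → zero-core (o ++ encUs (blockGates gs d (suc d) i a a)) (ones (suc d)) (regs₁₃ [] [] z p q)) s≡)
          (copy! (λ ()) (λ ()) (λ ()) refl (ones<N o₁<N)) ∙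
        (resume (cong (λ f → zero-core (o ++ encUs (blockGates gs d (suc d) i a a)) f (regs₁₃ [] [] (ones s) p q)) (sym (replicate-+ (suc d) l true)))
          (copy! (λ ()) (λ ()) (λ ()) refl (ones<N width<N)) ∙
        (copy! (λ ()) (λ ()) (λ ()) refl (subst (_< N) (sym p≡) nodes<N) ∙
        (copy! (λ ()) (λ ()) (λ ()) refl (subst (_< N) (sym q≡) nodes<N) ∙
        (block! p q (suc d + l) s<N o₂<N p≡ q≡ ∙
        resume (cong (λ o → zero-core o (ones (suc d + l)) (regs₁₃ [] [] (ones s) p q)) (join-assoc o _ (_ ∷ _ ∷ []))) snoc!)))))))))
        where
        s≡ : ones i ++ ones (suc d) ≡ ones s
        s≡ = trans (sym (replicate-+ i (suc d) true)) (cong ones (+-comm i (suc d)))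

      zeroing : ∀ m {o f ρ} → Rounds {K = 22} {N = N} (case {d = 1} rJ stop stop (snoc rO false)) (suc m)
                  (core [] [] [] [] o f [] (ones m) [] ρ) (zero-core (o ++ replicate m false) f ρ)
      zeroing zero {o} {f} {ρ}    = last (case-empty refl (resume (cong (λ o → zero-core o f ρ) (sym (++-identityʳ o))) stop!))
      zeroing (suc m) {o} {f} {ρ} = more (case-true refl snoc!)
        (subst (λ o′ → Rounds (case {d = 1} rJ stop stop (snoc rO false)) (suc m) (core [] [] [] [] (o ++ [ false ]) f [] (ones m) [] ρ) (zero-core o′ f ρ))
          (++-assoc o [ false ] _) (zeroing m))

      footer! : ∀ {z p q o} → Exec N footer (zero-core o (ones (suc d + l)) (regs₁₃ [] [] z p q)) true
                  (zero-core (o ++ (encOuts (map (suc d +_) os) ++ (encOuts (map ((suc d + l) +_) os) ++ replicate d false)))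
                    (ones (suc d + l)) (regs₁₃ [] [] z p q))
      footer! {z} {p} {q} {o} =
        clear! (ones<N o₂<N) ∙
        (copy! (λ ()) (λ ()) (λ ()) refl (ones<N nodes<N) ∙
        (resume (cong (λ f → zero-core o f (regs₁₃ [] [] z p q)) (ones-snoc d)) snoc! ∙
        (emitOuts! (suc d) refl refl o₁<N ∙
        (resume (cong (λ f → zero-core (o ++ encOuts (map (suc d +_) os)) f (regs₁₃ [] [] z p q)) (sym (replicate-+ (suc d) l true)))
          (copy! (λ ()) (λ ()) (λ ()) refl (ones<N width<N)) ∙
        (emitOuts! (suc d + l) refl refl o₂<N ∙
        (copy! (λ ()) (λ ()) (λ ()) refl (ones<N nodes<N) ∙
        resume (cong (λ o → zero-core o (ones (suc d + l)) (regs₁₃ [] [] z p q)) (join-assoc o _ (_ ∷ _ ∷ [])))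
          (loop! (zeroing d) nodes<N)))))))

  reduction! : All (_< l) os → suc d + l < N → colours a b ≢ colours a c → Reduced N n l gs os a b c
  reduction! valid o₂<N h with search! h
  ... | j , j<os , differ , found = record
    { position = j ; position< = j<os ; differs = differ
    ; executed = parse! B a≡ b≡ c≡ ∙ (found ∙ (header! refl refl ∙ (body! i i<l o₂<N (picked t b≡ c≡) (picked t c≡ b≡) ∙ footer! i i<l o₂<N)))
    ; emitted  = ++-assoc (encℕ d ++ (encℕ width ++ (true ∷ encU (neg 0)))) _ _ }
    where
    t : Bool
    t = nth (colours a b) j
    i : ℕ
    i = nthℕ os j
    i<l : i < l
    i<l = nthℕ-All valid j<os
    picked : ∀ t {u v} → length u ≡ d → length v ≡ d → length (pick t u v) ≡ d
    picked true  p q = p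
    picked false p q = q

-- The Pigeon circuit

eraseGate : ∀ {w} → Gate w → UGate
eraseGate (AND i j) = and (toℕ i) (toℕ j)
eraseGate (OR i j)  = or (toℕ i) (toℕ j)
eraseGate (NOT i)   = neg (toℕ i)

erase : ∀ {w v} → Gates w v → List UGate
erase done     = []
erase (g ∷ gs) = eraseGate g ∷ erase gs

wiresOf : ∀ {v m} → Vec (Fin v) m → List ℕ
wiresOf out = map toℕ (toList out)

nth-lookup : ∀ {w} (x : Vec Bool w) i → nth (toList x) (toℕ i) ≡ lookup x i
nth-lookup (b ∷ x) zero    = refl
nth-lookup (b ∷ x) (suc i) = nth-lookup x i

evU-erase : ∀ {w} (g : Gate w) x → evU (eraseGate g) (toList x) ≡ evalGate g x
evU-erase (AND i j) x = cong₂ _∧_ (nth-lookup x i) (nth-lookup x j)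
evU-erase (OR i j) x  = cong₂ _∨_ (nth-lookup x i) (nth-lookup x j)
evU-erase (NOT i) x   = cong not (nth-lookup x i)

evUs-erase : ∀ {w v} (gs : Gates w v) x → evUs (erase gs) (toList x) ≡ toList (evalGates gs x)
evUs-erase done x     = refl
evUs-erase (g ∷ gs) x = trans
  (cong (evUs (erase gs)) (trans (cong (λ b → toList x ++ [ b ]) (evU-erase g x)) (sym (Vecₚ.toList-∷ʳ (evalGate g x) x))))
  (evUs-erase gs (x ∷ʳ evalGate g x))

eval-erase : ∀ {n m v} (gs : Gates n v) (out : Vec (Fin v) m) x →
             toList (eval (circuit v gs out) x) ≡ colourU (erase gs) (wiresOf out) (toList x)
eval-erase gs out x = trans (Vecₚ.toList-map (lookup (evalGates gs x)) out)
  (trans (map-cong (λ i → sym (trans (cong (λ w → nth w (toℕ i)) (evUs-erase gs x)) (nth-lookup (evalGates gs x) i))) (toList out))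
    (map-∘ (toList out)))

encGate-erase : ∀ {w} (g : Gate w) → encGate g ≡ encU (eraseGate g)
encGate-erase (AND i j) = refl
encGate-erase (OR i j)  = refl
encGate-erase (NOT i)   = refl

encGates-erase : ∀ {w v} (gs : Gates w v) → encGates gs ≡ encUs (erase gs) ++ [ false ]
encGates-erase done     = refl
encGates-erase (g ∷ gs) = cong (true ∷_) (trans (cong₂ _++_ (encGate-erase g) (encGates-erase gs))
  (sym (++-assoc (encU (eraseGate g)) _ _)))

encOuts-erase : ∀ {v} (out : List (Fin v)) → concatMap (λ i → encℕ (toℕ i)) out ≡ encOuts (map toℕ out)
encOuts-erase []        = refl
encOuts-erase (i ∷ out) = cong (encℕ (toℕ i) ++_) (encOuts-erase out)

Reads : ℕ → UGate → Set
Reads w (and i j) = i < w × j < w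
Reads w (or i j)  = i < w × j < w
Reads w (neg i)   = i < w

WellFormed : ℕ → List UGate → Set
WellFormed w []       = ⊤
WellFormed w (g ∷ gs) = Reads w g × WellFormed (suc w) gs

erase-reads : ∀ {w} (g : Gate w) → Reads w (eraseGate g)
erase-reads (AND i j) = Finₚ.toℕ<n i , Finₚ.toℕ<n j
erase-reads (OR i j)  = Finₚ.toℕ<n i , Finₚ.toℕ<n j
erase-reads (NOT i)   = Finₚ.toℕ<n i

erase-wellFormed : ∀ {w v} (gs : Gates w v) → WellFormed w (erase gs)
erase-wellFormed done     = tt
erase-wellFormed (g ∷ gs) = erase-reads g , erase-wellFormed gs

erase-width : ∀ {w v} (gs : Gates w v) → v ≡ w + length (erase gs)
erase-width done     = sym (+-identityʳ _)
erase-width (g ∷ gs) = trans (erase-width gs) (sym (+-suc _ _))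

wiresOf-valid : ∀ {v m} (out : Vec (Fin v) m) → All (_< v) (wiresOf out)
wiresOf-valid []        = []
wiresOf-valid (i ∷ out) = Finₚ.toℕ<n i ∷ wiresOf-valid out

wiresOf-length : ∀ {v m} (out : Vec (Fin v) m) → length (wiresOf out) ≡ m
wiresOf-length out = trans (length-map toℕ (toList out)) (Vecₚ.length-toList out)

typedGate : ∀ {w} g → Reads w g → Σ[ h ∈ Gate w ] eraseGate h ≡ g
typedGate (and i j) (p , q) = AND (fromℕ< p) (fromℕ< q) , cong₂ and (Finₚ.toℕ-fromℕ< p) (Finₚ.toℕ-fromℕ< q)
typedGate (or i j) (p , q)  = OR (fromℕ< p) (fromℕ< q) , cong₂ or (Finₚ.toℕ-fromℕ< p) (Finₚ.toℕ-fromℕ< q)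
typedGate (neg i) p         = NOT (fromℕ< p) , cong neg (Finₚ.toℕ-fromℕ< p)

-- The emitted circuit is built as an untyped list, while a Pigeon instance must contain a typed
-- one; this is the way back.
typed : ∀ {w v} gs → WellFormed w gs → v ≡ w + length gs → Σ[ hs ∈ Gates w v ] erase hs ≡ gs
typed [] _ e with trans e (+-identityʳ _)
... | refl = done , refl
typed (g ∷ gs) (p , ps) e with typedGate g p | typed gs ps (trans e (+-suc _ _))
... | h , refl | hs , refl = h ∷ hs , refl

typedOuts : ∀ {v m} os → All (_< v) os → length os ≡ m → Σ[ out ∈ Vec (Fin v) m ] wiresOf out ≡ os
typedOuts [] [] refl = [] , refl
typedOuts (x ∷ os) (p ∷ ps) refl with typedOuts os ps refl
... | out , e = fromℕ< p ∷ out , cong₂ _∷_ (Finₚ.toℕ-fromℕ< p) e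

nth-++ˡ : ∀ u {v i} → i < length u → nth (u ++ v) i ≡ nth u i
nth-++ˡ (b ∷ u) {i = zero} _        = refl
nth-++ˡ (b ∷ u) {i = suc i} (s≤s p) = nth-++ˡ u p

nth-++ʳ : ∀ u {v} i → nth (u ++ v) (length u + i) ≡ nth v i
nth-++ʳ [] i      = refl
nth-++ʳ (b ∷ u) i = nth-++ʳ u i

nth-map : ∀ {w} os {j} → j < length os → nth (map (nth w) os) j ≡ nth w (nthℕ os j)
nth-map (x ∷ os) {zero} _        = refl
nth-map {w} (x ∷ os) {suc j} (s≤s p) = nth-map {w} os p

evUs-++ : ∀ gs {hs w} → evUs (gs ++ hs) w ≡ evUs hs (evUs gs w)
evUs-++ []       = refl
evUs-++ (g ∷ gs) = evUs-++ gs

evU-shift : ∀ u g {w} → evU (shift (length u) g) (u ++ w) ≡ evU g w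
evU-shift u (and i j) = cong₂ _∧_ (nth-++ʳ u i) (nth-++ʳ u j)
evU-shift u (or i j)  = cong₂ _∨_ (nth-++ʳ u i) (nth-++ʳ u j)
evU-shift u (neg i)   = cong not (nth-++ʳ u i)

evUs-shift : ∀ u gs {w} → evUs (map (shift (length u)) gs) (u ++ w) ≡ u ++ evUs gs w
evUs-shift u []           = refl
evUs-shift u (g ∷ gs) {w} = trans (cong (evUs (map (shift (length u)) gs))
  (trans (cong (λ b → (u ++ w) ++ [ b ]) (evU-shift u g)) (++-assoc u w _))) (evUs-shift u gs)

-- Induction on the part `v` still to be copied. New wires are added behind `w`, so the wires being
-- read stay in place.
evUs-copy : ∀ u v {w} → evUs (copyGates (length u) (length v)) ((u ++ v) ++ w) ≡ ((u ++ v) ++ w) ++ v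
evUs-copy u [] {w}      = sym (++-identityʳ _)
evUs-copy u (b ∷ v) {w} = begin
  evUs (copyGates (suc (length u)) (length v)) (x ++ [ nth x (length u) ∨ nth x (length u) ])
    ≡⟨ cong (λ c → evUs (copyGates (suc (length u)) (length v)) (x ++ [ c ])) (trans (cong (λ c → c ∨ c) read) (∨-idem b)) ⟩
  evUs (copyGates (suc (length u)) (length v)) (x ++ [ b ])
    ≡⟨ cong₂ (λ k y → evUs (copyGates k (length v)) y) (sym (trans (length-++ u) (+-comm _ 1)))
         (trans (++-assoc (u ++ b ∷ v) w [ b ]) (cong (_++ (w ++ [ b ])) regroup)) ⟩
  evUs (copyGates (length (u ++ [ b ])) (length v)) (((u ++ [ b ]) ++ v) ++ (w ++ [ b ]))
    ≡⟨ evUs-copy (u ++ [ b ]) v ⟩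
  (((u ++ [ b ]) ++ v) ++ (w ++ [ b ])) ++ v
    ≡⟨ cong (λ y → (y ++ (w ++ [ b ])) ++ v) regroup ⟨
  ((u ++ b ∷ v) ++ (w ++ [ b ])) ++ v
    ≡⟨ cong (_++ v) (++-assoc (u ++ b ∷ v) w [ b ]) ⟨
  (x ++ [ b ]) ++ v
    ≡⟨ ++-assoc x [ b ] v ⟩
  x ++ b ∷ v ∎
  where
  open ≡-Reasoning
  x : BitString
  x = (u ++ b ∷ v) ++ w
  regroup : u ++ b ∷ v ≡ (u ++ [ b ]) ++ v
  regroup = sym (++-assoc u [ b ] v)
  read : nth x (length u) ≡ b
  read = trans (cong₂ nth (++-assoc u (b ∷ v) w) (sym (+-identityʳ _))) (nth-++ʳ u 0)

select : Bool → Bool → Bool → Bool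
select t p q = if t then q else p

evU-select : ∀ d s p q w → nth w d ≡ not (nth w 0) → evU (selectGate d s p q) w ≡ select (nth w s) p q
evU-select d s false false w e rewrite e with nth w 0 | nth w s
... | false | false = refl
... | false | true  = refl
... | true  | false = refl
... | true  | true  = refl
evU-select d s true true w e rewrite e with nth w 0 | nth w s
... | false | false = refl
... | false | true  = refl
... | true  | false = refl
... | true  | true  = refl
evU-select d s false true w e with nth w s
... | false = refl
... | true  = refl
evU-select d s true false w e with nth w s
... | false = refl
... | true  = refl

-- The fixed part `u` contains the wires 0, d and s read by the gates; `v` collects the bits
-- selected so far and is what grows in the induction.
evUs-select : ∀ d s x y u {v} → 0 < length u → d < length u → s < length u → nth u d ≡ not (nth u 0) → length x ≡ length y →
              evUs (selectGates d s x y) (u ++ v) ≡ (u ++ v) ++ pick (nth u s) y x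
evUs-select d s [] [] u {v} _ _ _ _ _ with nth u s
... | false = sym (++-identityʳ _)
... | true  = sym (++-identityʳ _)
evUs-select d s (p ∷ x) (q ∷ y) u {v} 0< d< s< e l = begin
  evUs (selectGates d s x y) ((u ++ v) ++ [ evU (selectGate d s p q) (u ++ v) ])
    ≡⟨ cong (λ b → evUs (selectGates d s x y) ((u ++ v) ++ [ b ])) (trans (evU-select d s p q (u ++ v) constant)
         (cong (λ t → select t p q) (nth-++ˡ u s<))) ⟩
  evUs (selectGates d s x y) ((u ++ v) ++ [ select t p q ])
    ≡⟨ cong (evUs (selectGates d s x y)) (++-assoc u v _) ⟩
  evUs (selectGates d s x y) (u ++ (v ++ [ select t p q ]))
    ≡⟨ evUs-select d s x y u 0< d< s< e (suc-injective l) ⟩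
  (u ++ (v ++ [ select t p q ])) ++ pick t y x
    ≡⟨ cong (_++ pick t y x) (++-assoc u v _) ⟨
  ((u ++ v) ++ [ select t p q ]) ++ pick t y x
    ≡⟨ ++-assoc (u ++ v) _ _ ⟩
  (u ++ v) ++ (select t p q ∷ pick t y x)
    ≡⟨ cong ((u ++ v) ++_) (merge t) ⟩
  (u ++ v) ++ pick t (q ∷ y) (p ∷ x) ∎
  where
  open ≡-Reasoning
  t : Bool
  t = nth u s
  constant : nth (u ++ v) d ≡ not (nth (u ++ v) 0)
  constant = trans (nth-++ˡ u d<) (trans e (cong not (sym (nth-++ˡ u 0<))))
  merge : ∀ t → select t p q ∷ pick t y x ≡ pick t (q ∷ y) (p ∷ x)
  merge false = refl
  merge true  = refl

-- X are the inputs of the circuit, Z the wires behind them.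
evUs-block : ∀ gs d s x y X Z → length X ≡ d → 0 < d → s < length (X ++ Z) → d < length (X ++ Z) →
             nth (X ++ Z) d ≡ not (nth (X ++ Z) 0) → length x ≡ length y →
             evUs (blockGates gs d (length (X ++ Z)) s x y) (X ++ Z) ≡ (X ++ Z) ++ evUs gs (pick (nth (X ++ Z) s) y x ++ X)
evUs-block gs d s x y X Z refl 0<d s< d< e l = begin
  evUs (blockGates gs d (length u) s x y) u
    ≡⟨ trans (evUs-++ (selectGates d s x y)) (evUs-++ (copyGates 0 d)) ⟩
  evUs (map (shift (length u)) gs) (evUs (copyGates 0 d) (evUs (selectGates d s x y) u))
    ≡⟨ cong (evUs (map (shift (length u)) gs) ∘ evUs (copyGates 0 d)) selected ⟩
  evUs (map (shift (length u)) gs) (evUs (copyGates 0 d) ((X ++ Z) ++ w))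
    ≡⟨ cong (evUs (map (shift (length u)) gs)) copied ⟩
  evUs (map (shift (length u)) gs) (u ++ (w ++ X))
    ≡⟨ evUs-shift u gs ⟩
  u ++ evUs gs (w ++ X) ∎
  where
  open ≡-Reasoning
  u w : BitString
  u = X ++ Z
  w = pick (nth u s) y x
  selected : evUs (selectGates d s x y) u ≡ u ++ w
  selected = trans (cong (evUs (selectGates d s x y)) (sym (++-identityʳ u)))
    (trans (evUs-select d s x y u {[]} (≤-trans (s≤s z≤n) d<) d< s< e l) (cong (_++ w) (++-identityʳ u)))
  copied : evUs (copyGates 0 d) ((X ++ Z) ++ w) ≡ u ++ (w ++ X)
  copied = trans (cong (evUs (copyGates 0 d)) (++-assoc X Z w)) (trans (evUs-copy [] X)
    (trans (cong (_++ X) (sym (++-assoc X Z w))) (++-assoc u w X)))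

-- Equal bits give constant gates, which do not mention the selector. The first block can therefore
-- be treated as if its selector were wire 0, although the number i written there may exceed the
-- wires present.
selectGates-same : ∀ d s x → selectGates d s x x ≡ selectGates d 0 x x
selectGates-same d s []          = refl
selectGates-same d s (false ∷ x) = cong (and 0 d ∷_) (selectGates-same d s x)
selectGates-same d s (true ∷ x)  = cong (or 0 d ∷_) (selectGates-same d s x)

pick-same : ∀ t u → pick t u u ≡ u
pick-same false u = refl
pick-same true u  = refl

selectGates-length : ∀ d s x y → length x ≡ length y → length (selectGates d s x y) ≡ length x
selectGates-length d s [] [] _            = refl
selectGates-length d s (p ∷ x) (q ∷ y) e  = cong suc (selectGates-length d s x y (suc-injective e))

copyGates-length : ∀ i m → length (copyGates i m) ≡ m
copyGates-length i zero    = refl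
copyGates-length i (suc m) = cong suc (copyGates-length (suc i) m)

wellFormed-++ : ∀ {w} gs {hs} → WellFormed w gs → WellFormed (w + length gs) hs → WellFormed w (gs ++ hs)
wellFormed-++ {w} [] {hs} _ h            = subst (λ k → WellFormed k hs) (+-identityʳ w) h
wellFormed-++ {w} (g ∷ gs) {hs} (p , ps) h = p , wellFormed-++ gs ps (subst (λ k → WellFormed k hs) (+-suc w _) h)

select-wellFormed : ∀ {d s w} x y → s < w → d < w → WellFormed w (selectGates d s x y)
select-wellFormed [] _ _ _ = tt
select-wellFormed (_ ∷ _) [] _ _ = tt
select-wellFormed {d} {s} {w} (p ∷ x) (q ∷ y) s< d< = reads p q , select-wellFormed x y (m≤n⇒m≤1+n s<) (m≤n⇒m≤1+n d<)
  where
  0< : 0 < w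
  0< = ≤-trans (s≤s z≤n) d<
  reads : ∀ p q → Reads w (selectGate d s p q)
  reads false false = 0< , d<
  reads false true  = s< , s<
  reads true false  = s<
  reads true true   = 0< , d<

copy-wellFormed : ∀ {w} i m → i + m ≤ w → WellFormed w (copyGates i m)
copy-wellFormed i zero _    = tt
copy-wellFormed {w} i (suc m) h = (i<w , i<w) , copy-wellFormed (suc i) m (m≤n⇒m≤1+n (≤-trans (≤-reflexive (sym (+-suc i m))) h))
  where
  i<w : i < w
  i<w = ≤-trans (s≤s (m≤m+n i m)) (≤-trans (≤-reflexive (sym (+-suc i m))) h)

shift-wellFormed : ∀ k {w} gs → WellFormed w gs → WellFormed (k + w) (map (shift k) gs)
shift-wellFormed k [] _ = tt
shift-wellFormed k {w} (g ∷ gs) (p , ps) =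
  reads g p , subst (λ v → WellFormed v (map (shift k) gs)) (+-suc k w) (shift-wellFormed k gs ps)
  where
  reads : ∀ g → Reads w g → Reads (k + w) (shift k g)
  reads (and i j) (p , q) = +-monoʳ-< k p , +-monoʳ-< k q
  reads (or i j) (p , q)  = +-monoʳ-< k p , +-monoʳ-< k q
  reads (neg i) p         = +-monoʳ-< k p

module _ (gs : List UGate) (d : ℕ) (gs-wf : WellFormed (d + d) gs) where

  block-length : ∀ k s x y → length x ≡ d → length y ≡ d → length (blockGates gs d k s x y) ≡ d + d + length gs
  block-length k s x y x≡ y≡ = trans (length-++ (selectGates d s x y))
    (trans (cong₂ _+_ (trans (selectGates-length d s x y (trans x≡ (sym y≡))) x≡)
      (trans (length-++ (copyGates 0 d)) (cong₂ _+_ (copyGates-length 0 d) (length-map (shift k) gs)))) (sym (+-assoc d d _)))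

  block-wellFormed : ∀ k s x y → s < k → d < k → length x ≡ d → length y ≡ d → WellFormed k (blockGates gs d k s x y)
  block-wellFormed k s x y s< d< x≡ y≡ = wellFormed-++ (selectGates d s x y) (select-wellFormed x y s< d<)
    (wellFormed-++ (copyGates 0 d) (copy-wellFormed 0 d (≤-trans (<⇒≤ d<) (m≤m+n k _)))
      (subst (λ w → WellFormed w (map (shift k) gs)) (sym width≡) (shift-wellFormed k gs gs-wf)))
    where
    width≡ : k + length (selectGates d s x y) + length (copyGates 0 d) ≡ k + (d + d)
    width≡ = trans (cong₂ (λ m n → k + m + n) (trans (selectGates-length d s x y (trans x≡ (sym y≡))) x≡) (copyGates-length 0 d)) (+-assoc k d d)

blockGates-same : ∀ gs d k s x → blockGates gs d k s x x ≡ blockGates gs d k 0 x x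
blockGates-same gs d k s x = cong (_++ (copyGates 0 d ++ map (shift k) gs)) (selectGates-same d s x)

pigeonGates : (d l : ℕ) → List UGate → BitString → ℕ → BitString → BitString → List UGate
pigeonGates d l gs a i p q = neg 0 ∷ (blockGates gs d (suc d) i a a ++ blockGates gs d (suc d + l) (suc d + i) p q)

pigeonOuts : (d l : ℕ) → List ℕ → List ℕ
pigeonOuts d l os = map (suc d +_) os ++ map ((suc d + l) +_) os

reductionOutput≡ : ∀ d l gs os a i p q → reductionOutput d l gs os a i p q ≡
  encℕ d ++ ((encℕ (d + suc (l + (l + 0))) ++ ((encUs (pigeonGates d l gs a i p q) ++ [ false ]) ++ encOuts (pigeonOuts d l os))) ++ replicate d false)
reductionOutput≡ d l gs os a i p q = begin
  (E ++ (L ++ G₀)) ++ ((G₁ ++ (G₂ ++ F)) ++ (O₁ ++ (O₂ ++ Z)))      ≡⟨ ++-assoc E (L ++ G₀) _ ⟩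
  E ++ ((L ++ G₀) ++ ((G₁ ++ (G₂ ++ F)) ++ (O₁ ++ (O₂ ++ Z))))      ≡⟨ cong (E ++_) (++-assoc L G₀ _) ⟩
  E ++ (L ++ (G₀ ++ ((G₁ ++ (G₂ ++ F)) ++ (O₁ ++ (O₂ ++ Z)))))
    ≡⟨ cong (λ u → E ++ (L ++ u)) (sym (++-assoc G₀ (G₁ ++ (G₂ ++ F)) (O₁ ++ (O₂ ++ Z)))) ⟩
  E ++ (L ++ ((G₀ ++ (G₁ ++ (G₂ ++ F))) ++ (O₁ ++ (O₂ ++ Z))))
    ≡⟨ cong₂ (λ u v → E ++ (L ++ (u ++ v))) gates≡ (trans (sym (++-assoc O₁ O₂ Z)) (cong (_++ Z) (sym (concatMap-++ encℕ (map (suc d +_) os) _)))) ⟩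
  E ++ (L ++ ((Gs ++ F) ++ (O ++ Z)))                               ≡⟨ cong (λ u → E ++ (L ++ u)) (++-assoc (Gs ++ F) O Z) ⟨
  E ++ (L ++ (((Gs ++ F) ++ O) ++ Z))                               ≡⟨ cong (E ++_) (++-assoc L _ Z) ⟨
  E ++ ((L ++ ((Gs ++ F) ++ O)) ++ Z)                               ∎
  where
  open ≡-Reasoning
  B₁ B₂ : List UGate
  B₁ = blockGates gs d (suc d) i a a
  B₂ = blockGates gs d (suc d + l) (suc d + i) p q
  E L G₀ G₁ G₂ F O₁ O₂ Z Gs O : BitString
  E  = encℕ d
  L  = encℕ (d + suc (l + (l + 0)))
  G₀ = true ∷ encU (neg 0)
  G₁ = encUs B₁
  G₂ = encUs B₂
  F  = [ false ]
  O₁ = encOuts (map (suc d +_) os)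
  O₂ = encOuts (map ((suc d + l) +_) os)
  Z  = replicate d false
  Gs = encUs (pigeonGates d l gs a i p q)
  O  = encOuts (pigeonOuts d l os)
  gates≡ : G₀ ++ (G₁ ++ (G₂ ++ F)) ≡ Gs ++ F
  gates≡ = cong (G₀ ++_) (trans (sym (++-assoc G₁ G₂ F)) (cong (_++ F) (sym (concatMap-++ (λ g → true ∷ encU g) B₁ B₂))))

-- The hypothesis 0 < d provides wire 0, from which the constants are made; it will come from a ≠ b.
module PigeonCircuit (gs : List UGate) (os : List ℕ) (d l : ℕ) (0<d : 0 < d) (l≡ : l ≡ d + d + length gs)
                     (gs-wf : WellFormed (d + d) gs) (valid : All (_< l) os)
                     (a p q : BitString) (a≡ : length a ≡ d) (p≡ : length p ≡ d) (q≡ : length q ≡ d)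
                     (j : ℕ) (j<os : j < length os) where

  i : ℕ
  i = nthℕ os j

  i<l : i < l
  i<l = nthℕ-All valid j<os

  gates : List UGate
  gates = pigeonGates d l gs a i p q

  d<suc+ : ∀ m → d < suc d + m
  d<suc+ m = s≤s (m≤m+n d m)

  gates-wellFormed : WellFormed d gates
  gates-wellFormed = 0<d , wellFormed-++ (blockGates gs d (suc d) i a a)
    (subst (WellFormed (suc d)) (sym (blockGates-same gs d (suc d) i a)) (block-wellFormed gs d gs-wf (suc d) 0 a a (s≤s z≤n) ≤-refl a≡ a≡))
    (subst (λ w → WellFormed w (blockGates gs d (suc d + l) (suc d + i) p q))
      (cong (suc d +_) (trans l≡ (sym (block-length gs d gs-wf (suc d) i a a a≡ a≡))))
      (block-wellFormed gs d gs-wf (suc d + l) (suc d + i) p q (+-monoʳ-< (suc d) i<l) (d<suc+ l) p≡ q≡))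

  gates-width : d + suc (l + (l + 0)) ≡ d + length gates
  gates-width = cong (λ m → d + suc m) (sym (trans (length-++ (blockGates gs d (suc d) i a a))
    (cong₂ _+_ (trans (block-length gs d gs-wf (suc d) i a a a≡ a≡) (sym l≡))
      (trans (block-length gs d gs-wf (suc d + l) (suc d + i) p q p≡ q≡) (trans (sym l≡) (sym (+-identityʳ l)))))))

  outs-valid : All (_< d + suc (l + (l + 0))) (pigeonOuts d l os)
  outs-valid = Allₚ.++⁺ (Allₚ.map⁺ (All.map first valid)) (Allₚ.map⁺ (All.map second valid))
    where
    first : ∀ {x} → x < l → suc d + x < d + suc (l + (l + 0))
    first {x} h = subst (suc d + x <_) (sym (+-suc d _)) (+-monoʳ-< (suc d) (≤-trans h (m≤m+n l _)))
    second : ∀ {x} → x < l → (suc d + l) + x < d + suc (l + (l + 0))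
    second {x} h = subst₂ _<_ (sym (+-assoc (suc d) l x)) (sym (trans (+-suc d _) (cong (λ m → suc d + (l + m)) (+-identityʳ l))))
      (+-monoʳ-< (suc d) (+-monoʳ-< l h))

  outs-length : length (pigeonOuts d l os) ≡ length os + length os
  outs-length = trans (length-++ (map (suc d +_) os)) (cong₂ _+_ (length-map _ os) (length-map _ os))

  colours : BitString → BitString → BitString
  colours x y = colourU gs os (x ++ y)

  -- The endpoint outside the colour class of X around a.
  outsider : BitString → BitString
  outsider X = pick (nth (colours a X) j) q p

  value : ∀ X → length X ≡ d → colourU gates (pigeonOuts d l os) X ≡ colours a X ++ colours (outsider X) X
  value X X≡ = begin
    map (nth (evUs gates X)) (pigeonOuts d l os)      ≡⟨ cong (λ w → map (nth w) (pigeonOuts d l os)) evaluated ⟩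
    map (nth Y₃) (pigeonOuts d l os)                  ≡⟨ map-++ (nth Y₃) (map (suc d +_) os) _ ⟩
    map (nth Y₃) (map (suc d +_) os) ++ map (nth Y₃) (map ((suc d + l) +_) os)
      ≡⟨ cong₂ _++_ (trans (sym (map-∘ os)) (map-cong-local (All.map first valid)))
                    (trans (sym (map-∘ os)) (map-cong second os)) ⟩
    map (nth W₁) os ++ map (nth W₂) os                ∎
    where
    open ≡-Reasoning
    -- `Y₁`, `Y₂`, `Y₃` are the wires after the negation, the first and the second block. `W₁` and
    -- `W₂` are the wires of the two copies of C including their inputs, which the selecting and
    -- copying gates supply.
    Y₁ W₁ W₂ Y₂ Y₃ w : BitString
    Y₁ = X ++ [ not (nth X 0) ]
    W₁ = evUs gs (a ++ X)
    Y₂ = Y₁ ++ W₁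
    w  = outsider X
    W₂ = evUs gs (w ++ X)
    Y₃ = Y₂ ++ W₂
    Y₁≡ : length Y₁ ≡ suc d
    Y₁≡ = trans (length-++ X) (trans (+-comm _ 1) (cong suc X≡))
    W₁≡ : length W₁ ≡ l
    W₁≡ = trans (length-evUs gs (a ++ X)) (trans (cong (_+ length gs) (trans (length-++ a) (cong₂ _+_ a≡ X≡))) (sym l≡))
    Y₂≡ : length Y₂ ≡ suc d + l
    Y₂≡ = trans (length-++ Y₁) (cong₂ _+_ Y₁≡ W₁≡)
    0<X : 0 < length X
    0<X = subst (0 <_) (sym X≡) 0<d
    constant₁ : nth Y₁ d ≡ not (nth Y₁ 0)
    constant₁ = trans (cong (nth Y₁) (trans (sym X≡) (sym (+-identityʳ _)))) (trans (nth-++ʳ X 0) (cong not (sym (nth-++ˡ X 0<X))))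
    constant₂ : nth Y₂ d ≡ not (nth Y₂ 0)
    constant₂ = trans (nth-++ˡ Y₁ (≤-reflexive (sym Y₁≡))) (trans constant₁ (cong not (sym (nth-++ˡ Y₁ (subst (0 <_) (sym Y₁≡) (s≤s z≤n))))))
    block₁ : evUs (blockGates gs d (suc d) i a a) Y₁ ≡ Y₂
    block₁ = trans (cong (λ hs → evUs hs Y₁) (trans (blockGates-same gs d (suc d) i a) (cong (λ k → blockGates gs d k 0 a a) (sym Y₁≡))))
      (trans (evUs-block gs d 0 a a X [ not (nth X 0) ] X≡ 0<d (subst (0 <_) (sym Y₁≡) (s≤s z≤n)) (≤-reflexive (sym Y₁≡)) constant₁ refl)
        (cong (λ u → Y₁ ++ evUs gs (u ++ X)) (pick-same (nth Y₁ 0) a)))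
    Y₂-split : Y₂ ≡ X ++ (not (nth X 0) ∷ W₁)
    Y₂-split = ++-assoc X _ W₁
    -- Wire i of the first copy is its output number j, hence bit j of the colour of aX.
    selector : nth Y₂ (suc d + i) ≡ nth (colours a X) j
    selector = trans (cong (λ k → nth Y₂ (k + i)) (sym Y₁≡)) (trans (nth-++ʳ Y₁ i) (sym (nth-map {W₁} os j<os)))
    block₂ : evUs (blockGates gs d (suc d + l) (suc d + i) p q) Y₂ ≡ Y₃
    block₂ = begin
      evUs (blockGates gs d (suc d + l) (suc d + i) p q) Y₂
        ≡⟨ cong (λ k → evUs (blockGates gs d k (suc d + i) p q) Y₂) (sym Y₂≡) ⟩
      evUs (blockGates gs d (length Y₂) (suc d + i) p q) Y₂
        ≡⟨ subst (λ Y → nth Y d ≡ not (nth Y 0) → suc d + i < length Y → d < length Y →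
               evUs (blockGates gs d (length Y) (suc d + i) p q) Y ≡ Y ++ evUs gs (pick (nth Y (suc d + i)) q p ++ X)) (sym Y₂-split)
             (λ e s< d< → evUs-block gs d (suc d + i) p q X (not (nth X 0) ∷ W₁) X≡ 0<d s< d< e (trans p≡ (sym q≡)))
             constant₂ (subst (suc d + i <_) (sym Y₂≡) (+-monoʳ-< (suc d) i<l)) (subst (d <_) (sym Y₂≡) (d<suc+ l)) ⟩
      Y₂ ++ evUs gs (pick (nth Y₂ (suc d + i)) q p ++ X)
        ≡⟨ cong (λ t → Y₂ ++ evUs gs (pick t q p ++ X)) selector ⟩
      Y₃ ∎
    evaluated : evUs gates X ≡ Y₃
    evaluated = trans (evUs-++ (blockGates gs d (suc d) i a a)) (trans (cong (evUs (blockGates gs d (suc d + l) (suc d + i) p q)) block₁) block₂)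
    first : ∀ {x} → x < l → nth Y₃ (suc d + x) ≡ nth W₁ x
    first {x} h = trans (nth-++ˡ Y₂ (subst (suc d + x <_) (sym Y₂≡) (+-monoʳ-< (suc d) h)))
      (trans (cong (λ k → nth Y₂ (k + x)) (sym Y₁≡)) (nth-++ʳ Y₁ x))
    second : ∀ x → nth Y₃ ((suc d + l) + x) ≡ nth W₂ x
    second x = trans (cong (λ k → nth Y₃ (k + x)) (sym Y₂≡)) (nth-++ʳ Y₂ x)

-- The combinatorial argument

module Colouring {V C : Set} (_≟ᵛ_ : (x y : V) → Dec (x ≡ y)) (_≟ᶜ_ : (s t : C) → Dec (s ≡ t)) (col : V → V → C) where

  Triangle : V → V → V → Set
  Triangle x y z = x ≢ y × x ≢ z × y ≢ z × col x y ≡ col x z × col x y ≢ col y z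

  Asymmetric : V → V → Set
  Asymmetric x y = x ≢ y × col x y ≢ col y x

  symmetric : ∀ {x y} → ¬ Asymmetric x y → x ≢ y → col x y ≡ col y x
  symmetric {x} {y} h x≢y with col x y ≟ᶜ col y x
  ... | yes e = e
  ... | no ne = contradiction (x≢y , ne) h

  module _ {a w : V} (w≢a : w ≢ a) (symmetric-w : ¬ Asymmetric a w) where

    private
      aw≡wa : col a w ≡ col w a
      aw≡wa = symmetric symmetric-w (w≢a ∘ sym)

    -- Both the preimages of a diagonal value and the collisions inside one colour class end here.
    same-colour : ∀ {x} → col a x ≡ col w x → col a w ≢ col a x →
                  ¬ Triangle x a w → ¬ Asymmetric w x → ¬ Asymmetric a x → ⊥
    same-colour {x} ax≡wx aw≢ax ¬t ¬wx ¬ax with x ≟ᵛ a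
    ... | yes refl = aw≢ax (trans aw≡wa (sym ax≡wx))
    ... | no x≢a = ¬t (x≢a , x≢w , w≢a ∘ sym , trans (sym ax≡xa) (trans ax≡wx wx≡xw) , λ e → aw≢ax (sym (trans ax≡xa e)))
      where
      x≢w : x ≢ w
      x≢w refl = aw≢ax refl
      ax≡xa : col a x ≡ col x a
      ax≡xa = symmetric ¬ax (x≢a ∘ sym)
      wx≡xw : col w x ≡ col x w
      wx≡xw = symmetric ¬wx (x≢w ∘ sym)

    -- If one of x, y is a, call the other one z: wa and wz have the same colour by the collision,
    -- az has another one, and w, a, z is a triangle. Otherwise the colour of xy either differs from
    -- that of ax or of wx, giving a triangle at a or at w, or equals both, so that `same-colour`
    -- applies.
    collision-solved : ∀ {x y} → x ≢ y → col a x ≡ col a y → col w x ≡ col w y → col a w ≢ col a x →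
                       ¬ Triangle a x y → ¬ Triangle w x y → ¬ Triangle w a x → ¬ Triangle w a y →
                       ¬ Triangle x a w → ¬ Asymmetric w x → ¬ Asymmetric a x → ⊥
    collision-solved {x} {y} x≢y ax≡ay wx≡wy aw≢ax ¬axy ¬wxy ¬wax ¬way ¬xaw ¬wx ¬ax = cases (x ≟ᵛ a) (y ≟ᵛ a)
      where
      w≢x : w ≢ x
      w≢x refl = aw≢ax refl
      w≢y : w ≢ y
      w≢y refl = aw≢ax (sym ax≡ay)
      cases : Dec (x ≡ a) → Dec (y ≡ a) → ⊥
      cases (yes refl) _ = ¬way (w≢a , w≢y , x≢y , wx≡wy , λ e → aw≢ax (trans aw≡wa (trans e (sym ax≡ay))))
      cases (no x≢a) (yes refl) = ¬wax (w≢a , w≢x , x≢a ∘ sym , sym wx≡wy , λ e → aw≢ax (trans aw≡wa e))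
      cases (no x≢a) (no y≢a) with col a x ≟ᶜ col x y
      ... | no ax≢xy = ¬axy (x≢a ∘ sym , y≢a ∘ sym , x≢y , ax≡ay , ax≢xy)
      ... | yes ax≡xy with col w x ≟ᶜ col x y
      ...   | no wx≢xy = ¬wxy (w≢x , w≢y , x≢y , wx≡wy , wx≢xy)
      ...   | yes wx≡xy = same-colour (trans ax≡xy (sym wx≡xy)) aw≢ax ¬xaw ¬wx ¬ax

-- The program recovering a solution

xx yy ff : Fin 13
xx = # 10
yy = # 11
ff = # 12

data Node : Set where
  nodeA nodeB nodeC nodeX nodeY : Node

reg : Node → Fin 13
reg nodeA = aa
reg nodeB = bb
reg nodeC = cc
reg nodeX = xx
reg nodeY = yy

data Candidate : Set where
  tri : Node → Node → Node → Candidate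
  asy : Node → Node → Candidate

compareStep : ∀ {d} → P d
compareStep = case rV stop
  (case rY stop skip (snoc rJ true ； stop))
  (case rY stop (snoc rJ true ； stop) skip)

compare : Fin 22 → Fin 22 → P 2
compare r r′ = copy r rV rT ； copy r′ rY rT ； loop compareStep ； clear rV ； clear rY
             ； case rJ (snoc (hi ff) false) (snoc (hi ff) false) (snoc (hi ff) true)

-- The verdicts wait in the queue `ff`. At the first wrong one the rest is cleared, so that the next
-- candidate starts with an empty queue.
accept : BitString → P 2 → P 2
accept [] p          = p
accept (false ∷ u) p = case (hi ff) skip (accept u p) (clear (hi ff))
accept (true ∷ u) p  = case (hi ff) skip (clear (hi ff)) (accept u p)

-- A `true` stands for a difference. For a triangle the tests are the three pairs of nodes, then the
-- colours of pq against pr and of pq against qr.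
expected : Candidate → BitString
expected (tri _ _ _) = true ∷ true ∷ true ∷ false ∷ true ∷ []
expected (asy _ _)   = true ∷ true ∷ []

-- These programs run outside every loop, where `stop` ends everything that follows, so only the
-- first successful candidate is written.
try : Candidate → P 2
try (tri p q r) = evalPair (reg p) (reg q) ； move rE (hi e₁) ； evalPair (reg p) (reg r) ； move rE (hi e₂) ； evalPair (reg q) (reg r)
  ； compare (hi (reg p)) (hi (reg q)) ； compare (hi (reg p)) (hi (reg r)) ； compare (hi (reg q)) (hi (reg r))
  ； compare (hi e₁) (hi e₂) ； compare (hi e₁) rE ； clear (hi e₁) ； clear (hi e₂) ； clear rE
  ； accept (expected (tri p q r)) (emit [ false ] ； copy (hi (reg p)) rO rT ； copy (hi (reg q)) rO rT ； copy (hi (reg r)) rO rT ； stop)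
try (asy p q) = evalPair (reg p) (reg q) ； move rE (hi e₁) ； evalPair (reg q) (reg p)
  ； compare (hi (reg p)) (hi (reg q)) ； compare (hi e₁) rE ； clear (hi e₁) ； clear rE
  ； accept (expected (asy p q)) (emit [ true ] ； copy (hi (reg p)) rO rT ； copy (hi (reg q)) rO rT ； stop)

tryAll : List Candidate → P 2
tryAll []       = skip
tryAll (c ∷ cs) = try c ； tryAll cs

-- The triangles and edges refuted in `collision-solved`, for both possible values b and c of w,
-- which spares the program the computation of w.
candidates : List Candidate
candidates = tri nodeA nodeX nodeY ∷ asy nodeA nodeX ∷ around nodeB ++ around nodeC
  where
  around : Node → List Candidate
  around w = tri w nodeX nodeY ∷ tri w nodeA nodeX ∷ tri w nodeA nodeY ∷ tri nodeX nodeA w ∷ asy nodeA w ∷ asy w nodeX ∷ []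

-- Reduces the pair to the plain instance followed by the plain Pigeon solution, so that `parse` can
-- be reused and leaves just the solution on the stream.
decode : P 2
decode = loop (case rS stop stop (case rS stop (snoc rW false) (snoc rW true))) ； move rS rW ； move rW rS

-- A preimage is stored both as x and as y, so that one list of candidates serves both kinds of
-- Pigeon solutions.
readSolution : P 2
readSolution = case rS stop (take xx ； copy (hi xx) (hi yy) rT) (take xx ； take yy)

recovery : P 2
recovery = decode ； parse ； readSolution ； tryAll candidates

differ : BitString → BitString → Bool
differ []          _           = false
differ (_ ∷ _)     []          = false
differ (false ∷ u) (false ∷ v) = differ u v
differ (false ∷ u) (true ∷ v)  = true
differ (true ∷ u)  (false ∷ v) = true
differ (true ∷ u)  (true ∷ v)  = differ u v

differ-refl : ∀ u → differ u u ≡ false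
differ-refl []          = refl
differ-refl (false ∷ u) = differ-refl u
differ-refl (true ∷ u)  = differ-refl u

differ-false : ∀ u v → length u ≡ length v → differ u v ≡ false → u ≡ v
differ-false [] [] _ _                   = refl
differ-false (false ∷ u) (false ∷ v) l e = cong (false ∷_) (differ-false u v (suc-injective l) e)
differ-false (true ∷ u) (true ∷ v) l e   = cong (true ∷_) (differ-false u v (suc-injective l) e)

module _ {N : ℕ} where

  private
    flag : Bool → BitString
    flag false = []
    flag true  = [ true ]

    comparing : ∀ u v {e ρ} → Σ[ u′ ∈ BitString ] Σ[ v′ ∈ BitString ] Σ[ k ∈ ℕ ] k ≤ suc (length u) × length u′ ≤ length u × length v′ ≤ length v ×
                Rounds {N = N} (compareStep {1}) k (core [] [] u v [] [] [] [] e ρ) (core [] [] u′ v′ [] [] [] (flag (differ u v)) e ρ)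
    comparing [] v                = [] , v , 1 , ≤-refl , ≤-refl , ≤-refl , last (case-empty refl stop!)
    comparing (false ∷ u) []      = u , [] , 1 , s≤s z≤n , n≤1+n _ , ≤-refl , last (case-false refl (case-empty refl stop!))
    comparing (true ∷ u) []       = u , [] , 1 , s≤s z≤n , n≤1+n _ , ≤-refl , last (case-true refl (case-empty refl stop!))
    comparing (false ∷ u) (true ∷ v) = u , v , 1 , s≤s z≤n , n≤1+n _ , n≤1+n _ , last (case-false refl (case-true refl (snoc! ∙ stop!)))
    comparing (true ∷ u) (false ∷ v) = u , v , 1 , s≤s z≤n , n≤1+n _ , n≤1+n _ , last (case-true refl (case-false refl (snoc! ∙ stop!)))
    comparing (false ∷ u) (false ∷ v) {e} {ρ} with comparing u v {e} {ρ}
    ... | u′ , v′ , k , k≤ , u≤ , v≤ , r = u′ , v′ , suc k , s≤s k≤ , m≤n⇒m≤1+n u≤ , m≤n⇒m≤1+n v≤ ,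
      more (case-false refl (case-false refl skip!)) r
    comparing (true ∷ u) (true ∷ v) {e} {ρ} with comparing u v {e} {ρ}
    ... | u′ , v′ , k , k≤ , u≤ , v≤ , r = u′ , v′ , suc k , s≤s k≤ , m≤n⇒m≤1+n u≤ , m≤n⇒m≤1+n v≤ ,
      more (case-true refl (case-true refl skip!)) r

  compare! : ∀ r r′ {u v e ρ} → r ≢ rV → r ≢ rT → r′ ≢ rY → r′ ≢ rT →
             lookup (core [] [] [] [] [] [] [] [] e ρ) r ≡ u → lookup (core [] [] u [] [] [] [] [] e ρ) r′ ≡ v →
             length u < N → length v < N →
             Exec N (compare r r′) (core [] [] [] [] [] [] [] [] e ρ) true (core [] [] [] [] [] [] [] [] e (append ff [ differ u v ] ρ))
  compare! r r′ {u} {v} {e} {ρ} r≢V r≢T r′≢Y r′≢T r≡ r′≡ u<N v<N with comparing u v {e} {ρ}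
  ... | u′ , v′ , k , k≤ , u≤ , v≤ , rounds =
    resume (cong (λ u → core [] [] u [] [] [] [] [] e ρ) r≡) (copy! r≢V r≢T (λ ()) refl (subst (λ u → length u < N) (sym r≡) u<N)) ∙
    (resume (cong (λ v → core [] [] u v [] [] [] [] e ρ) r′≡) (copy! r′≢Y r′≢T (λ ()) refl (subst (λ u → length u < N) (sym r′≡) v<N)) ∙
    (loop! rounds (≤-trans k≤ u<N) ∙ (clear! (≤-trans (s≤s u≤) u<N) ∙ (clear! (≤-trans (s≤s v≤) v<N) ∙ verdict (differ u v)))))
    where
    verdict : ∀ b → Exec N (case {d = 2} rJ (snoc (hi ff) false) (snoc (hi ff) false) (snoc (hi ff) true))
                (core [] [] [] [] [] [] [] (flag b) e ρ) true (core [] [] [] [] [] [] [] [] e (append ff [ b ] ρ))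
    verdict false = case-empty refl snoc!
    verdict true  = case-true refl snoc!

module Recovery {N n l gs os} (B : Bounds N n l gs os) (a b c : BitString)
                (a≡ : length a ≡ 2 * n) (b≡ : length b ≡ 2 * n) (c≡ : length c ≡ 2 * n) where

  open Bounds B

  private
    d : ℕ
    d = 2 * n

    decoding : ∀ u {w s ρ} → Rounds {K = 22} {N = N} (case {d = 1} rS stop stop (case rS stop (snoc rW false) (snoc rW true))) (suc (length u))
                 (core (selfDelim u ++ s) w [] [] [] [] [] [] [] ρ) (core s (w ++ u) [] [] [] [] [] [] [] ρ)
    decoding [] {w} {s} {ρ}      = last (case-false refl (resume (cong (λ w → core s w [] [] [] [] [] [] [] ρ) (sym (++-identityʳ w))) stop!))
    decoding (b ∷ u) {w} {s} {ρ} = more (case-true refl (case-bit {q = snoc rW} refl snoc!))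
      (subst (λ w′ → Rounds (case {d = 1} rS stop stop (case rS stop (snoc rW false) (snoc rW true))) (suc (length u))
                (core (selfDelim u ++ s) (w ++ [ b ]) [] [] [] [] [] [] [] ρ) (core s w′ [] [] [] [] [] [] [] ρ))
        (++-assoc w [ b ] u) (decoding u))

  decode! : ∀ u s {ρ} → length (u ++ s) < N → Exec N decode (core (selfDelim u ++ s) [] [] [] [] [] [] [] [] ρ) true
              (core (u ++ s) [] [] [] [] [] [] [] [] ρ)
  decode! u s h = loop! (decoding u) (≤-trans (s≤s (prefix-bound u ≤-refl)) h) ∙
    (move! (λ ()) (≤-trans (s≤s (suffix-bound u ≤-refl)) h) ∙ move! (λ ()) h)

  module _ (x y : BitString) (x≡ : length x ≡ d) (y≡ : length y ≡ d) where

    registers : BitString → BitString → BitString → Vec BitString 13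
    registers u v w = ones n ∷ ones d ∷ ones l ∷ (encUs gs ++ [ false ]) ∷ encOuts os ∷ a ∷ b ∷ c ∷ u ∷ v ∷ x ∷ y ∷ w ∷ []

    value : Node → BitString
    value nodeA = a
    value nodeB = b
    value nodeC = c
    value nodeX = x
    value nodeY = y

    shade : Node → Node → BitString
    shade p q = colourU gs os (value p ++ value q)

    observed : Candidate → BitString
    observed (tri p q r) = differ (value p) (value q) ∷ differ (value p) (value r) ∷ differ (value q) (value r)
                         ∷ differ (shade p q) (shade p r) ∷ differ (shade p q) (shade q r) ∷ []
    observed (asy p q)   = differ (value p) (value q) ∷ differ (shade p q) (shade q p) ∷ []

    Matches : Candidate → Set
    Matches k = observed k ≡ expected k

    encoding : Candidate → BitString
    encoding (tri p q r) = false ∷ (value p ++ (value q ++ value r))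
    encoding (asy p q)   = true ∷ (value p ++ value q)

    private
      idle : BitString → BitString → State 22
      idle e w = core [] [] [] [] [] [] [] [] e (registers [] [] w)

      at-node : ∀ p {u v w} → lookup (registers u v w) (reg p) ≡ value p
      at-node nodeA = refl
      at-node nodeB = refl
      at-node nodeC = refl
      at-node nodeX = refl
      at-node nodeY = refl

      value-length : ∀ p → length (value p) ≡ d
      value-length nodeA = a≡
      value-length nodeB = b≡
      value-length nodeC = c≡
      value-length nodeX = x≡
      value-length nodeY = y≡

      value<N : ∀ p → length (value p) < N
      value<N p = subst (_< N) (sym (value-length p)) nodes<N

      shade<N : ∀ p q → length (shade p q) < N
      shade<N p q = subst (_< N) (sym (length-map _ os)) os<N

      evaluate : ∀ p q {u v w} → Exec N (evalPair (reg p) (reg q)) (core [] [] [] [] [] [] [] [] [] (registers u v w)) true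
                   (core [] [] [] [] [] [] [] [] (shade p q) (registers u v w))
      evaluate p q {u} {v} {w} = resume (cong₂ (λ s t → core [] [] [] [] [] [] [] [] (colourU gs os (s ++ t)) (registers u v w)) (at-node p) (at-node q))
        (evalPair! B (reg p) (reg q) refl refl refl (trans (cong length (at-node p {u} {v} {w})) (value-length p))
          (trans (cong length (at-node q {u} {v} {w})) (value-length q)))

      compare-nodes : ∀ p q {e u v w} → Exec N (compare (hi (reg p)) (hi (reg q))) (core [] [] [] [] [] [] [] [] e (registers u v w)) true
                        (core [] [] [] [] [] [] [] [] e (registers u v (w ++ [ differ (value p) (value q) ])))
      compare-nodes p q = compare! (hi (reg p)) (hi (reg q)) (λ ()) (λ ()) (λ ()) (λ ()) (at-node p) (at-node q) (value<N p) (value<N q)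

      copy-node : ∀ p {o e u v w} → Exec N (copy {d = 1} (hi (reg p)) rO rT) (core [] [] [] [] o [] [] [] e (registers u v w)) true
                    (core [] [] [] [] (o ++ value p) [] [] [] e (registers u v w))
      copy-node p {o} {e} {u} {v} {w} = resume (cong (λ s → core [] [] [] [] (o ++ s) [] [] [] e (registers u v w)) (at-node p))
        (copy! (λ ()) (λ ()) (λ ()) refl (subst (λ s → length s < N) (sym (at-node p {u} {v} {w})) (value<N p)))

      accepted : ∀ u {v p b τ} → v ≡ u → Exec N p (idle [] []) b τ → Exec N (accept u p) (idle [] v) b τ
      accepted [] refl e          = e
      accepted (false ∷ u) refl e = case-false refl (accepted u refl e)
      accepted (true ∷ u) refl e  = case-true refl (accepted u refl e)

      rejected : ∀ u v {p} → length u ≡ length v → length v < N → v ≢ u → Exec N (accept u p) (idle [] v) true (idle [] [])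
      rejected [] [] _ _ ne = contradiction refl ne
      rejected (false ∷ u) (false ∷ v) l h ne = case-false refl (rejected u v (suc-injective l) (≤-trans (n≤1+n _) h) (ne ∘ cong (false ∷_)))
      rejected (true ∷ u) (true ∷ v) l h ne   = case-true refl (rejected u v (suc-injective l) (≤-trans (n≤1+n _) h) (ne ∘ cong (true ∷_)))
      rejected (false ∷ u) (true ∷ v) l h ne  = case-true refl (clear! (≤-trans (n≤1+n _) h))
      rejected (true ∷ u) (false ∷ v) l h ne  = case-false refl (clear! (≤-trans (n≤1+n _) h))

      -- `try` with an arbitrary continuation in place of the final test, so that the part common to
      -- success and failure is executed in one lemma.
      prepare : Candidate → P 2 → P 2
      prepare (tri p q r) t = evalPair (reg p) (reg q) ； move rE (hi e₁) ； evalPair (reg p) (reg r) ； move rE (hi e₂) ； evalPair (reg q) (reg r)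
        ； compare (hi (reg p)) (hi (reg q)) ； compare (hi (reg p)) (hi (reg r)) ； compare (hi (reg q)) (hi (reg r))
        ； compare (hi e₁) (hi e₂) ； compare (hi e₁) rE ； clear (hi e₁) ； clear (hi e₂) ； clear rE ； t
      prepare (asy p q) t = evalPair (reg p) (reg q) ； move rE (hi e₁) ； evalPair (reg q) (reg p)
        ； compare (hi (reg p)) (hi (reg q)) ； compare (hi e₁) rE ； clear (hi e₁) ； clear rE ； t

      prepare! : ∀ k {t b τ} → Exec N t (idle [] (observed k)) b τ → Exec N (prepare k t) (idle [] []) b τ
      prepare! (tri p q r) E =
        evaluate p q ∙ (move! (λ ()) (shade<N p q) ∙ (evaluate p r ∙ (move! (λ ()) (shade<N p r) ∙ (evaluate q r ∙
        (compare-nodes p q ∙ (compare-nodes p r ∙ (compare-nodes q r ∙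
        (compare! (hi e₁) (hi e₂) (λ ()) (λ ()) (λ ()) (λ ()) refl refl (shade<N p q) (shade<N p r) ∙
        (compare! (hi e₁) rE (λ ()) (λ ()) (λ ()) (λ ()) refl refl (shade<N p q) (shade<N q r) ∙
        (clear! (shade<N p q) ∙ (clear! (shade<N p r) ∙ (clear! (shade<N q r) ∙ E))))))))))))
      prepare! (asy p q) E =
        evaluate p q ∙ (move! (λ ()) (shade<N p q) ∙ (evaluate q p ∙ (compare-nodes p q ∙
        (compare! (hi e₁) rE (λ ()) (λ ()) (λ ()) (λ ()) refl refl (shade<N p q) (shade<N q p) ∙
        (clear! (shade<N p q) ∙ (clear! (shade<N q p) ∙ E))))))

      try-match : ∀ k → Matches k → Σ[ τ ∈ State 22 ] Exec N (try k) (idle [] []) false τ × lookup τ rO ≡ encoding k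
      try-match (tri p q r) m = _ , prepare! (tri p q r)
        (accepted (expected (tri p q r)) m (emit! [ false ] ∙ (copy-node p ∙ (copy-node q ∙ (copy-node r ∙ stop!))))) ,
        join-assoc [ false ] (value p) (value q ∷ value r ∷ [])
      try-match (asy p q) m = _ , prepare! (asy p q)
        (accepted (expected (asy p q)) m (emit! [ true ] ∙ (copy-node p ∙ (copy-node q ∙ stop!)))) ,
        join-assoc [ true ] (value p) (value q ∷ [])

      -- The 5 is the number of verdicts on a triangle: discarding them must fit on the clock.
      try-mismatch : 5 < N → ∀ k → ¬ Matches k → Exec N (try k) (idle [] []) true (idle [] [])
      try-mismatch 5<N (tri p q r) m = prepare! (tri p q r) (rejected (expected (tri p q r)) (observed (tri p q r)) refl 5<N m)
      try-mismatch 5<N (asy p q) m   = prepare! (asy p q) (rejected (expected (asy p q)) (observed (asy p q)) refl (≤-trans (s≤s (s≤s (s≤s z≤n))) 5<N) m)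

    tryAll! : 5 < N → ∀ ks → (All (¬_ ∘ Matches) ks) ⊎ (Σ[ k ∈ Candidate ] Matches k × Σ[ τ ∈ State 22 ]
              Exec N (tryAll ks) (core [] [] [] [] [] [] [] [] [] (registers [] [] [])) false τ × lookup τ rO ≡ encoding k)
    tryAll! 5<N [] = inj₁ []
    tryAll! 5<N (k ∷ ks) with ≡-dec _≟ᵇ_ (observed k) (expected k)
    ... | yes m = inj₂ (k , m , proj₁ (try-match k m) , halt (proj₁ (proj₂ (try-match k m))) , proj₂ (proj₂ (try-match k m)))
    ... | no m with tryAll! 5<N ks
    ...   | inj₁ ms = inj₁ (m ∷ ms)
    ...   | inj₂ (k′ , m′ , τ , E , o) = inj₂ (k′ , m′ , τ , (try-mismatch 5<N k m ∙ E) , o)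

  instanceBits : BitString
  instanceBits = encℕ n ++ (encℕ l ++ (encUs gs ++ false ∷ (encOuts os ++ (a ++ (b ++ c)))))

  private
    instanceBits-++ : ∀ t → instanceBits ++ t ≡ encℕ n ++ (encℕ l ++ (encUs gs ++ false ∷ (encOuts os ++ (a ++ (b ++ (c ++ t))))))
    instanceBits-++ t = trans (++-assoc (encℕ n) _ t) (cong (encℕ n ++_) (trans (++-assoc (encℕ l) _ t) (cong (encℕ l ++_)
      (trans (++-assoc (encUs gs) _ t) (cong (λ u → encUs gs ++ false ∷ u) (trans (++-assoc (encOuts os) _ t) (cong (encOuts os ++_)
        (trans (++-assoc a _ t) (cong (a ++_) (++-assoc b c t))))))))))

    start! : ∀ t → length (instanceBits ++ t) < N → ∀ {r τ} {p : P 2} →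
             Exec N p (core t [] [] [] [] [] [] [] [] (ones n ∷ ones d ∷ ones l ∷ (encUs gs ++ [ false ]) ∷ encOuts os ∷ a ∷ b ∷ c ∷ [] ∷ [] ∷ [] ∷ [] ∷ [] ∷ [])) r τ →
             Exec N (decode ； parse ； p) ((selfDelim instanceBits ++ t) ∷ Vec.replicate 21 []) r τ
    start! t h E = resume (cong (λ u → core u [] [] [] [] [] [] [] [] (Vec.replicate 13 [])) (instanceBits-++ t)) (decode! instanceBits t h) ∙
      (parse! B {a} {b} {c} {t} a≡ b≡ c≡ ∙ E)

  preimage-recovery! : ∀ x → (x≡ : length x ≡ d) → ∀ {r τ} → length (instanceBits ++ false ∷ (x ++ [])) < N →
    Exec N (tryAll candidates) (core [] [] [] [] [] [] [] [] [] (registers x x x≡ x≡ [] [] [])) r τ →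
    Exec N recovery ((selfDelim instanceBits ++ false ∷ (x ++ [])) ∷ Vec.replicate 21 []) r τ
  preimage-recovery! x x≡ h E = start! (false ∷ (x ++ [])) h
    (case-false refl (take! xx x (cong ones (sym x≡)) x<N ∙ copy! (λ ()) (λ ()) (λ ()) refl x<N) ∙ E)
    where
    x<N : length x < N
    x<N = subst (_< N) (sym x≡) nodes<N

  collision-recovery! : ∀ x y → (x≡ : length x ≡ d) (y≡ : length y ≡ d) → ∀ {r τ} → length (instanceBits ++ true ∷ (x ++ (y ++ []))) < N →
    Exec N (tryAll candidates) (core [] [] [] [] [] [] [] [] [] (registers x y x≡ y≡ [] [] [])) r τ →
    Exec N recovery ((selfDelim instanceBits ++ true ∷ (x ++ (y ++ []))) ∷ Vec.replicate 21 []) r τ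
  collision-recovery! x y x≡ y≡ h E = start! (true ∷ (x ++ (y ++ []))) h
    (case-true refl (take! xx x (cong ones (sym x≡)) (subst (_< N) (sym x≡) nodes<N) ∙ take! yy y (cong ones (sym y≡)) (subst (_< N) (sym y≡) nodes<N)) ∙ E)

-- Correctness

++-split : ∀ (u u′ : BitString) {v v′} → length u ≡ length u′ → u ++ v ≡ u′ ++ v′ → u ≡ u′ × v ≡ v′
++-split [] [] _ e = refl , e
++-split (_ ∷ u) (_ ∷ u′) l e with ∷-injective e
... | refl , e′ with ++-split u u′ (suc-injective l) e′
...   | refl , e″ = refl , e″

toList-injective : ∀ {m} {x y : Vec Bool m} → toList x ≡ toList y → x ≡ y
toList-injective {x = x} {y} e = trans (sym (Vecₚ.cast-is-id refl x)) (Vecₚ.toList-injective refl x y e)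

nonempty : ∀ {m} (x y : Vec Bool m) → x ≢ y → 0 < m
nonempty [] [] ne      = contradiction refl ne
nonempty (_ ∷ _) _ _   = s≤s z≤n

differ-≢ : ∀ {m} {x y : Vec Bool m} → x ≢ y → differ (toList x) (toList y) ≡ true
differ-≢ {x = x} {y} ne with differ (toList x) (toList y) in e
... | true  = refl
... | false = contradiction (toList-injective (differ-false (toList x) (toList y) (trans (Vecₚ.length-toList x) (sym (Vecₚ.length-toList y))) e)) ne

differ-≡ : ∀ {m} {x y : Vec Bool m} → x ≡ y → differ (toList x) (toList y) ≡ false
differ-≡ {x = x} refl = differ-refl (toList x)

differ-true⇒≢ : ∀ {m} {x y : Vec Bool m} → differ (toList x) (toList y) ≡ true → x ≢ y
differ-true⇒≢ {x = x} e refl with trans (sym e) (differ-refl (toList x))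
... | ()

differ-false⇒≡ : ∀ {m} {x y : Vec Bool m} → differ (toList x) (toList y) ≡ false → x ≡ y
differ-false⇒≡ {x = x} {y} e =
  toList-injective (differ-false (toList x) (toList y) (trans (Vecₚ.length-toList x) (sym (Vecₚ.length-toList y))) e)

toList-if : ∀ {m} t {x y : Vec Bool m} → toList (if t then x else y) ≡ pick t (toList x) (toList y)
toList-if false = refl
toList-if true  = refl

length-selfDelim : ∀ u → length (selfDelim u) ≡ suc (length u + length u)
length-selfDelim []      = refl
length-selfDelim (b ∷ u) = cong suc (trans (cong suc (length-selfDelim u)) (cong suc (sym (+-suc (length u) (length u)))))

-- s, t and t′ are the chosen bits of the colours of ax, ab and ac: the endpoint selected by s disagrees with s.
endpoint : ∀ {A : Set} (b c : A) s t t′ → t ≡ not t′ →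
           ((if s then (if t then c else b) else (if t then b else c)) ≡ b × t ≢ s) ⊎
           ((if s then (if t then c else b) else (if t then b else c)) ≡ c × t′ ≢ s)
endpoint b c true true false refl  = inj₂ (refl , λ ())
endpoint b c true false true refl  = inj₁ (refl , λ ())
endpoint b c false true false refl = inj₁ (refl , λ ())
endpoint b c false false true refl = inj₂ (refl , λ ())

-- Opaque, lest conversion checking run the programs.
opaque

  computes : P 2 → BitString → BitString
  computes p = Machine.result 20 p rO

  computes-polyTime : ∀ p → PolyTime (computes p)
  computes-polyTime p = Machine.polyTime 20 p rO

  computes-polyTime₂ : ∀ p → PolyTime₂ (λ x y → computes p (pairEnc x y))
  computes-polyTime₂ p = Machine.polyTime₂ 20 p rO

  computes≡ : ∀ p x {r τ} → Exec (length x) p (x ∷ Vec.replicate 21 []) r τ → computes p x ≡ lookup τ rO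
  computes≡ p x (exec e) = cong (λ s → lookup (proj₂ s) rO) e

module _ (n l : ℕ) (Gs : Gates (2 * n + 2 * n) l) (out : Vec (Fin l) n) (a b c : Vec Bool (2 * n)) where

  private
    I : WSInstance
    I = wsInst n (circuit l Gs out) a b c

    gs : List UGate
    gs = erase Gs

    os : List ℕ
    os = wiresOf out

    d : ℕ
    d = 2 * n

    V : Set
    V = Vec Bool d

    len : ∀ (x : V) → length (toList x) ≡ d
    len = Vecₚ.length-toList

    input : BitString → BitString
    input t = encℕ n ++ (encℕ l ++ (encUs gs ++ false ∷ (encOuts os ++ (toList a ++ (toList b ++ (toList c ++ t))))))

    encWS≡ : encWS I ≡ input []
    encWS≡ = cong (encℕ n ++_) (trans (++-assoc (encℕ l) _ _) (cong (encℕ l ++_)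
      (trans (cong₂ (λ u v → (u ++ v) ++ (toList a ++ (toList b ++ toList c))) (encGates-erase Gs) (encOuts-erase (toList out)))
      (trans (++-assoc (encUs gs ++ [ false ]) (encOuts os) _) (trans (++-assoc (encUs gs) [ false ] _)
        (cong (λ u → encUs gs ++ false ∷ (encOuts os ++ (toList a ++ (toList b ++ u)))) (sym (++-identityʳ (toList c)))))))))

    size : length (input []) ≡ suc n + (suc l + (length (encUs gs) + suc (length (encOuts os) + (d + (d + d)))))
    size = trans (length-++ (encℕ n)) (cong₂ _+_ (length-encℕ n) (trans (length-++ (encℕ l)) (cong₂ _+_ (length-encℕ l)
      (trans (length-++ (encUs gs)) (cong (λ k → length (encUs gs) + suc k) (trans (length-++ (encOuts os)) (cong (length (encOuts os) +_)
        (trans (length-++ (toList a)) (cong₂ _+_ (len a) (trans (length-++ (toList b)) (cong₂ _+_ (len b)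
          (trans (length-++ (toList c)) (trans (cong (_+ 0) (len c)) (+-identityʳ d))))))))))))))

    module _ {N : ℕ} (h : length (input []) ≤ N) where

      -- All bounds are read off the length of the encoded instance: `r` names the other summands,
      -- and the ring solver checks the rearrangement.
      part : ∀ {k} r → suc n + (suc l + (length (encUs gs) + suc (length (encOuts os) + (d + (d + d))))) ≡ k + r → k ≤ N
      part {k} r e = ≤-trans (m≤m+n k r) (≤-trans (≤-reflexive (trans (sym e) (sym size))) h)

      offset<N : suc d + l < N
      offset<N = part (n + (length (encUs gs) + suc (length (encOuts os) + (d + d)))) (shape n l (length (encUs gs)) (length (encOuts os)) d)
        where
        shape : ∀ n l g o d → suc n + (suc l + (g + suc (o + (d + (d + d))))) ≡ suc (suc d + l) + (n + (g + suc (o + (d + d))))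
        shape = solve-∀

      -- Being even and positive, d is at least 2, so the three nodes alone occupy six bits.
      large : 0 < d → 5 < N
      large 0<d = ≤-trans (+-mono-≤ 2≤d (+-mono-≤ 2≤d 2≤d)) (part (suc n + (suc l + (length (encUs gs) + suc (length (encOuts os)))))
        (shape n l (length (encUs gs)) (length (encOuts os)) d))
        where
        2≤d : 2 ≤ d
        2≤d = even n 0<d
          where
          even : ∀ n → 0 < 2 * n → 2 ≤ 2 * n
          even (suc n) _ = *-monoʳ-≤ 2 (s≤s z≤n)
        shape : ∀ n l g o d → suc n + (suc l + (g + suc (o + (d + (d + d))))) ≡ (d + (d + d)) + (suc n + (suc l + (g + suc o)))
        shape = solve-∀

      bounds : Bounds N n l gs os
      bounds = record
        { nodes<N = ≤-trans (s≤s (≤-trans (n≤1+n d) (m≤m+n (suc d) l))) offset<N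
        ; width<N = l<N
        ; gates<N = subst (λ k → suc k ≤ N) (sym (trans (length-++ (encUs gs)) (+-comm _ 1)))
            (part (n + (suc l + (length (encOuts os) + (d + (d + d))))) (shape₁ n l (length (encUs gs)) (length (encOuts os)) d))
        ; outs<N  = part (suc n + (suc l + (length (encUs gs) + (d + (d + d))))) (shape₂ n l (length (encUs gs)) (length (encOuts os)) d)
        ; wires<N = subst (_< N) (erase-width Gs) l<N
        ; number  = wiresOf-length out }
        where
        l<N : l < N
        l<N = ≤-trans (s≤s (m≤n+m l (suc d))) offset<N
        shape₁ : ∀ n l g o d → suc n + (suc l + (g + suc (o + (d + (d + d))))) ≡ suc (suc g) + (n + (suc l + (o + (d + (d + d)))))
        shape₁ = solve-∀
        shape₂ : ∀ n l g o d → suc n + (suc l + (g + suc (o + (d + (d + d))))) ≡ suc o + (suc n + (suc l + (g + (d + (d + d)))))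
        shape₂ = solve-∀

    shade≡ : ∀ x y → colourU gs os (toList x ++ toList y) ≡ toList (colour I x y)
    shade≡ x y = trans (cong (colourU gs os) (sym (Vecₚ.toList-++ x y))) (sym (eval-erase Gs out (x Vec.++ y)))

    open Colouring {V} {Vec Bool n} (Vecₚ.≡-dec _≟ᵇ_) (Vecₚ.≡-dec _≟ᵇ_) (colour I)

    differing : WSPromise I → colourU gs os (toList a ++ toList b) ≢ colourU gs os (toList a ++ toList c)
    differing (_ , _ , _ , ab≢ac) e = ab≢ac (toList-injective (trans (sym (shade≡ a b)) (trans e (shade≡ a c))))

    reduced : WSPromise I → Reduced (length (input [])) n l gs os (toList a) (toList b) (toList c)
    reduced promise = Reduction.reduction! (bounds ≤-refl) (toList a) (toList b) (toList c) (len a) (len b) (len c)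
      (wiresOf-valid out) (offset<N ≤-refl) (differing promise)

    module Solve (promise : WSPromise I) (R : Reduced (length (input [])) n l gs os (toList a) (toList b) (toList c)) where

      open Reduced R renaming (position to j)

      a≢b : a ≢ b
      a≢b = proj₁ promise

      a≢c : a ≢ c
      a≢c = proj₁ (proj₂ promise)

      0<d : 0 < d
      0<d = nonempty a b a≢b

      t : Bool
      t = nth (colourU gs os (toList a ++ toList b)) j

      p q : V
      p = if t then b else c
      q = if t then c else b

      module C = PigeonCircuit gs os d l 0<d (erase-width Gs) (erase-wellFormed Gs) (wiresOf-valid out)
        (toList a) (toList p) (toList q) (len a) (len p) (len q) j position<

      circuitGates : Σ[ hs ∈ Gates d (d + suc (l + (l + 0))) ] erase hs ≡ C.gates
      circuitGates = typed C.gates C.gates-wellFormed C.gates-width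

      circuitOuts : Σ[ vs ∈ Vec (Fin (d + suc (l + (l + 0)))) d ] wiresOf vs ≡ pigeonOuts d l os
      circuitOuts = typedOuts (pigeonOuts d l os) C.outs-valid
        (trans C.outs-length (cong₂ _+_ (wiresOf-length out) (trans (wiresOf-length out) (sym (+-identityʳ n)))))

      pigeons : PigeonInstance
      pigeons = pigInst d (circuit (d + suc (l + (l + 0))) (proj₁ circuitGates) (proj₁ circuitOuts)) (Vec.replicate d false)

      reduction≡ : computes reduction (input []) ≡ encPigeon pigeons
      reduction≡ = trans (computes≡ reduction (input []) executed)
        (trans emitted
        (trans (cong₂ (reductionOutput d l gs os (toList a) (nthℕ os j)) (sym (toList-if t)) (sym (toList-if t)))
        (trans (reductionOutput≡ d l gs os (toList a) (nthℕ os j) (toList p) (toList q))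
          (cong (encℕ d ++_) (cong₂ _++_ (cong (encℕ (d + suc (l + (l + 0))) ++_) (cong₂ _++_
              (sym (trans (encGates-erase (proj₁ circuitGates)) (cong (λ hs → encUs hs ++ [ false ]) (proj₂ circuitGates))))
              (sym (trans (encOuts-erase (toList (proj₁ circuitOuts))) (cong encOuts (proj₂ circuitOuts))))))
            (sym (Vecₚ.toList-replicate d false)))))))

      outsider : V → V
      outsider x = if nth (toList (colour I a x)) j then q else p

      value≡ : ∀ x → toList (eval (PigeonInstance.f pigeons) x) ≡ toList (colour I a x) ++ toList (colour I (outsider x) x)
      value≡ x = trans (eval-erase (proj₁ circuitGates) (proj₁ circuitOuts) x)
        (trans (cong₂ (λ hs vs → colourU hs vs (toList x)) (proj₂ circuitGates) (proj₂ circuitOuts))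
        (trans (C.value (toList x) (len x)) (cong₂ _++_ (shade≡ a x)
          (trans (cong (λ w → C.colours w (toList x)) outsider≡) (shade≡ (outsider x) x)))))
        where
        outsider≡ : C.outsider (toList x) ≡ toList (outsider x)
        outsider≡ = trans (cong (λ u → pick (nth u j) (toList q) (toList p)) (shade≡ a x)) (sym (toList-if (nth (toList (colour I a x)) j)))

      outsider-spec : ∀ x → (outsider x ≡ b ⊎ outsider x ≡ c) × colour I a (outsider x) ≢ colour I a x
      outsider-spec x with endpoint b c (nth (toList (colour I a x)) j) t (nth (colourU gs os (toList a ++ toList c)) j) differs
      ... | inj₁ (w≡b , t≢s) = inj₁ w≡b , λ e → t≢s (trans (cong (λ u → nth u j) (shade≡ a b))
        (cong (λ v → nth (toList v) j) (trans (cong (colour I a) (sym w≡b)) e)))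
      ... | inj₂ (w≡c , t≢s) = inj₂ w≡c , λ e → t≢s (trans (cong (λ u → nth u j) (shade≡ a c))
        (cong (λ v → nth (toList v) j) (trans (cong (colour I a) (sym w≡c)) e)))

      outsider≢a : ∀ x → outsider x ≢ a
      outsider≢a x e with proj₁ (outsider-spec x)
      ... | inj₁ w≡b = a≢b (trans (sym e) w≡b)
      ... | inj₂ w≡c = a≢c (trans (sym e) w≡c)

      colours-length : ∀ (u v : Vec Bool n) → length (toList u) ≡ length (toList v)
      colours-length u v = trans (Vecₚ.length-toList u) (sym (Vecₚ.length-toList v))

      value : V → V
      value = eval (PigeonInstance.f pigeons)

      preimage-colours : ∀ x → value x ≡ Vec.replicate d false → colour I a x ≡ colour I (outsider x) x
      preimage-colours x e = toList-injective (trans (proj₁ halves) (trans (cong (λ m → replicate m false) (sym (+-identityʳ n))) (sym (proj₂ halves))))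
        where
        halves : toList (colour I a x) ≡ replicate n false × toList (colour I (outsider x) x) ≡ replicate (n + 0) false
        halves = ++-split (toList (colour I a x)) (replicate n false)
          (trans (Vecₚ.length-toList (colour I a x)) (sym (length-replicate n)))
          (trans (sym (value≡ x)) (trans (cong toList e) (trans (Vecₚ.toList-replicate d false) (replicate-+ n (n + 0) false))))

      -- The outsider depends on the node only through its colour with a, so equal first halves make
      -- x and y share their outsider.
      collision-colours : ∀ x y → value x ≡ value y → colour I a x ≡ colour I a y × colour I (outsider x) x ≡ colour I (outsider x) y
      collision-colours x y e = toList-injective (proj₁ halves) , trans (toList-injective (proj₂ halves))
          (cong (λ u → colour I (if nth u j then q else p) y) (sym (proj₁ halves)))
        where
        halves : toList (colour I a x) ≡ toList (colour I a y) × toList (colour I (outsider x) x) ≡ toList (colour I (outsider y) y)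
        halves = ++-split (toList (colour I a x)) (toList (colour I a y)) (colours-length (colour I a x) (colour I a y))
          (trans (sym (value≡ x)) (trans (cong toList e) (value≡ y)))

      module Search {N : ℕ} (h : length (input []) ≤ N) (x y : V) where

        module G = Recovery (bounds h) (toList a) (toList b) (toList c) (len a) (len b) (len c)

        Matches : Candidate → Set
        Matches = G.Matches (toList x) (toList y) (len x) (len y)

        node : Node → V
        node nodeA = a
        node nodeB = b
        node nodeC = c
        node nodeX = x
        node nodeY = y

        value-node : ∀ k → G.value (toList x) (toList y) (len x) (len y) k ≡ toList (node k)
        value-node nodeA = refl
        value-node nodeB = refl
        value-node nodeC = refl
        value-node nodeX = refl
        value-node nodeY = refl

        triangle-matches : ∀ k m o → Triangle (node k) (node m) (node o) → Matches (tri k m o)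
        triangle-matches k m o (km , ko , mo , same , other)
          rewrite value-node k | value-node m | value-node o | shade≡ (node k) (node m) | shade≡ (node k) (node o) | shade≡ (node m) (node o)
                | differ-≢ km | differ-≢ ko | differ-≢ mo | differ-≡ same | differ-≢ other = refl

        asymmetric-matches : ∀ k m → Asymmetric (node k) (node m) → Matches (asy k m)
        asymmetric-matches k m (km , other)
          rewrite value-node k | value-node m | shade≡ (node k) (node m) | shade≡ (node m) (node k)
                | differ-≢ km | differ-≢ other = refl

        solution : ∀ k → Matches k → Σ[ σ ∈ WSSolution I ] G.encoding (toList x) (toList y) (len x) (len y) k ≡ encWSSol σ
        solution (tri k m o) e
          rewrite value-node k | value-node m | value-node o | shade≡ (node k) (node m) | shade≡ (node k) (node o) | shade≡ (node m) (node o)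
          with ∷-injective e
        ... | e₁ , r₁ with ∷-injective r₁
        ...   | e₂ , r₂ with ∷-injective r₂
        ...     | e₃ , r₃ with ∷-injective r₃
        ...       | e₄ , r₄ with ∷-injective r₄
        ...         | e₅ , _ = triangle (node k) (node m) (node o) (differ-true⇒≢ e₁) (differ-true⇒≢ e₂) (differ-true⇒≢ e₃)
                                 (differ-false⇒≡ e₄) (differ-true⇒≢ e₅) , refl
        solution (asy k m) e
          rewrite value-node k | value-node m | shade≡ (node k) (node m) | shade≡ (node m) (node k)
          with ∷-injective e
        ... | e₁ , r₁ with ∷-injective r₁
        ...   | e₂ , _ = asymm (node k) (node m) (differ-true⇒≢ e₁) (differ-true⇒≢ e₂) , refl

        Unsolved : V → Set
        Unsolved w = ¬ Triangle w x y × ¬ Triangle w a x × ¬ Triangle w a y × ¬ Triangle x a w × ¬ Asymmetric a w × ¬ Asymmetric w x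

        unsolved : All (¬_ ∘ Matches) candidates → ¬ Triangle a x y × ¬ Asymmetric a x × (∀ {w} → w ≡ b ⊎ w ≡ c → Unsolved w)
        unsolved (axy ∷ ax ∷ b₁ ∷ b₂ ∷ b₃ ∷ b₄ ∷ b₅ ∷ b₆ ∷ c₁ ∷ c₂ ∷ c₃ ∷ c₄ ∷ c₅ ∷ c₆ ∷ []) =
          axy ∘ triangle-matches nodeA nodeX nodeY , ax ∘ asymmetric-matches nodeA nodeX , λ
            { (inj₁ refl) → b₁ ∘ triangle-matches nodeB nodeX nodeY , b₂ ∘ triangle-matches nodeB nodeA nodeX
                          , b₃ ∘ triangle-matches nodeB nodeA nodeY , b₄ ∘ triangle-matches nodeX nodeA nodeB
                          , b₅ ∘ asymmetric-matches nodeA nodeB , b₆ ∘ asymmetric-matches nodeB nodeX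
            ; (inj₂ refl) → c₁ ∘ triangle-matches nodeC nodeX nodeY , c₂ ∘ triangle-matches nodeC nodeA nodeX
                          , c₃ ∘ triangle-matches nodeC nodeA nodeY , c₄ ∘ triangle-matches nodeX nodeA nodeC
                          , c₅ ∘ asymmetric-matches nodeA nodeC , c₆ ∘ asymmetric-matches nodeC nodeX }

        Searched : Set
        Searched = Σ[ σ ∈ WSSolution I ] Σ[ τ ∈ State 22 ]
          Exec N (tryAll candidates) (core [] [] [] [] [] [] [] [] [] (G.registers (toList x) (toList y) (len x) (len y) [] [] [])) false τ ×
          lookup τ rO ≡ encWSSol σ

        -- The combinatorial argument merely refutes that all candidates fail. The witness comes
        -- from `tryAll!`, which decides them one by one.
        searched : ¬ All (¬_ ∘ Matches) candidates → Searched
        searched some = conclude (G.tryAll! (toList x) (toList y) (len x) (len y) (large h 0<d) candidates)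
          where
          conclude : All (¬_ ∘ Matches) candidates ⊎ (Σ[ k ∈ Candidate ] Matches k × Σ[ τ ∈ State 22 ]
            Exec N (tryAll candidates) (core [] [] [] [] [] [] [] [] [] (G.registers (toList x) (toList y) (len x) (len y) [] [] [])) false τ ×
            lookup τ rO ≡ G.encoding (toList x) (toList y) (len x) (len y) k) → Searched
          conclude (inj₁ none)              = contradiction none some
          conclude (inj₂ (k , m , τ , E , o)) = proj₁ (solution k m) , τ , E , trans o (proj₂ (solution k m))

        preimage-solvable : value x ≡ Vec.replicate d false → ¬ All (¬_ ∘ Matches) candidates
        preimage-solvable e none = conclude (unsolved none)
          where
          conclude : ¬ Triangle a x y × ¬ Asymmetric a x × (∀ {w} → w ≡ b ⊎ w ≡ c → Unsolved w) → ⊥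
          conclude (_ , ¬ax , around) = conclude′ (around (proj₁ (outsider-spec x)))
            where
            conclude′ : Unsolved (outsider x) → ⊥
            conclude′ (_ , _ , _ , ¬xaw , ¬aw , ¬wx) =
              same-colour (outsider≢a x) ¬aw (preimage-colours x e) (proj₂ (outsider-spec x)) ¬xaw ¬wx ¬ax

        collision-solvable : x ≢ y → value x ≡ value y → ¬ All (¬_ ∘ Matches) candidates
        collision-solvable x≢y e none = conclude (unsolved none)
          where
          conclude : ¬ Triangle a x y × ¬ Asymmetric a x × (∀ {w} → w ≡ b ⊎ w ≡ c → Unsolved w) → ⊥
          conclude (¬axy , ¬ax , around) = conclude′ (around (proj₁ (outsider-spec x)))
            where
            conclude′ : Unsolved (outsider x) → ⊥
            conclude′ (¬wxy , ¬wax , ¬way , ¬xaw , ¬aw , ¬wx) =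
              collision-solved (outsider≢a x) ¬aw x≢y (proj₁ (collision-colours x y e)) (proj₂ (collision-colours x y e))
                (proj₂ (outsider-spec x)) ¬axy ¬wxy ¬wax ¬way ¬xaw ¬wx ¬ax

      -- `selfDelim` doubles the instance and adds a bit, which leaves the room on the clock that
      -- `decode!` asks for.
      paired : ∀ t → length (input [] ++ t) < length (pairEnc (input []) t)
      paired t = subst₂ _<_ (sym (length-++ (input []))) (sym (trans (length-++ (selfDelim (input []))) (cong (_+ length t) (length-selfDelim (input [])))))
        (s≤s (+-monoˡ-≤ (length t) (m≤m+n (length (input [])) _)))

      input≤ : ∀ t → length (input []) ≤ length (pairEnc (input []) t)
      input≤ t = ≤-trans (prefix-bound (input []) {t} ≤-refl) (<⇒≤ (paired t))

      instance≡ : input [] ≡ encℕ n ++ (encℕ l ++ (encUs gs ++ false ∷ (encOuts os ++ (toList a ++ (toList b ++ toList c)))))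
      instance≡ = cong (λ u → encℕ n ++ (encℕ l ++ (encUs gs ++ false ∷ (encOuts os ++ (toList a ++ (toList b ++ u)))))) (++-identityʳ (toList c))

      Recovered : BitString → Set
      Recovered u = Σ[ ρ ∈ WSSolution I ] computes recovery (pairEnc (input []) u) ≡ encWSSol ρ

      recovered-preimage : ∀ x → value x ≡ Vec.replicate d false → Recovered (false ∷ toList x)
      recovered-preimage x e = conclude (Search.searched (input≤ u) x x (Search.preimage-solvable (input≤ u) x x e))
        where
        u : BitString
        u = false ∷ toList x
        conclude : Search.Searched (input≤ u) x x → Recovered u
        conclude (ρ , τ , E , o) = ρ , trans (computes≡ recovery (pairEnc (input []) u) execution) o
          where
          execution : Exec (length (pairEnc (input []) u)) recovery (pairEnc (input []) u ∷ Vec.replicate 21 []) false τ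
          execution = subst₂ (λ v w → Exec (length (pairEnc (input []) u)) recovery (pairEnc v (false ∷ w) ∷ Vec.replicate 21 []) false τ)
            (sym instance≡) (++-identityʳ (toList x))
            (Search.G.preimage-recovery! (input≤ u) x x (toList x) (len x)
              (subst₂ (λ v w → length (v ++ false ∷ w) < length (pairEnc (input []) u)) instance≡ (sym (++-identityʳ (toList x))) (paired u)) E)

      recovered-collision : ∀ x y → x ≢ y → value x ≡ value y → Recovered (true ∷ toList x ++ toList y)
      recovered-collision x y x≢y e = conclude (Search.searched (input≤ u) x y (Search.collision-solvable (input≤ u) x y x≢y e))
        where
        u : BitString
        u = true ∷ toList x ++ toList y
        conclude : Search.Searched (input≤ u) x y → Recovered u
        conclude (ρ , τ , E , o) = ρ , trans (computes≡ recovery (pairEnc (input []) u) execution) o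
          where
          execution : Exec (length (pairEnc (input []) u)) recovery (pairEnc (input []) u ∷ Vec.replicate 21 []) false τ
          execution = subst₂ (λ v w → Exec (length (pairEnc (input []) u)) recovery (pairEnc v (true ∷ (toList x ++ w)) ∷ Vec.replicate 21 []) false τ)
            (sym instance≡) (++-identityʳ (toList y))
            (Search.G.collision-recovery! (input≤ u) x y (toList x) (toList y) (len x) (len y)
              (subst₂ (λ v w → length (v ++ true ∷ (toList x ++ w)) < length (pairEnc (input []) u)) instance≡ (sym (++-identityʳ (toList y))) (paired u)) E)

      recovered : ∀ (σ : PigeonSolution pigeons) → Recovered (encPigeonSol σ)
      recovered (preimage x e)        = recovered-preimage x e
      recovered (collision x y x≢y e) = recovered-collision x y x≢y e

  correct : ∀ t → Pigeon (computes reduction (encWS I)) t → WSPromise I →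
            Σ[ ρ ∈ WSSolution I ] computes recovery (pairEnc (encWS I) t) ≡ encWSSol ρ
  correct t sol promise = subst (λ s → Σ[ ρ ∈ WSSolution I ] computes recovery (pairEnc s t) ≡ encWSSol ρ) (sym encWS≡)
    -- `sol` speaks about every instance encoded by the emitted string; it is applied to the one
    -- constructed in `Solve`.
    (conclude (sol (Solve.pigeons promise R) (trans (cong (computes reduction) encWS≡) (Solve.reduction≡ promise R))))
    where
    R : Reduced (length (input [])) n l gs os (toList a) (toList b) (toList c)
    R = reduced promise
    conclude : Σ[ σ ∈ PigeonSolution (Solve.pigeons promise R) ] t ≡ encPigeonSol σ → Solve.Recovered promise R t
    conclude (σ , t≡) = subst (Solve.Recovered promise R) (sym t≡) (Solve.recovered promise R σ)

theorem3 : InPPP WardSzabo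
theorem3 = computes reduction , (λ x y → computes recovery (pairEnc x y)) , computes-polyTime reduction , computes-polyTime₂ recovery ,
  λ { x y sol (wsInst n (circuit l gs out) a b c) refl promise → correct n l gs out a b c y sol promise }
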